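{- Let $p\ge 7$ be a prime. Then, modulo $p^4$ (in $\mathbb{Z}_p$): (i) if $n$ is an integer with $4\le 2n\le p-7$, $$A^\star_{2n}\equiv-A_{p-1-2n}+p^2w_p(1+pw_p)\mathcal{B}_{p-1-2n}-\frac{p^3w_p}{2}\,\mathcal{C}(p-1-2n);$$ (ii) $A^\star_2\equiv-A_{p-3}+p^2w_p\big(2\mathcal{B}_{p-3}-\mathcal{B}_{2p-4}\big)$; (iii) if moreover $p\ge 11$, $$A^\star_{p-5}\equiv\frac{1}{8}\Big(\frac{5p^3}{4}-\frac{p}{15}-\frac{p^2}{36}\Big)+\frac{p\,w_p}{120}\Big(\frac{7p^2}{12}-p\big(1+p\,(pB_{p-1})_1\big)\Big);$$ (iv) $A^\star_{p-3}\equiv\frac{1}{24}\Big(p(2p-1)(5p-2)+p\,w_p\big(2p-11p^2+2p^2(pB_{p-1})_1\big)\Big)$; (v) $A^\star_{p-1}\equiv-1+p\,w_p\Big(3(p\mathcal{B}_{p-1}-1)-p\mathcal{B}_{2(p-1)}-\frac{1}{2}p^2\mathcal{B}_{p-1}^2\Big)$.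
   Context: $A_k:=\sum_{1\le i_1<\dots<i_k\le p-1}i_1\cdots i_k$ and $A^\star_k:=\sum_{1\le i_1<\dots<i_k\le p-1}\frac{1}{i_1\cdots i_k}$ (multiple harmonic sum). $w_p:=\frac{(p-1)!+1}{p}$ is the Wilson quotient. $B_n$ is the $n$-th Bernoulli number, $\mathcal{B}_n:=B_n/n$, and for even $m\ge4$, $\mathcal{C}(m):=\sum_{i=2}^{m-2}\mathcal{B}_i\mathcal{B}_{m-i}$. $(pB_{p-1})_1$ denotes the Agoh–Giuga quotient $(pB_{p-1}+1)/p\in\mathbb{Z}_p$. $x\equiv y\pmod{p^4}$ means $x-y\in p^4\mathbb{Z}_p$. -}

module Defs where

open import Data.Nat as ℕ using (ℕ; zero; suc; _∸_; _!)
open import Data.Nat.Divisibility using (_∣_)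
open import Data.Nat.Combinatorics using (_C_)
open import Data.Integer as ℤ using (ℤ; +_)
open import Data.Rational using (ℚ; _/_; _+_; _*_; _-_; -_; ↥_; ↧ₙ_; 0ℚ; 1ℚ)
open import Data.List as List using (List; []; _∷_; upTo)
open import Data.Vec as Vec using (Vec; _∷ʳ_)
open import Data.Fin using (toℕ)
open import Data.Product using (_×_)
open import Relation.Nullary using (¬_)

ℕ→ℚ : ℕ → ℚ
ℕ→ℚ n = + n / 1

sumℚ : List ℚ → ℚ
sumℚ = List.foldr _+_ 0ℚ

-- Bernoulli numbers B_0, ..., B_n via  Σ_{k=0}^{n} C(n+1,k) B_k = 0 (n ≥ 1), B_0 = 1
-- (so B_1 = -1/2)
bernVec : (n : ℕ) → Vec ℚ (suc n)
bernVec zero = 1ℚ Vec.∷ Vec.[]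
bernVec (suc n) = bs ∷ʳ next
  where
  bs : Vec ℚ (suc n)
  bs = bernVec n
  next : ℚ
  next = - ((+ 1 / suc (suc n)) *
           Vec.foldr _ _+_ 0ℚ
             (Vec.zipWith (λ k b → ℕ→ℚ (suc (suc n) C k) * b)
                          (Vec.tabulate toℕ) bs))

B : ℕ → ℚ
B n = Vec.last (bernVec n)

-- 𝓑 n = B_n / n  (only used for n ≥ 1; the value at 0 is irrelevant)
𝓑 : ℕ → ℚ
𝓑 zero = 0ℚ
𝓑 (suc n) = B (suc n) * (+ 1 / suc n)

𝓒 : ℕ → ℚ
𝓒 m = sumℚ (List.map (λ j → 𝓑 (suc (suc j)) * 𝓑 (m ∸ suc (suc j))) (upTo (m ∸ 3)))

esym : ℕ → List ℚ → ℚ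
esym zero    _        = 1ℚ
esym (suc k) []       = 0ℚ
esym (suc k) (x ∷ xs) = x * esym k xs + esym (suc k) xs

A : (p k : ℕ) → ℚ
A p k = esym k (List.map (λ i → ℕ→ℚ (suc i)) (upTo (p ∸ 1)))

A⋆ : (p k : ℕ) → ℚ
A⋆ p k = esym k (List.map (λ i → + 1 / suc i) (upTo (p ∸ 1)))

w : (p : ℕ) → .{{_ : ℕ.NonZero p}} → ℚ
w p = + (((p ∸ 1) !) ℕ.+ 1) / p

AG : (p : ℕ) → .{{_ : ℕ.NonZero p}} → ℚ
AG p = (ℕ→ℚ p * B (p ∸ 1) + 1ℚ) * (+ 1 / p)

-- x ≡ y (mod p^k) in ℤ_p : x - y ∈ p^k ℤ_p, i.e. writing x - y in lowest
-- terms, p^k divides the numerator and p does not divide the denominator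
infix 4 _≡_[mod_^_]
_≡_[mod_^_] : ℚ → ℚ → ℕ → ℕ → Set
x ≡ y [mod p ^ k ] = (p ℕ.^ k) ∣ ℤ.∣ ↥ (x - y) ∣ × ¬ (p ∣ ↧ₙ (x - y))

-- Write W = (p − 1)! = z − 1 with z = p w. Then A⋆ₖ W = A_{p−1−k}, so A⋆ₖ = −Aₘ + z A⋆ₖ with m = p − 1 − k,
-- and since p ∣ z it is enough to know Aₘ (or A⋆ₖ) modulo p³. Newton's identities express Aₘ through the power
-- sums Sᵢ of 1, …, p − 1, and Faulhaber's formula gives Sᵢ ≡ p Bᵢ modulo p² or p³; the products Sᵢ A_{m−i}
-- produce the convolution 𝓒(m), which is (i). For (iii) and (iv), Aₘ is an explicit polynomial in p. For (v),
-- and for the congruence AG ≡ w + 1 (mod p), the product of the i^{p−1} ≡ 1 (mod p), which is W^{p−1}, is expanded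
-- to second order and compared with S_{p−1} and S_{2p−2}. For (ii), A⋆₂ ≡ −½ Σ i⁻² (mod p³), and a Kummer congruence
-- Y₀ − 2 Y₁ + Y₂ ≡ 0 (mod p³) relates the values Yⱼ = Σ iⁿ / n at n = −2 + j (p − 1); it follows by
-- comparing Σ iⁿ with Σ (2i)ⁿ, as doubling permutes the residues modulo p.

module Submission where

open import Defs
open import Data.Nat as ℕ using (ℕ; zero; suc; _≤_; _<_; _∸_; _!; z≤n; s≤s)
open import Data.Nat.Primality using (Prime; euclidsLemma; prime⇒irreducible)
open import Data.Integer as ℤ using (ℤ; +_)
open import Data.Rational as ℚ using (ℚ; mkℚ; _/_; _+_; _*_; _-_; -_; 0ℚ; 1ℚ; ↥_; ↧ₙ_)
open import Data.Product using (_×_; _,_; ∃; proj₁; proj₂)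
open import Data.Sum using (_⊎_; inj₁; inj₂; [_,_]′)
open import Data.Empty using (⊥-elim)
open import Data.Maybe using (Maybe; just; nothing)
open import Data.Fin using (toℕ)
import Data.Vec as Vec
import Data.Vec.Properties as VecP
open import Data.List as List using (List; []; _∷_; _∷ʳ_; upTo; applyUpTo; length; map; foldr)
import Data.List.Properties as ListP
import Data.Nat.Properties as ℕP
import Data.Nat.DivMod as ℕD
open import Data.Nat.Divisibility as ∣ using (_∣_; _∣?_; divides)
open import Data.Nat.Combinatorics using (_C_; k![n∸k]!∣n!)
open import Data.Nat.Combinatorics.Specification using (nCk≡n!/k![n-k]!)
import Data.Nat.Coprimality as Coprime
open import Data.Nat.Induction using (<-rec)
import Data.Nat.Tactic.RingSolver as ℕR
import Data.Integer.Properties as ℤP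
import Data.Rational.Properties as ℚP
import Data.Rational.Unnormalised as ℚᵘ
import Data.Rational.Unnormalised.Properties as ℚᵘP
open import Algebra using (CommutativeRing)
open import Algebra.Properties.CommutativeSemiring.Exp (CommutativeRing.commutativeSemiring ℚP.+-*-commutativeRing) using (_^_; ^-homo-*; ^-distrib-*; ^-assocʳ)
open import Relation.Nullary using (¬_; yes; no)
open import Relation.Binary.PropositionalEquality using (_≡_; refl; sym; trans; cong; cong₂; subst; subst₂; module ≡-Reasoning)
open import Tactic.RingSolver using (solve-∀)
open import Tactic.RingSolver.Core.AlmostCommutativeRing using (AlmostCommutativeRing; fromCommutativeRing)

-- The embedding of the integers in ℚ

-- The obstacle is denominators. Faulhaber's expansion of Sₙ contains Bernoulli numbers that may
-- have p in the denominator, and quotients p^k / (k + 1) in which k + 1 may be a multiple of p. Two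
-- facts control both: p Bₙ is p-integral for every n, and p^k / (k + 1) is divisible by p^min(k, 3)
-- because p ≥ 7. For even n only the terms k = 1 and k = 2 then need care modulo p³: the former
-- vanishes with a Bernoulli number of odd index, the latter asks for one integral Bernoulli number,
-- which beyond p is obtained from Fermat's congruence for power sums. In the Kummer congruence the
-- normalisation by 1 / n makes the leading term of each doubling difference independent of n apart
-- from the power iⁿ itself. Writing i^(p-1) = 1 + ε, the second difference in the exponent yields
-- ε², and the doubling difference contributes a third p. Doubling loses nothing, since 1 - 2ⁿ ≡ 3/4
-- is a unit modulo p for these exponents.

ℚring : AlmostCommutativeRing _ _
ℚring = fromCommutativeRing ℚP.+-*-commutativeRing 0≟
  where
  0≟ : (x : ℚ) → Maybe (0ℚ ≡ x)
  0≟ x with 0ℚ ℚP.≟ x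
  ... | yes e = just e
  ... | no _ = nothing

ι : ℤ → ℚ
ι a = a / 1

toℚᵘ-/ : ∀ a d .{{_ : ℕ.NonZero d}} → ℚ.toℚᵘ (a / d) ℚᵘ.≃ (a ℚᵘ./ d)
toℚᵘ-/ a (suc d) = ℚP.toℚᵘ-fromℚᵘ (ℚᵘ.mkℚᵘ a d)

ι-+ : ∀ a b → ι (a ℤ.+ b) ≡ ι a + ι b
ι-+ a b = ℚP.toℚᵘ-injective (begin
  ℚ.toℚᵘ (ι (a ℤ.+ b))              ≈⟨ toℚᵘ-/ (a ℤ.+ b) 1 ⟩
  (a ℤ.+ b) ℚᵘ./ 1                  ≈⟨ ℚᵘ.*≡* (cong₂ ℤ._*_ (cong₂ ℤ._+_ (sym (ℤP.*-identityʳ a)) (sym (ℤP.*-identityʳ b))) refl) ⟩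
  (a ℚᵘ./ 1) ℚᵘ.+ (b ℚᵘ./ 1)        ≈⟨ ℚᵘP.+-cong (toℚᵘ-/ a 1) (toℚᵘ-/ b 1) ⟨
  ℚ.toℚᵘ (ι a) ℚᵘ.+ ℚ.toℚᵘ (ι b)    ≈⟨ ℚP.toℚᵘ-homo-+ (ι a) (ι b) ⟨
  ℚ.toℚᵘ (ι a + ι b)                ∎)
  where open ℚᵘP.≃-Reasoning

ι-* : ∀ a b → ι (a ℤ.* b) ≡ ι a * ι b
ι-* a b = ℚP.toℚᵘ-injective (begin
  ℚ.toℚᵘ (ι (a ℤ.* b))              ≈⟨ toℚᵘ-/ (a ℤ.* b) 1 ⟩
  (a ℤ.* b) ℚᵘ./ 1                  ≈⟨ ℚᵘP.*-cong (toℚᵘ-/ a 1) (toℚᵘ-/ b 1) ⟨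
  ℚ.toℚᵘ (ι a) ℚᵘ.* ℚ.toℚᵘ (ι b)    ≈⟨ ℚP.toℚᵘ-homo-* (ι a) (ι b) ⟨
  ℚ.toℚᵘ (ι a * ι b)                ∎)
  where open ℚᵘP.≃-Reasoning

/-*-cancel : ∀ a d .{{_ : ℕ.NonZero d}} → (a / d) * ℕ→ℚ d ≡ ι a
/-*-cancel a d@(suc _) = ℚP.toℚᵘ-injective (begin
  ℚ.toℚᵘ ((a / d) * ℕ→ℚ d)              ≈⟨ ℚP.toℚᵘ-homo-* (a / d) (ℕ→ℚ d) ⟩
  ℚ.toℚᵘ (a / d) ℚᵘ.* ℚ.toℚᵘ (ℕ→ℚ d)    ≈⟨ ℚᵘP.*-cong (toℚᵘ-/ a d) (toℚᵘ-/ (+ d) 1) ⟩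
  (a ℚᵘ./ d) ℚᵘ.* (+ d ℚᵘ./ 1)          ≈⟨ ℚᵘ.*≡* (trans (ℤP.*-identityʳ _) (cong (λ n → a ℤ.* + n) (sym (ℕP.*-identityʳ d)))) ⟩
  a ℚᵘ./ 1                              ≈⟨ toℚᵘ-/ a 1 ⟨
  ℚ.toℚᵘ (ι a)                          ∎)
  where open ℚᵘP.≃-Reasoning

ι-injective : ∀ {a b} → ι a ≡ ι b → a ≡ b
ι-injective {a} {b} e with ℚᵘP.≃-trans (ℚᵘP.≃-sym (toℚᵘ-/ a 1)) (ℚᵘP.≃-trans (ℚP.toℚᵘ-cong e) (toℚᵘ-/ b 1))
... | ℚᵘ.*≡* e' = trans (sym (ℤP.*-identityʳ a)) (trans e' (ℤP.*-identityʳ b))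

↥-* : ∀ x → x * ℕ→ℚ (↧ₙ x) ≡ ι (↥ x)
↥-* x@record{} = trans (cong (_* ℕ→ℚ (↧ₙ x)) (sym (ℚP.fromℚᵘ-toℚᵘ x))) (/-*-cancel (↥ x) (↧ₙ x))

ℕ→ℚ-+ : ∀ m n → ℕ→ℚ (m ℕ.+ n) ≡ ℕ→ℚ m + ℕ→ℚ n
ℕ→ℚ-+ m n = ι-+ (+ m) (+ n)

ℕ→ℚ-* : ∀ m n → ℕ→ℚ (m ℕ.* n) ≡ ℕ→ℚ m * ℕ→ℚ n
ℕ→ℚ-* m n = trans (cong ι (ℤP.pos-* m n)) (ι-* (+ m) (+ n))

ℕ→ℚ-suc : ∀ n → ℕ→ℚ (suc n) ≡ 1ℚ + ℕ→ℚ n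
ℕ→ℚ-suc = ℕ→ℚ-+ 1

ℕ→ℚ-∸ : ∀ {m n} → n ≤ m → ℕ→ℚ (m ∸ n) ≡ ℕ→ℚ m - ℕ→ℚ n
ℕ→ℚ-∸ {m} {n} n≤m = begin
  ℕ→ℚ (m ∸ n)                      ≡⟨ lemma (ℕ→ℚ (m ∸ n)) (ℕ→ℚ n) ⟩
  (ℕ→ℚ (m ∸ n) + ℕ→ℚ n) - ℕ→ℚ n    ≡⟨ cong (_- ℕ→ℚ n) (ℕ→ℚ-+ (m ∸ n) n) ⟨
  ℕ→ℚ (m ∸ n ℕ.+ n) - ℕ→ℚ n        ≡⟨ cong (λ k → ℕ→ℚ k - ℕ→ℚ n) (ℕP.m∸n+n≡m n≤m) ⟩
  ℕ→ℚ m - ℕ→ℚ n                    ∎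
  where
  open ≡-Reasoning
  lemma : ∀ x y → x ≡ (x + y) - y
  lemma = solve-∀ ℚring

1/-inverse : ∀ d .{{_ : ℕ.NonZero d}} → (+ 1 / d) * ℕ→ℚ d ≡ 1ℚ
1/-inverse = /-*-cancel (+ 1)

*-cancelʳ-ℕ→ℚ : ∀ d .{{_ : ℕ.NonZero d}} {x y} → x * ℕ→ℚ d ≡ y * ℕ→ℚ d → x ≡ y
*-cancelʳ-ℕ→ℚ d {x} {y} e = trans (expand x) (trans (cong (_* (+ 1 / d)) e) (sym (expand y)))
  where
  regroup : ∀ x i n → x * (i * n) ≡ x * n * i
  regroup = solve-∀ ℚring
  expand : ∀ x → x ≡ x * ℕ→ℚ d * (+ 1 / d)
  expand x = trans (sym (ℚP.*-identityʳ x)) (trans (cong (x *_) (sym (1/-inverse d))) (regroup x (+ 1 / d) (ℕ→ℚ d)))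

-- Formal power series

infixl 7 _⊛_
-- The Cauchy product. Recursing through the shift of the left factor lets the laws go by induction
-- on the degree, with that factor generalised.
_⊛_ : (ℕ → ℚ) → (ℕ → ℚ) → ℕ → ℚ
(f ⊛ g) zero    = f 0 * g 0
(f ⊛ g) (suc n) = f 0 * g (suc n) + ((λ i → f (suc i)) ⊛ g) n

δ : ℕ → ℚ
δ zero    = 1ℚ
δ (suc _) = 0ℚ

shift : (ℕ → ℚ) → ℕ → ℚ
shift f zero    = 0ℚ
shift f (suc n) = f n

⊛-cong : ∀ {f f′ g g′} → (∀ n → f n ≡ f′ n) → (∀ n → g n ≡ g′ n) → ∀ n → (f ⊛ g) n ≡ (f′ ⊛ g′) n
⊛-cong p q zero    = cong₂ _*_ (p 0) (q 0)
⊛-cong p q (suc n) = cong₂ _+_ (cong₂ _*_ (p 0) (q (suc n))) (⊛-cong (λ i → p (suc i)) q n)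

⊛-congˡ : ∀ {f g g′} → (∀ n → g n ≡ g′ n) → ∀ n → (f ⊛ g) n ≡ (f ⊛ g′) n
⊛-congˡ = ⊛-cong (λ _ → refl)

⊛-congʳ : ∀ {f f′ g} → (∀ n → f n ≡ f′ n) → ∀ n → (f ⊛ g) n ≡ (f′ ⊛ g) n
⊛-congʳ p = ⊛-cong p (λ _ → refl)

⊛-distribʳ-+ : ∀ f g h n → ((λ i → f i + g i) ⊛ h) n ≡ (f ⊛ h) n + (g ⊛ h) n
⊛-distribʳ-+ f g h zero    = ℚP.*-distribʳ-+ (h 0) (f 0) (g 0)
⊛-distribʳ-+ f g h (suc n) = trans (cong₂ _+_ (refl {x = ((f 0 + g 0) * h (suc n))}) (⊛-distribʳ-+ (λ i → f (suc i)) (λ i → g (suc i)) h n))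
  (lemma (f 0) (g 0) (h (suc n)) _ _)
  where
  lemma : ∀ a b c x y → (a + b) * c + (x + y) ≡ (a * c + x) + (b * c + y)
  lemma = solve-∀ ℚring

⊛-scaleˡ : ∀ c f h n → ((λ i → c * f i) ⊛ h) n ≡ c * (f ⊛ h) n
⊛-scaleˡ c f h zero    = ℚP.*-assoc c (f 0) (h 0)
⊛-scaleˡ c f h (suc n) = trans (cong₂ _+_ (refl {x = c * f 0 * h (suc n)}) (⊛-scaleˡ c (λ i → f (suc i)) h n)) (lemma c (f 0) (h (suc n)) _)
  where
  lemma : ∀ a b c x → a * b * c + a * x ≡ a * (b * c + x)
  lemma = solve-∀ ℚring

-- Peels the product from the other end. With the defining recursion this yields commutativity, and
-- later it isolates the last term of Newton's identity.
⊛-snoc : ∀ f g n → (f ⊛ g) (suc n) ≡ (f ⊛ (λ i → g (suc i))) n + f (suc n) * g 0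
⊛-snoc f g zero    = refl
⊛-snoc f g (suc n) = trans (cong₂ _+_ (refl {x = f 0 * g (suc (suc n))}) (⊛-snoc (λ i → f (suc i)) g n)) (sym (ℚP.+-assoc (f 0 * g (suc (suc n))) (((λ i → f (suc i)) ⊛ (λ i → g (suc i))) n) (f (suc (suc n)) * g 0)))

⊛-comm : ∀ f g n → (f ⊛ g) n ≡ (g ⊛ f) n
⊛-comm f g zero    = ℚP.*-comm (f 0) (g 0)
⊛-comm f g (suc n) = trans (cong₂ _+_ (refl {x = f 0 * g (suc n)}) (⊛-comm (λ i → f (suc i)) g n))
  (trans (lemma (f 0) (g (suc n)) _) (sym (⊛-snoc g f n)))
  where
  lemma : ∀ a b x → a * b + x ≡ x + b * a
  lemma = solve-∀ ℚring

⊛-distribˡ-+ : ∀ f g h n → (h ⊛ (λ i → f i + g i)) n ≡ (h ⊛ f) n + (h ⊛ g) n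
⊛-distribˡ-+ f g h n = trans (⊛-comm h _ n) (trans (⊛-distribʳ-+ f g h n) (cong₂ _+_ (⊛-comm f h n) (⊛-comm g h n)))

⊛-scaleʳ : ∀ c f h n → (h ⊛ (λ i → c * f i)) n ≡ c * (h ⊛ f) n
⊛-scaleʳ c f h n = trans (⊛-comm h _ n) (trans (⊛-scaleˡ c f h n) (cong (c *_) (⊛-comm f h n)))

⊛-assoc : ∀ f g h n → ((f ⊛ g) ⊛ h) n ≡ (f ⊛ (g ⊛ h)) n
⊛-assoc f g h zero    = ℚP.*-assoc (f 0) (g 0) (h 0)
⊛-assoc f g h (suc n) = begin
  f 0 * g 0 * h (suc n) + ((λ i → f 0 * g (suc i) + (f′ ⊛ g) i) ⊛ h) n
    ≡⟨ cong₂ _+_ (refl {x = f 0 * g 0 * h (suc n)}) (⊛-distribʳ-+ _ (f′ ⊛ g) h n) ⟩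
  f 0 * g 0 * h (suc n) + (((λ i → f 0 * g (suc i)) ⊛ h) n + ((f′ ⊛ g) ⊛ h) n)
    ≡⟨ cong₂ (λ u v → f 0 * g 0 * h (suc n) + (u + v)) (⊛-scaleˡ (f 0) (λ i → g (suc i)) h n) (⊛-assoc f′ g h n) ⟩
  f 0 * g 0 * h (suc n) + (f 0 * ((λ i → g (suc i)) ⊛ h) n + (f′ ⊛ (g ⊛ h)) n)
    ≡⟨ lemma (f 0) (g 0) (h (suc n)) _ _ ⟩
  f 0 * (g 0 * h (suc n) + ((λ i → g (suc i)) ⊛ h) n) + (f′ ⊛ (g ⊛ h)) n ∎
  where
  open ≡-Reasoning
  f′ : ℕ → ℚ
  f′ i = f (suc i)
  lemma : ∀ a b c x y → a * b * c + (a * x + y) ≡ a * (b * c + x) + y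
  lemma = solve-∀ ℚring

⊛-zeroˡ : ∀ g n → ((λ _ → 0ℚ) ⊛ g) n ≡ 0ℚ
⊛-zeroˡ g zero    = ℚP.*-zeroˡ (g 0)
⊛-zeroˡ g (suc n) = cong₂ _+_ (ℚP.*-zeroˡ (g (suc n))) (⊛-zeroˡ g n)

⊛-identityˡ : ∀ g n → (δ ⊛ g) n ≡ g n
⊛-identityˡ g zero    = ℚP.*-identityˡ (g 0)
⊛-identityˡ g (suc n) = trans (cong₂ _+_ (ℚP.*-identityˡ (g (suc n))) (⊛-zeroˡ g n)) (ℚP.+-identityʳ _)

⊛-identityʳ : ∀ g n → (g ⊛ δ) n ≡ g n
⊛-identityʳ g n = trans (⊛-comm g δ n) (⊛-identityˡ g n)

shift-⊛ : ∀ f g n → (shift f ⊛ g) n ≡ shift (f ⊛ g) n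
shift-⊛ f g zero    = ℚP.*-zeroˡ (g 0)
shift-⊛ f g (suc n) = trans (cong (_+ (f ⊛ g) n) (ℚP.*-zeroˡ (g (suc n)))) (ℚP.+-identityˡ _)

⊛-shift : ∀ f g n → (f ⊛ shift g) n ≡ shift (f ⊛ g) n
⊛-shift f g n = trans (⊛-comm f (shift g) n) (trans (shift-⊛ g f n) (shift-cong n))
  where
  shift-cong : ∀ n → shift (g ⊛ f) n ≡ shift (f ⊛ g) n
  shift-cong zero    = refl
  shift-cong (suc n) = ⊛-comm g f n

-- The Euler operator t d/dt is a derivation.
⊛-euler : ∀ f g n → ℕ→ℚ n * (f ⊛ g) n ≡ ((λ i → ℕ→ℚ i * f i) ⊛ g) n + (f ⊛ (λ i → ℕ→ℚ i * g i)) n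
⊛-euler f g zero    = lemma (f 0) (g 0)
  where
  lemma : ∀ a b → 0ℚ * (a * b) ≡ 0ℚ * a * b + a * (0ℚ * b)
  lemma = solve-∀ ℚring
⊛-euler f g (suc n) = begin
  ℕ→ℚ (suc n) * (f 0 * g (suc n) + (f′ ⊛ g) n)
    ≡⟨ cong (_* (f 0 * g (suc n) + (f′ ⊛ g) n)) (ℕ→ℚ-suc n) ⟩
  (1ℚ + ℕ→ℚ n) * (f 0 * g (suc n) + (f′ ⊛ g) n)
    ≡⟨ step₁ (ℕ→ℚ n) (f 0) (g (suc n)) ((f′ ⊛ g) n) ⟩
  0ℚ * f 0 * g (suc n) + (f′ ⊛ g) n + (f 0 * ((1ℚ + ℕ→ℚ n) * g (suc n)) + ℕ→ℚ n * (f′ ⊛ g) n)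
    ≡⟨ cong (λ u → 0ℚ * f 0 * g (suc n) + (f′ ⊛ g) n + (f 0 * ((1ℚ + ℕ→ℚ n) * g (suc n)) + u)) (⊛-euler f′ g n) ⟩
  0ℚ * f 0 * g (suc n) + (f′ ⊛ g) n + (f 0 * ((1ℚ + ℕ→ℚ n) * g (suc n)) + (((λ i → ℕ→ℚ i * f′ i) ⊛ g) n + (f′ ⊛ θg) n))
    ≡⟨ step₂ (0ℚ * f 0 * g (suc n)) ((f′ ⊛ g) n) (f 0 * ((1ℚ + ℕ→ℚ n) * g (suc n))) (((λ i → ℕ→ℚ i * f′ i) ⊛ g) n) ((f′ ⊛ θg) n) ⟩
  0ℚ * f 0 * g (suc n) + ((f′ ⊛ g) n + ((λ i → ℕ→ℚ i * f′ i) ⊛ g) n) + (f 0 * ((1ℚ + ℕ→ℚ n) * g (suc n)) + (f′ ⊛ θg) n)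
    ≡⟨ cong₂ (λ u v → 0ℚ * f 0 * g (suc n) + u + (f 0 * (v * g (suc n)) + (f′ ⊛ θg) n))
         (trans (sym (⊛-distribʳ-+ f′ (λ i → ℕ→ℚ i * f′ i) g n)) (⊛-congʳ (λ i → sym (trans (cong (_* f′ i) (ℕ→ℚ-suc i)) (step₃ (ℕ→ℚ i) (f′ i)))) n))
         (sym (ℕ→ℚ-suc n)) ⟩
  0ℚ * f 0 * g (suc n) + ((λ i → ℕ→ℚ (suc i) * f′ i) ⊛ g) n + (f 0 * (ℕ→ℚ (suc n) * g (suc n)) + (f′ ⊛ θg) n) ∎
  where
  open ≡-Reasoning
  f′ θg : ℕ → ℚ
  f′ i = f (suc i)
  θg i = ℕ→ℚ i * g i
  step₁ : ∀ n a b x → (1ℚ + n) * (a * b + x) ≡ 0ℚ * a * b + x + (a * ((1ℚ + n) * b) + n * x)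
  step₁ = solve-∀ ℚring
  step₂ : ∀ a b c d e → a + b + (c + (d + e)) ≡ a + (b + d) + (c + e)
  step₂ = solve-∀ ℚring
  step₃ : ∀ n a → (1ℚ + n) * a ≡ a + n * a
  step₃ = solve-∀ ℚring

1/! : ℕ → ℚ
1/! zero    = 1ℚ
1/! (suc n) = 1/! n * (+ 1 / suc n)

1/!-suc : ∀ n → ℕ→ℚ (suc n) * 1/! (suc n) ≡ 1/! n
1/!-suc n = trans (lemma (ℕ→ℚ (suc n)) (1/! n) (+ 1 / suc n)) (trans (cong (1/! n *_) (1/-inverse (suc n))) (ℚP.*-identityʳ _))
  where
  lemma : ∀ a b c → a * (b * c) ≡ b * (c * a)
  lemma = solve-∀ ℚring

!*1/! : ∀ n → ℕ→ℚ (n !) * 1/! n ≡ 1ℚ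
!*1/! zero    = refl
!*1/! (suc n) = trans (cong (_* 1/! (suc n)) (ℕ→ℚ-* (suc n) (n !)))
  (trans (lemma (ℕ→ℚ (suc n)) (ℕ→ℚ (n !)) (1/! (suc n))) (trans (cong (ℕ→ℚ (n !) *_) (1/!-suc n)) (!*1/! n)))
  where
  lemma : ∀ a b c → a * b * c ≡ b * (a * c)
  lemma = solve-∀ ℚring

expS : ℚ → ℕ → ℚ
expS x n = x ^ n * 1/! n

expS-suc : ∀ x n → ℕ→ℚ (suc n) * expS x (suc n) ≡ x * expS x n
expS-suc x n = trans (lemma (ℕ→ℚ (suc n)) x (x ^ n) (1/! (suc n))) (cong (λ u → x * (x ^ n * u)) (1/!-suc n))
  where
  lemma : ∀ a x y r → a * (x * y * r) ≡ x * (y * (a * r))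
  lemma = solve-∀ ℚring

-- The Euler operator gives both sides the recurrence `(n + 1) cₙ₊₁ = (x + y) cₙ`, so no binomial
-- sums occur.
expS-+ : ∀ x y n → (expS x ⊛ expS y) n ≡ expS (x + y) n
expS-+ x y zero    = refl
expS-+ x y (suc n) = *-cancelʳ-ℕ→ℚ (suc n) (begin
  (expS x ⊛ expS y) (suc n) * ℕ→ℚ (suc n)
    ≡⟨ ℚP.*-comm _ (ℕ→ℚ (suc n)) ⟩
  ℕ→ℚ (suc n) * (expS x ⊛ expS y) (suc n)
    ≡⟨ ⊛-euler (expS x) (expS y) (suc n) ⟩
  ((λ i → ℕ→ℚ i * expS x i) ⊛ expS y) (suc n) + (expS x ⊛ (λ i → ℕ→ℚ i * expS y i)) (suc n)
    ≡⟨ cong₂ _+_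
         (trans (⊛-congʳ (euler x) (suc n)) (trans (⊛-scaleˡ x (shift (expS x)) (expS y) (suc n)) (cong (x *_) (shift-⊛ (expS x) (expS y) (suc n)))))
         (trans (⊛-congˡ {f = expS x} (euler y) (suc n)) (trans (⊛-scaleʳ y (shift (expS y)) (expS x) (suc n)) (cong (y *_) (⊛-shift (expS x) (expS y) (suc n))))) ⟩
  x * (expS x ⊛ expS y) n + y * (expS x ⊛ expS y) n
    ≡⟨ ℚP.*-distribʳ-+ ((expS x ⊛ expS y) n) x y ⟨
  (x + y) * (expS x ⊛ expS y) n
    ≡⟨ cong ((x + y) *_) (expS-+ x y n) ⟩
  (x + y) * expS (x + y) n
    ≡⟨ expS-suc (x + y) n ⟨
  ℕ→ℚ (suc n) * expS (x + y) (suc n)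
    ≡⟨ ℚP.*-comm (ℕ→ℚ (suc n)) _ ⟩
  expS (x + y) (suc n) * ℕ→ℚ (suc n) ∎)
  where
  open ≡-Reasoning
  euler : ∀ z i → ℕ→ℚ i * expS z i ≡ z * shift (expS z) i
  euler z zero    = trans (ℚP.*-zeroˡ (expS z 0)) (sym (ℚP.*-zeroʳ z))
  euler z (suc i) = expS-suc z i

-- Bernoulli numbers

∑ : ℕ → (ℕ → ℚ) → ℚ
∑ zero    f = 0ℚ
∑ (suc n) f = f 0 + ∑ n (λ i → f (suc i))

∑-cong : ∀ n {f g} → (∀ i → i < n → f i ≡ g i) → ∑ n f ≡ ∑ n g
∑-cong zero    e = refl
∑-cong (suc n) e = cong₂ _+_ (e 0 (s≤s z≤n)) (∑-cong n (λ i i<n → e (suc i) (s≤s i<n)))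

∑-snoc : ∀ n f → ∑ (suc n) f ≡ ∑ n f + f n
∑-snoc zero    f = ℚP.+-comm (f 0) 0ℚ
∑-snoc (suc n) f = trans (cong₂ _+_ (refl {x = f 0}) (∑-snoc n (λ i → f (suc i)))) (sym (ℚP.+-assoc (f 0) (∑ n (λ i → f (suc i))) (f (suc n))))

∑-*ˡ : ∀ n c f → ∑ n (λ i → c * f i) ≡ c * ∑ n f
∑-*ˡ zero    c f = sym (ℚP.*-zeroʳ c)
∑-*ˡ (suc n) c f = trans (cong₂ _+_ (refl {x = c * f 0}) (∑-*ˡ n c (λ i → f (suc i)))) (sym (ℚP.*-distribˡ-+ c (f 0) (∑ n (λ i → f (suc i)))))

∑-+ : ∀ n f g → ∑ n (λ i → f i + g i) ≡ ∑ n f + ∑ n g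
∑-+ zero    f g = refl
∑-+ (suc n) f g = trans (cong₂ _+_ (refl {x = f 0 + g 0}) (∑-+ n (λ i → f (suc i)) (λ i → g (suc i))))
  (lemma (f 0) (g 0) (∑ n (λ i → f (suc i))) (∑ n (λ i → g (suc i))))
  where
  lemma : ∀ a b x y → (a + b) + (x + y) ≡ (a + x) + (b + y)
  lemma = solve-∀ ℚring

⊛-∑ : ∀ f g n → (f ⊛ g) n ≡ ∑ (suc n) (λ k → f k * g (n ∸ k))
⊛-∑ f g zero    = sym (ℚP.+-identityʳ (f 0 * g 0))
⊛-∑ f g (suc n) = cong₂ _+_ (refl {x = f 0 * g (suc n)}) (⊛-∑ (λ i → f (suc i)) g n)

ℕ→ℚ-C : ∀ {n k} → k ≤ n → ℕ→ℚ (n C k) ≡ ℕ→ℚ (n !) * (1/! k * 1/! (n ∸ k))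
ℕ→ℚ-C {n} {k} k≤n = begin
  ℕ→ℚ (n C k)
    ≡⟨ lemma₁ (ℕ→ℚ (n C k)) ⟩
  ℕ→ℚ (n C k) * (1ℚ * 1ℚ)
    ≡⟨ cong₂ (λ u v → ℕ→ℚ (n C k) * (u * v)) (!*1/! k) (!*1/! (n ∸ k)) ⟨
  ℕ→ℚ (n C k) * ((ℕ→ℚ (k !) * 1/! k) * (ℕ→ℚ ((n ∸ k) !) * 1/! (n ∸ k)))
    ≡⟨ lemma₂ (ℕ→ℚ (n C k)) (ℕ→ℚ (k !)) (1/! k) (ℕ→ℚ ((n ∸ k) !)) (1/! (n ∸ k)) ⟩
  ℕ→ℚ (n C k) * (ℕ→ℚ (k !) * ℕ→ℚ ((n ∸ k) !)) * (1/! k * 1/! (n ∸ k))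
    ≡⟨ cong (λ u → ℕ→ℚ (n C k) * u * (1/! k * 1/! (n ∸ k))) (ℕ→ℚ-* (k !) ((n ∸ k) !)) ⟨
  ℕ→ℚ (n C k) * ℕ→ℚ (k ! ℕ.* (n ∸ k) !) * (1/! k * 1/! (n ∸ k))
    ≡⟨ cong (_* (1/! k * 1/! (n ∸ k))) (ℕ→ℚ-* (n C k) (k ! ℕ.* (n ∸ k) !)) ⟨
  ℕ→ℚ ((n C k) ℕ.* (k ! ℕ.* (n ∸ k) !)) * (1/! k * 1/! (n ∸ k))
    ≡⟨ cong (λ u → ℕ→ℚ u * (1/! k * 1/! (n ∸ k))) C*!≡! ⟩
  ℕ→ℚ (n !) * (1/! k * 1/! (n ∸ k)) ∎
  where
  open ≡-Reasoning
  instance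
    k!*≢0 : ℕ.NonZero (k ! ℕ.* (n ∸ k) !)
    k!*≢0 = ℕP.m*n≢0 (k !) ((n ∸ k) !) {{k ℕP.!≢0}} {{(n ∸ k) ℕP.!≢0}}
  C*!≡! : (n C k) ℕ.* (k ! ℕ.* (n ∸ k) !) ≡ n !
  C*!≡! = trans (cong (ℕ._* (k ! ℕ.* (n ∸ k) !)) (nCk≡n!/k![n-k]! k≤n)) (ℕD.m/n*n≡m (k![n∸k]!∣n! k≤n))
  lemma₁ : ∀ x → x ≡ x * (1ℚ * 1ℚ)
  lemma₁ = solve-∀ ℚring
  lemma₂ : ∀ x a b c d → x * ((a * b) * (c * d)) ≡ x * (a * c) * (b * d)
  lemma₂ = solve-∀ ℚring

tabulate-∷ʳ : ∀ n (f : ℕ → ℚ) → Vec.tabulate {n = n} (λ i → f (toℕ i)) Vec.∷ʳ f n ≡ Vec.tabulate (λ i → f (toℕ i))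
tabulate-∷ʳ zero    f = refl
tabulate-∷ʳ (suc n) f = cong (f 0 Vec.∷_) (tabulate-∷ʳ n (λ i → f (suc i)))

bernVec-tabulate : ∀ n → bernVec n ≡ Vec.tabulate (λ i → B (toℕ i))
bernVec-tabulate zero    = refl
bernVec-tabulate (suc n) = trans (cong₂ Vec._∷ʳ_ (bernVec-tabulate n) (sym (VecP.last-∷ʳ _ (bernVec n)))) (tabulate-∷ʳ (suc n) B)

sum-zipWith-tabulate : ∀ n (F : ℕ → ℚ → ℚ) (h : ℕ → ℕ) (f : ℕ → ℚ) →
  Vec.foldr _ _+_ 0ℚ (Vec.zipWith F (Vec.tabulate {n = n} (λ i → h (toℕ i))) (Vec.tabulate (λ i → f (toℕ i)))) ≡ ∑ n (λ i → F (h i) (f i))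
sum-zipWith-tabulate zero    F h f = refl
sum-zipWith-tabulate (suc n) F h f = cong₂ _+_ (refl {x = F (h 0) (f 0)}) (sum-zipWith-tabulate n F (λ i → h (suc i)) (λ i → f (suc i)))

B-suc : ∀ n → B (suc n) ≡ - ((+ 1 / suc (suc n)) * ∑ (suc n) (λ k → ℕ→ℚ (suc (suc n) C k) * B k))
B-suc n = trans (VecP.last-∷ʳ _ (bernVec n)) (cong (λ s → - ((+ 1 / suc (suc n)) * s))
  (trans (cong (λ bs → Vec.foldr _ _+_ 0ℚ (Vec.zipWith (λ k b → ℕ→ℚ (suc (suc n) C k) * b) (Vec.tabulate toℕ) bs)) (bernVec-tabulate n))
    (sum-zipWith-tabulate (suc n) (λ k b → ℕ→ℚ (suc (suc n) C k) * b) (λ i → i) B)))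

bernS : ℕ → ℚ
bernS n = B n * 1/! n

-- (eᵗ − 1)/t
exp₁S : ℕ → ℚ
exp₁S n = 1/! (suc n)

-- Multiplied by `N !`, the coefficient becomes the binomial sum that defines the Bernoulli numbers;
-- `B-suc` is that sum solved for its last term.
bernS-inverse : ∀ n → (bernS ⊛ exp₁S) n ≡ δ n
bernS-inverse zero    = refl
bernS-inverse (suc n) = *-cancelʳ-ℕ→ℚ (N !) {{N ℕP.!≢0}} (begin
  (bernS ⊛ exp₁S) (suc n) * ℕ→ℚ (N !)
    ≡⟨ ℚP.*-comm ((bernS ⊛ exp₁S) (suc n)) (ℕ→ℚ (N !)) ⟩
  ℕ→ℚ (N !) * (bernS ⊛ exp₁S) (suc n)
    ≡⟨ cong (ℕ→ℚ (N !) *_) (trans (⊛-∑ bernS exp₁S (suc n)) (∑-snoc (suc n) (λ k → bernS k * exp₁S (suc n ∸ k)))) ⟩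
  ℕ→ℚ (N !) * (∑ (suc n) (λ k → bernS k * exp₁S (suc n ∸ k)) + bernS (suc n) * exp₁S (suc n ∸ suc n))
    ≡⟨ ℚP.*-distribˡ-+ (ℕ→ℚ (N !)) (∑ (suc n) (λ k → bernS k * exp₁S (suc n ∸ k))) (bernS (suc n) * exp₁S (suc n ∸ suc n)) ⟩
  ℕ→ℚ (N !) * ∑ (suc n) (λ k → bernS k * exp₁S (suc n ∸ k)) + ℕ→ℚ (N !) * (bernS (suc n) * exp₁S (suc n ∸ suc n))
    ≡⟨ cong₂ _+_
         (trans (sym (∑-*ˡ (suc n) (ℕ→ℚ (N !)) (λ k → bernS k * exp₁S (suc n ∸ k)))) (∑-cong (suc n) binom))
         last-term ⟩
  s + ℕ→ℚ N * B (suc n)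
    ≡⟨ cong (λ u → s + ℕ→ℚ N * u) (B-suc n) ⟩
  s + ℕ→ℚ N * (- ((+ 1 / N) * s))
    ≡⟨ lemma₃ s (ℕ→ℚ N) (+ 1 / N) ⟩
  s - ((+ 1 / N) * ℕ→ℚ N) * s
    ≡⟨ cong (λ u → s - u * s) (1/-inverse N) ⟩
  s - 1ℚ * s
    ≡⟨ lemma₄ s (ℕ→ℚ (N !)) ⟩
  0ℚ * ℕ→ℚ (N !) ∎)
  where
  open ≡-Reasoning
  N : ℕ
  N = suc (suc n)
  s : ℚ
  s = ∑ (suc n) (λ k → ℕ→ℚ (N C k) * B k)
  lemma₁ : ∀ x b a c → x * ((b * a) * c) ≡ x * (a * c) * b
  lemma₁ = solve-∀ ℚring
  lemma₂ : ∀ x y b a → x * y * ((b * a) * 1ℚ) ≡ x * b * (y * a)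
  lemma₂ = solve-∀ ℚring
  lemma₃ : ∀ s x i → s + x * (- (i * s)) ≡ s - (i * x) * s
  lemma₃ = solve-∀ ℚring
  lemma₄ : ∀ s x → s - 1ℚ * s ≡ 0ℚ * x
  lemma₄ = solve-∀ ℚring
  binom : ∀ k → k < suc n → ℕ→ℚ (N !) * (bernS k * exp₁S (suc n ∸ k)) ≡ ℕ→ℚ (N C k) * B k
  binom k (s≤s k≤n) = trans (lemma₁ (ℕ→ℚ (N !)) (B k) (1/! k) (exp₁S (suc n ∸ k))) (cong (_* B k)
    (trans (cong (λ m → ℕ→ℚ (N !) * (1/! k * 1/! m)) (sym (ℕP.+-∸-assoc 1 {suc n} {k} (ℕP.m≤n⇒m≤1+n k≤n)))) (sym (ℕ→ℚ-C {N} {k} (ℕP.m≤n⇒m≤1+n (ℕP.m≤n⇒m≤1+n k≤n))))))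
  last-term : ℕ→ℚ (N !) * (bernS (suc n) * exp₁S (suc n ∸ suc n)) ≡ ℕ→ℚ N * B (suc n)
  last-term = begin
    ℕ→ℚ (N !) * (bernS (suc n) * exp₁S (n ∸ n))
      ≡⟨ cong₂ (λ u m → u * (bernS (suc n) * exp₁S m)) (ℕ→ℚ-* N (suc n !)) (ℕP.n∸n≡0 n) ⟩
    ℕ→ℚ N * ℕ→ℚ (suc n !) * (B (suc n) * 1/! (suc n) * 1ℚ)
      ≡⟨ lemma₂ (ℕ→ℚ N) (ℕ→ℚ (suc n !)) (B (suc n)) (1/! (suc n)) ⟩
    ℕ→ℚ N * B (suc n) * (ℕ→ℚ (suc n !) * 1/! (suc n))
      ≡⟨ cong (ℕ→ℚ N * B (suc n) *_) (!*1/! (suc n)) ⟩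
    ℕ→ℚ N * B (suc n) * 1ℚ
      ≡⟨ ℚP.*-identityʳ (ℕ→ℚ N * B (suc n)) ⟩
    ℕ→ℚ N * B (suc n) ∎

-- (eⁿᵗ − 1)/t
expₙS : ℕ → ℕ → ℚ
expₙS n k = expS (ℕ→ℚ n) (suc k)

1^ : ∀ n → 1ℚ ^ n ≡ 1ℚ
1^ zero    = refl
1^ (suc n) = trans (ℚP.*-identityˡ (1ℚ ^ n)) (1^ n)

expS-1 : ∀ n → expS 1ℚ n ≡ 1/! n
expS-1 n = trans (cong (_* 1/! n) (1^ n)) (ℚP.*-identityˡ (1/! n))

expₙS-suc : ∀ n k → expₙS (suc n) k ≡ (expS (ℕ→ℚ n) ⊛ exp₁S) k + expₙS n k
expₙS-suc n k = begin
  expS (ℕ→ℚ (suc n)) (suc k)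
    ≡⟨ cong (λ x → expS x (suc k)) (trans (ℕ→ℚ-suc n) (ℚP.+-comm 1ℚ (ℕ→ℚ n))) ⟩
  expS (ℕ→ℚ n + 1ℚ) (suc k)
    ≡⟨ expS-+ (ℕ→ℚ n) 1ℚ (suc k) ⟨
  (expS (ℕ→ℚ n) ⊛ expS 1ℚ) (suc k)
    ≡⟨ ⊛-snoc (expS (ℕ→ℚ n)) (expS 1ℚ) k ⟩
  (expS (ℕ→ℚ n) ⊛ (λ i → expS 1ℚ (suc i))) k + expS (ℕ→ℚ n) (suc k) * 1ℚ
    ≡⟨ cong₂ _+_ (⊛-congˡ {f = expS (ℕ→ℚ n)} (λ i → expS-1 (suc i)) k) (ℚP.*-identityʳ (expS (ℕ→ℚ n) (suc k))) ⟩
  (expS (ℕ→ℚ n) ⊛ exp₁S) k + expₙS n k ∎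
  where open ≡-Reasoning

-- Passing from `n` to `n + 1` adds `eⁿᵗ (eᵗ − 1)/t` to `expₙS n`, and multiplication by the
-- Bernoulli series turns this into `eⁿᵗ`.
faulhaber : ∀ n N → ∑ n (λ i → expS (ℕ→ℚ i) N) ≡ (bernS ⊛ expₙS n) N
faulhaber zero    N = sym (trans (⊛-comm bernS (expₙS 0) N) (trans (⊛-congʳ {g = bernS} vanish N) (⊛-zeroˡ bernS N)))
  where
  lemma : ∀ x y → 0ℚ * x * y ≡ 0ℚ
  lemma = solve-∀ ℚring
  vanish : ∀ k → expₙS 0 k ≡ 0ℚ
  vanish k = lemma (0ℚ ^ k) (1/! (suc k))
faulhaber (suc n) N = begin
  ∑ (suc n) (λ i → expS (ℕ→ℚ i) N)
    ≡⟨ ∑-snoc n (λ i → expS (ℕ→ℚ i) N) ⟩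
  ∑ n (λ i → expS (ℕ→ℚ i) N) + expS (ℕ→ℚ n) N
    ≡⟨ cong₂ _+_ (faulhaber n N) (sym difference) ⟩
  (bernS ⊛ expₙS n) N + (bernS ⊛ (expS (ℕ→ℚ n) ⊛ exp₁S)) N
    ≡⟨ ℚP.+-comm ((bernS ⊛ expₙS n) N) _ ⟩
  (bernS ⊛ (expS (ℕ→ℚ n) ⊛ exp₁S)) N + (bernS ⊛ expₙS n) N
    ≡⟨ ⊛-distribˡ-+ (expS (ℕ→ℚ n) ⊛ exp₁S) (expₙS n) bernS N ⟨
  (bernS ⊛ (λ k → (expS (ℕ→ℚ n) ⊛ exp₁S) k + expₙS n k)) N
    ≡⟨ ⊛-congˡ {f = bernS} (λ k → expₙS-suc n k) N ⟨
  (bernS ⊛ expₙS (suc n)) N ∎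
  where
  open ≡-Reasoning
  difference : (bernS ⊛ (expS (ℕ→ℚ n) ⊛ exp₁S)) N ≡ expS (ℕ→ℚ n) N
  difference = begin
    (bernS ⊛ (expS (ℕ→ℚ n) ⊛ exp₁S)) N   ≡⟨ ⊛-congˡ {f = bernS} (⊛-comm (expS (ℕ→ℚ n)) exp₁S) N ⟩
    (bernS ⊛ (exp₁S ⊛ expS (ℕ→ℚ n))) N   ≡⟨ ⊛-assoc bernS exp₁S (expS (ℕ→ℚ n)) N ⟨
    ((bernS ⊛ exp₁S) ⊛ expS (ℕ→ℚ n)) N   ≡⟨ ⊛-congʳ {g = expS (ℕ→ℚ n)} bernS-inverse N ⟩
    (δ ⊛ expS (ℕ→ℚ n)) N                 ≡⟨ ⊛-identityˡ (expS (ℕ→ℚ n)) N ⟩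
    expS (ℕ→ℚ n) N                       ∎

-- Vanishing of the Bernoulli numbers of odd index

alt : (ℕ → ℚ) → ℕ → ℚ
alt f n = (- 1ℚ) ^ n * f n

alt-suc : ∀ f n → alt f (suc n) ≡ - 1ℚ * alt (λ i → f (suc i)) n
alt-suc f n = ℚP.*-assoc (- 1ℚ) ((- 1ℚ) ^ n) (f (suc n))

alt-⊛ : ∀ f g n → (alt f ⊛ alt g) n ≡ alt (f ⊛ g) n
alt-⊛ f g zero    = lemma (f 0) (g 0)
  where
  lemma : ∀ a b → 1ℚ * a * (1ℚ * b) ≡ 1ℚ * (a * b)
  lemma = solve-∀ ℚring
alt-⊛ f g (suc n) = begin
  alt f 0 * alt g (suc n) + ((λ i → alt f (suc i)) ⊛ alt g) n
    ≡⟨ cong₂ _+_ (refl {x = alt f 0 * alt g (suc n)}) (trans (⊛-congʳ {g = alt g} (alt-suc f) n) (trans (⊛-scaleˡ (- 1ℚ) (alt f′) (alt g) n) (cong (- 1ℚ *_) (alt-⊛ f′ g n)))) ⟩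
  alt f 0 * alt g (suc n) + - 1ℚ * alt (f′ ⊛ g) n
    ≡⟨ lemma (f 0) ((- 1ℚ) ^ n) (g (suc n)) ((f′ ⊛ g) n) ⟩
  alt (f ⊛ g) (suc n) ∎
  where
  open ≡-Reasoning
  f′ : ℕ → ℚ
  f′ i = f (suc i)
  lemma : ∀ a s b x → 1ℚ * a * ((- 1ℚ) * s * b) + (- 1ℚ) * (s * x) ≡ (- 1ℚ) * s * (a * b + x)
  lemma = solve-∀ ℚring

-- `alt exp₁S` is the series `(1 − e⁻ᵗ)/t`, which `eᵗ` turns into `(eᵗ − 1)/t`.
alt-exp₁S-⊛ : ∀ n → (alt exp₁S ⊛ expS 1ℚ) n ≡ exp₁S n
alt-exp₁S-⊛ n = begin
  (alt exp₁S ⊛ expS 1ℚ) n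
    ≡⟨ ⊛-congʳ {g = expS 1ℚ} (λ i → lemma₁ ((- 1ℚ) ^ i) (1/! (suc i))) n ⟩
  ((λ i → - 1ℚ * expS (- 1ℚ) (suc i)) ⊛ expS 1ℚ) n
    ≡⟨ ⊛-scaleˡ (- 1ℚ) (λ i → expS (- 1ℚ) (suc i)) (expS 1ℚ) n ⟩
  - 1ℚ * ((λ i → expS (- 1ℚ) (suc i)) ⊛ expS 1ℚ) n
    ≡⟨ lemma₂ (expS 1ℚ (suc n)) (((λ i → expS (- 1ℚ) (suc i)) ⊛ expS 1ℚ) n) ⟩
  expS 1ℚ (suc n) - (expS (- 1ℚ) ⊛ expS 1ℚ) (suc n)
    ≡⟨ cong₂ _-_ (expS-1 (suc n)) (trans (expS-+ (- 1ℚ) 1ℚ (suc n)) (lemma₃ (0ℚ ^ n) (1/! (suc n)))) ⟩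
  exp₁S n - 0ℚ
    ≡⟨ lemma₄ (exp₁S n) ⟩
  exp₁S n ∎
  where
  open ≡-Reasoning
  lemma₁ : ∀ s x → s * x ≡ - 1ℚ * (- 1ℚ * s * x)
  lemma₁ = solve-∀ ℚring
  lemma₂ : ∀ y x → - 1ℚ * x ≡ y - (1ℚ * 1ℚ * y + x)
  lemma₂ = solve-∀ ℚring
  lemma₃ : ∀ s x → 0ℚ * s * x ≡ 0ℚ
  lemma₃ = solve-∀ ℚring
  lemma₄ : ∀ x → x - 0ℚ ≡ x
  lemma₄ = solve-∀ ℚring

-- B(−t) = B(t) eᵗ, because both are inverse to (1 − e⁻ᵗ)/t.
alt-bernS : ∀ n → alt bernS n ≡ (expS 1ℚ ⊛ bernS) n
alt-bernS n = begin
  alt bernS n                            ≡⟨ ⊛-identityʳ (alt bernS) n ⟨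
  (alt bernS ⊛ δ) n                      ≡⟨ ⊛-congˡ {f = alt bernS} (λ i → trans (⊛-comm exp₁S bernS i) (bernS-inverse i)) n ⟨
  (alt bernS ⊛ (exp₁S ⊛ bernS)) n        ≡⟨ ⊛-assoc (alt bernS) exp₁S bernS n ⟨
  ((alt bernS ⊛ exp₁S) ⊛ bernS) n        ≡⟨ ⊛-congʳ {g = bernS} step n ⟩
  (expS 1ℚ ⊛ bernS) n                    ∎
  where
  open ≡-Reasoning
  alt-δ : ∀ n → alt δ n ≡ δ n
  alt-δ zero    = refl
  alt-δ (suc n) = ℚP.*-zeroʳ ((- 1ℚ) ^ suc n)
  step : ∀ n → (alt bernS ⊛ exp₁S) n ≡ expS 1ℚ n
  step n = begin
    (alt bernS ⊛ exp₁S) n                        ≡⟨ ⊛-congˡ {f = alt bernS} alt-exp₁S-⊛ n ⟨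
    (alt bernS ⊛ (alt exp₁S ⊛ expS 1ℚ)) n        ≡⟨ ⊛-assoc (alt bernS) (alt exp₁S) (expS 1ℚ) n ⟨
    ((alt bernS ⊛ alt exp₁S) ⊛ expS 1ℚ) n        ≡⟨ ⊛-congʳ {g = expS 1ℚ} (λ i → trans (alt-⊛ bernS exp₁S i) (trans (cong ((- 1ℚ) ^ i *_) (bernS-inverse i)) (alt-δ i))) n ⟩
    (δ ⊛ expS 1ℚ) n                              ≡⟨ ⊛-identityˡ (expS 1ℚ) n ⟩
    expS 1ℚ n                                    ∎

[-1]^2* : ∀ k → (- 1ℚ) ^ (2 ℕ.* k) ≡ 1ℚ
[-1]^2* k = trans (sym (^-assocʳ (- 1ℚ) 2 k)) (1^ k)

-- From `B(−t) = eᵗ B(t)` and `(eᵗ − 1) B(t) = t` one gets `B(−t) = B(t) + t`, so above degree 1 the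
-- odd coefficients equal their own negatives.
B-odd : ∀ k → B (3 ℕ.+ 2 ℕ.* k) ≡ 0ℚ
B-odd k = *-cancelʳ-ℕ→ℚ 2 (begin
  B n * ℕ→ℚ 2
    ≡⟨ lemma₁ (B n) (ℕ→ℚ (n !)) (1/! n) (!*1/! n) ⟩
  (bernS n - - bernS n) * ℕ→ℚ (n !)
    ≡⟨ cong (λ u → (bernS n - u) * ℕ→ℚ (n !)) even-part ⟩
  (bernS n - bernS n) * ℕ→ℚ (n !)
    ≡⟨ lemma₂ (bernS n) (ℕ→ℚ (n !)) ⟩
  0ℚ * ℕ→ℚ 2 ∎)
  where
  open ≡-Reasoning
  n : ℕ
  n = 3 ℕ.+ 2 ℕ.* k
  lemma₁′ : ∀ b f r → (b * r - - (b * r)) * f ≡ b * (+ 2 / 1) * (f * r)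
  lemma₁′ = solve-∀ ℚring
  lemma₁ : ∀ b f r → f * r ≡ 1ℚ → b * (+ 2 / 1) ≡ (b * r - - (b * r)) * f
  lemma₁ b f r e = sym (trans (lemma₁′ b f r) (trans (cong (b * (+ 2 / 1) *_) e) (ℚP.*-identityʳ (b * (+ 2 / 1)))))
  lemma₂ : ∀ b f → (b - b) * f ≡ 0ℚ * (+ 2 / 1)
  lemma₂ = solve-∀ ℚring
  lemma₃ : ∀ b → - b ≡ (- 1ℚ) * ((- 1ℚ) * ((- 1ℚ) * 1ℚ)) * b
  lemma₃ = solve-∀ ℚring
  lemma₄ : ∀ b → 1ℚ * 1ℚ * b + 0ℚ ≡ b
  lemma₄ = solve-∀ ℚring
  even-part : - bernS n ≡ bernS n
  even-part = begin
    - bernS n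
      ≡⟨ lemma₃ (bernS n) ⟩
    (- 1ℚ) * ((- 1ℚ) * ((- 1ℚ) * 1ℚ)) * bernS n
      ≡⟨ cong (λ u → (- 1ℚ) * ((- 1ℚ) * ((- 1ℚ) * u)) * bernS n) ([-1]^2* k) ⟨
    alt bernS n
      ≡⟨ alt-bernS n ⟩
    1ℚ * 1ℚ * bernS n + ((λ i → expS 1ℚ (suc i)) ⊛ bernS) (2 ℕ.+ 2 ℕ.* k)
      ≡⟨ cong₂ _+_ (refl {x = 1ℚ * 1ℚ * bernS n}) (trans (⊛-congʳ {g = bernS} (λ i → expS-1 (suc i)) (2 ℕ.+ 2 ℕ.* k)) (trans (⊛-comm exp₁S bernS (2 ℕ.+ 2 ℕ.* k)) (bernS-inverse (2 ℕ.+ 2 ℕ.* k)))) ⟩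
    1ℚ * 1ℚ * bernS n + 0ℚ
      ≡⟨ lemma₄ (bernS n) ⟩
    bernS n ∎

-- Elementary symmetric functions and power sums

psum : ℕ → List ℚ → ℚ
psum k xs = sumℚ (map (_^ k) xs)

prodℚ : List ℚ → ℚ
prodℚ = foldr _*_ 1ℚ

-- With `E(t)` the product of the `1 + x t`, this is `E′ = E · Σ x/(1 + x t)`. Adjoining `x`
-- multiplies `E` by `1 + x t` and adds one summand to the logarithmic derivative.
newton : ∀ xs k → ℕ→ℚ (suc k) * esym (suc k) xs ≡ (alt (λ i → psum (suc i) xs) ⊛ (λ j → esym j xs)) k
newton [] k = trans (ℚP.*-zeroʳ (ℕ→ℚ (suc k))) (sym (trans (⊛-congʳ {g = λ j → esym j []} (λ i → ℚP.*-zeroʳ ((- 1ℚ) ^ i)) k) (⊛-zeroˡ (λ j → esym j []) k)))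
newton (x ∷ xs) k = sym (begin
  (alt (λ i → psum (suc i) (x ∷ xs)) ⊛ e′) k
    ≡⟨ ⊛-congʳ {g = e′} (λ i → ℚP.*-distribˡ-+ ((- 1ℚ) ^ i) (x ^ suc i) (psum (suc i) xs)) k ⟩
  ((λ i → alt (λ i → x ^ suc i) i + r i) ⊛ e′) k
    ≡⟨ ⊛-distribʳ-+ (alt (λ i → x ^ suc i)) r e′ k ⟩
  (alt (λ i → x ^ suc i) ⊛ e′) k + (r ⊛ e′) k
    ≡⟨ cong₂ _+_ (telescope k) (trans (⊛-congˡ {f = r} e′-split k) (trans (⊛-distribˡ-+ (λ j → x * shift e j) e r k)
         (cong (_+ (r ⊛ e) k) (trans (⊛-scaleʳ x (shift e) r k) (cong (x *_) (⊛-shift r e k)))))) ⟩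
  x * e k + (x * shift (r ⊛ e) k + (r ⊛ e) k)
    ≡⟨ cong₂ (λ u v → x * e k + (x * u + v)) (IH k) (sym (newton xs k)) ⟩
  x * e k + (x * (ℕ→ℚ k * e k) + ℕ→ℚ (suc k) * e (suc k))
    ≡⟨ lemma x (e k) (ℕ→ℚ k) (ℕ→ℚ (suc k) * e (suc k)) ⟩
  (1ℚ + ℕ→ℚ k) * (x * e k) + ℕ→ℚ (suc k) * e (suc k)
    ≡⟨ cong (λ u → u * (x * e k) + ℕ→ℚ (suc k) * e (suc k)) (ℕ→ℚ-suc k) ⟨
  ℕ→ℚ (suc k) * (x * e k) + ℕ→ℚ (suc k) * e (suc k)
    ≡⟨ ℚP.*-distribˡ-+ (ℕ→ℚ (suc k)) (x * e k) (e (suc k)) ⟨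
  ℕ→ℚ (suc k) * esym (suc k) (x ∷ xs) ∎)
  where
  open ≡-Reasoning
  e e′ r : ℕ → ℚ
  e j = esym j xs
  e′ j = esym j (x ∷ xs)
  r = alt (λ i → psum (suc i) xs)
  lemma : ∀ x e k y → x * e + (x * (k * e) + y) ≡ (1ℚ + k) * (x * e) + y
  lemma = solve-∀ ℚring
  e′-split : ∀ j → e′ j ≡ x * shift e j + e j
  e′-split zero    = lemma₀ x
    where
    lemma₀ : ∀ x → 1ℚ ≡ x * 0ℚ + 1ℚ
    lemma₀ = solve-∀ ℚring
  e′-split (suc j) = refl
  -- The induction hypothesis one degree lower; `shift` supplies the case of degree 0.
  IH : ∀ k → shift (r ⊛ e) k ≡ ℕ→ℚ k * e k
  IH zero    = refl
  IH (suc k) = sym (newton xs k)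
  -- Coefficients of `x/(1 + x t) · (1 + x t) E(t) = x E(t)`.
  telescope : ∀ k → (alt (λ i → x ^ suc i) ⊛ e′) k ≡ x * e k
  telescope zero    = lemma₁ x
    where
    lemma₁ : ∀ x → 1ℚ * (x * 1ℚ) * 1ℚ ≡ x * 1ℚ
    lemma₁ = solve-∀ ℚring
  telescope (suc k) = begin
    1ℚ * (x * 1ℚ) * e′ (suc k) + ((λ i → alt (λ i → x ^ suc i) (suc i)) ⊛ e′) k
      ≡⟨ cong₂ _+_ (refl {x = 1ℚ * (x * 1ℚ) * e′ (suc k)}) (trans (⊛-congʳ {g = e′} (λ i → lemma₂ x ((- 1ℚ) ^ i) (x ^ i)) k)
           (trans (⊛-scaleˡ (- x) (alt (λ i → x ^ suc i)) e′ k) (cong (- x *_) (telescope k)))) ⟩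
    1ℚ * (x * 1ℚ) * (x * e k + e (suc k)) + - x * (x * e k)
      ≡⟨ lemma₃ x (e k) (e (suc k)) ⟩
    x * e (suc k) ∎
    where
    lemma₂ : ∀ x s y → - 1ℚ * s * (x * (x * y)) ≡ - x * (s * (x * y))
    lemma₂ = solve-∀ ℚring
    lemma₃ : ∀ x a b → 1ℚ * (x * 1ℚ) * (x * a + b) + - x * (x * a) ≡ x * b
    lemma₃ = solve-∀ ℚring

esym-vanish : ∀ xs k → length xs < k → esym k xs ≡ 0ℚ
esym-vanish []       (suc k) _          = refl
esym-vanish (x ∷ xs) (suc k) (s≤s xs<k) = trans (cong₂ (λ u v → x * u + v) (esym-vanish xs k xs<k) (esym-vanish xs (suc k) (ℕP.m<n⇒m<1+n xs<k))) (lemma x)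
  where
  lemma : ∀ x → x * 0ℚ + 0ℚ ≡ 0ℚ
  lemma = solve-∀ ℚring

esym-length : ∀ xs → esym (length xs) xs ≡ prodℚ xs
esym-length []       = refl
esym-length (x ∷ xs) = trans (cong₂ (λ u v → x * u + v) (esym-length xs) (esym-vanish xs (suc (length xs)) ℕP.≤-refl)) (ℚP.+-identityʳ (x * prodℚ xs))

module _ (f g : ℕ → ℚ) (fg≡1 : ∀ i → f i * g i ≡ 1ℚ) where

  -- Taking complements: the full product times the reciprocals of a `k`-subset is the product of
  -- the remaining `m` entries. The recursion distinguishes whether the head lies in the subset.
  esym-reciprocal : ∀ (is : List ℕ) k m → k ℕ.+ m ≡ length is → esym k (map g is) * prodℚ (map f is) ≡ esym m (map f is)
  esym-reciprocal []       zero    zero    _ = refl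
  esym-reciprocal (i ∷ is) zero    m       e = trans (ℚP.*-identityˡ (prodℚ (map f (i ∷ is)))) (trans (sym (esym-length (map f (i ∷ is))))
    (cong (λ l → esym l (map f (i ∷ is))) (trans (cong suc (ListP.length-map f is)) (sym e))))
  esym-reciprocal (i ∷ is) (suc k) m e = begin
    (g i * esym k ys + esym (suc k) ys) * (f i * P)
      ≡⟨ lemma (g i) (esym k ys) (esym (suc k) ys) (f i) P ⟩
    f i * g i * (esym k ys * P) + f i * (esym (suc k) ys * P)
      ≡⟨ cong₂ (λ u v → u * v + f i * (esym (suc k) ys * P)) (fg≡1 i) (esym-reciprocal is k m (ℕP.suc-injective e)) ⟩
    1ℚ * esym m xs + f i * (esym (suc k) ys * P)
      ≡⟨ last-step m e ⟩
    esym m (map f (i ∷ is)) ∎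
    where
    open ≡-Reasoning
    xs ys : List ℚ
    xs = map f is
    ys = map g is
    P : ℚ
    P = prodℚ xs
    lemma : ∀ g a b f p → (g * a + b) * (f * p) ≡ f * g * (a * p) + f * (b * p)
    lemma = solve-∀ ℚring
    lemma₀ : ∀ f p → 1ℚ * 1ℚ + f * (0ℚ * p) ≡ 1ℚ
    lemma₀ = solve-∀ ℚring
    lemma₁ : ∀ x a b → 1ℚ * b + x * a ≡ x * a + b
    lemma₁ = solve-∀ ℚring
    last-step : ∀ m → suc k ℕ.+ m ≡ length (i ∷ is) → 1ℚ * esym m xs + f i * (esym (suc k) ys * P) ≡ esym m (map f (i ∷ is))
    -- Here `is` has only `k` entries, so no `suc k` reciprocals can be chosen from it.
    last-step zero    e = trans (cong (λ u → 1ℚ * 1ℚ + f i * (u * P))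
      (esym-vanish ys (suc k) (s≤s (ℕP.≤-reflexive (trans (ListP.length-map g is) (trans (sym (ℕP.suc-injective e)) (ℕP.+-identityʳ k))))))) (lemma₀ (f i) P)
    last-step (suc m) e = trans (cong (λ u → 1ℚ * esym (suc m) xs + f i * u) (esym-reciprocal is (suc k) m (trans (sym (ℕP.+-suc k m)) (ℕP.suc-injective e))))
      (lemma₁ (f i) (esym m xs) (esym (suc m) xs))

sum-map-applyUpTo : ∀ (g : ℕ → ℚ) f n → sumℚ (map g (applyUpTo f n)) ≡ ∑ n (λ i → g (f i))
sum-map-applyUpTo g f zero    = refl
sum-map-applyUpTo g f (suc n) = cong₂ _+_ (refl {x = g (f 0)}) (sum-map-applyUpTo g (λ i → f (suc i)) n)

psum-upTo : ∀ k g n → psum k (map g (upTo n)) ≡ ∑ n (λ i → g i ^ k)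
psum-upTo k g n = trans (cong sumℚ (sym (ListP.map-∘ (upTo n)))) (sum-map-applyUpTo (λ i → g i ^ k) (λ i → i) n)

esym-∷ʳ : ∀ k xs x → esym (suc k) (xs ∷ʳ x) ≡ x * esym k xs + esym (suc k) xs
esym-∷ʳ zero    []       x = refl
esym-∷ʳ (suc k) []       x = refl
esym-∷ʳ zero    (y ∷ ys) x = trans (cong₂ _+_ (refl {x = y * 1ℚ}) (esym-∷ʳ 0 ys x)) (lemma x y (esym 1 ys))
  where
  lemma : ∀ x y a → y * 1ℚ + (x * 1ℚ + a) ≡ x * 1ℚ + (y * 1ℚ + a)
  lemma = solve-∀ ℚring
esym-∷ʳ (suc k) (y ∷ ys) x = trans (cong₂ (λ u v → y * u + v) (esym-∷ʳ k ys x) (esym-∷ʳ (suc k) ys x)) (lemma x y (esym k ys) (esym (suc k) ys) (esym (suc (suc k)) ys))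
  where
  lemma : ∀ x y a b c → y * (x * a + b) + (x * b + c) ≡ x * (y * a + b) + (y * b + c)
  lemma = solve-∀ ℚring

prodℚ-∷ʳ : ∀ xs x → prodℚ (xs ∷ʳ x) ≡ x * prodℚ xs
prodℚ-∷ʳ []       x = refl
prodℚ-∷ʳ (y ∷ ys) x = trans (cong (y *_) (prodℚ-∷ʳ ys x)) (lemma y x (prodℚ ys))
  where
  lemma : ∀ a b c → a * (b * c) ≡ b * (a * c)
  lemma = solve-∀ ℚring

-- Elementary symmetric functions of 1, ..., n as polynomials in n

[1⋯_] : ℕ → List ℚ
[1⋯ n ] = map (λ i → ℕ→ℚ (suc i)) (upTo n)

[1⋯suc] : ∀ n → [1⋯ suc n ] ≡ [1⋯ n ] ∷ʳ ℕ→ℚ (suc n)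
[1⋯suc] n = trans (cong (map (λ i → ℕ→ℚ (suc i))) (sym (ListP.applyUpTo-∷ʳ (λ i → i) n))) (ListP.map-++ (λ i → ℕ→ℚ (suc i)) (upTo n) (n ∷ []))

prod-[1⋯] : ∀ n → prodℚ [1⋯ n ] ≡ ℕ→ℚ (n !)
prod-[1⋯] zero    = refl
prod-[1⋯] (suc n) = trans (cong prodℚ ([1⋯suc] n)) (trans (prodℚ-∷ʳ [1⋯ n ] (ℕ→ℚ (suc n))) (trans (cong (ℕ→ℚ (suc n) *_) (prod-[1⋯] n)) (sym (ℕ→ℚ-* (suc n) (n !)))))

esym-[1⋯suc] : ∀ k n → esym (suc k) [1⋯ suc n ] ≡ (1ℚ + ℕ→ℚ n) * esym k [1⋯ n ] + esym (suc k) [1⋯ n ]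
esym-[1⋯suc] k n = trans (cong (esym (suc k)) ([1⋯suc] n)) (trans (esym-∷ʳ k [1⋯ n ] (ℕ→ℚ (suc n))) (cong (λ u → u * esym k [1⋯ n ] + esym (suc k) [1⋯ n ]) (ℕ→ℚ-suc n)))

-- Closed forms of the unsigned Stirling numbers of the first kind `c(x + 1, x + 1 − k)` for k from
-- 1 to 4.
esym₁ esym₂ esym₃ esym₄ : ℚ → ℚ
esym₁ x = (+ 1 / 2) * (x * (x + 1ℚ))
esym₂ x = (+ 1 / 24) * ((x - 1ℚ) * x * (x + 1ℚ) * ((+ 3 / 1) * x + (+ 2 / 1)))
esym₃ x = (+ 1 / 48) * ((x - (+ 2 / 1)) * (x - 1ℚ) * x * x * (x + 1ℚ) * (x + 1ℚ))
esym₄ x = (+ 1 / 5760) * ((x - (+ 3 / 1)) * (x - (+ 2 / 1)) * (x - 1ℚ) * x * (x + 1ℚ)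
  * ((+ 15 / 1) * x * x * x + (+ 15 / 1) * x * x - (+ 10 / 1) * x - (+ 8 / 1)))

-- Adjoining `n + 1` gives a recursion in `n` that, with the value at 0, determines the sequence; a
-- candidate polynomial therefore needs only one polynomial identity.
esym-step : ∀ k (P Q : ℚ → ℚ) → P 0ℚ ≡ 0ℚ → (∀ x → (1ℚ + x) * Q x + P x ≡ P (1ℚ + x)) →
  (∀ n → esym k [1⋯ n ] ≡ Q (ℕ→ℚ n)) → ∀ n → esym (suc k) [1⋯ n ] ≡ P (ℕ→ℚ n)
esym-step k P Q P0 step IH zero    = sym P0
esym-step k P Q P0 step IH (suc n) = trans (esym-[1⋯suc] k n) (trans (cong₂ (λ u v → (1ℚ + ℕ→ℚ n) * u + v) (IH n) (esym-step k P Q P0 step IH n))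
  (trans (step (ℕ→ℚ n)) (cong P (sym (ℕ→ℚ-suc n)))))

esym₁-correct : ∀ n → esym 1 [1⋯ n ] ≡ esym₁ (ℕ→ℚ n)
esym₁-correct = esym-step 0 esym₁ (λ _ → 1ℚ) refl step (λ _ → refl)
  where
  step : ∀ x → (1ℚ + x) * 1ℚ + (+ 1 / 2) * (x * (x + 1ℚ)) ≡ (+ 1 / 2) * ((1ℚ + x) * ((1ℚ + x) + 1ℚ))
  step = solve-∀ ℚring

esym₂-correct : ∀ n → esym 2 [1⋯ n ] ≡ esym₂ (ℕ→ℚ n)
esym₂-correct = esym-step 1 esym₂ esym₁ refl step esym₁-correct
  where
  step : ∀ x → (1ℚ + x) * ((+ 1 / 2) * (x * (x + 1ℚ))) + (+ 1 / 24) * ((x - 1ℚ) * x * (x + 1ℚ) * ((+ 3 / 1) * x + (+ 2 / 1)))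
    ≡ (+ 1 / 24) * (((1ℚ + x) - 1ℚ) * (1ℚ + x) * ((1ℚ + x) + 1ℚ) * ((+ 3 / 1) * (1ℚ + x) + (+ 2 / 1)))
  step = solve-∀ ℚring

esym₃-correct : ∀ n → esym 3 [1⋯ n ] ≡ esym₃ (ℕ→ℚ n)
esym₃-correct = esym-step 2 esym₃ esym₂ refl step esym₂-correct
  where
  step : ∀ x → (1ℚ + x) * ((+ 1 / 24) * ((x - 1ℚ) * x * (x + 1ℚ) * ((+ 3 / 1) * x + (+ 2 / 1))))
      + (+ 1 / 48) * ((x - (+ 2 / 1)) * (x - 1ℚ) * x * x * (x + 1ℚ) * (x + 1ℚ))
    ≡ (+ 1 / 48) * (((1ℚ + x) - (+ 2 / 1)) * ((1ℚ + x) - 1ℚ) * (1ℚ + x) * (1ℚ + x) * ((1ℚ + x) + 1ℚ) * ((1ℚ + x) + 1ℚ))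
  step = solve-∀ ℚring

esym₄-correct : ∀ n → esym 4 [1⋯ n ] ≡ esym₄ (ℕ→ℚ n)
esym₄-correct = esym-step 3 esym₄ esym₃ refl step esym₃-correct
  where
  step : ∀ x → (1ℚ + x) * ((+ 1 / 48) * ((x - (+ 2 / 1)) * (x - 1ℚ) * x * x * (x + 1ℚ) * (x + 1ℚ)))
      + (+ 1 / 5760) * ((x - (+ 3 / 1)) * (x - (+ 2 / 1)) * (x - 1ℚ) * x * (x + 1ℚ) * ((+ 15 / 1) * x * x * x + (+ 15 / 1) * x * x - (+ 10 / 1) * x - (+ 8 / 1)))
    ≡ (+ 1 / 5760) * (((1ℚ + x) - (+ 3 / 1)) * ((1ℚ + x) - (+ 2 / 1)) * ((1ℚ + x) - 1ℚ) * (1ℚ + x) * ((1ℚ + x) + 1ℚ)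
        * ((+ 15 / 1) * (1ℚ + x) * (1ℚ + x) * (1ℚ + x) + (+ 15 / 1) * (1ℚ + x) * (1ℚ + x) - (+ 10 / 1) * (1ℚ + x) - (+ 8 / 1)))
  step = solve-∀ ℚring

-- Rearranging sums under doubling

∑-split : ∀ m n f → ∑ (m ℕ.+ n) f ≡ ∑ m f + ∑ n (λ i → f (m ℕ.+ i))
∑-split zero    n f = sym (ℚP.+-identityˡ (∑ n f))
∑-split (suc m) n f = trans (cong₂ _+_ (refl {x = f 0}) (∑-split m n (λ i → f (suc i)))) (sym (ℚP.+-assoc (f 0) (∑ m (λ i → f (suc i))) (∑ n (λ i → f (suc m ℕ.+ i)))))

∑-interleave : ∀ n f → ∑ (n ℕ.+ n) f ≡ ∑ n (λ i → f (i ℕ.+ i)) + ∑ n (λ i → f (suc (i ℕ.+ i)))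
∑-interleave zero    f = refl
∑-interleave (suc n) f = begin
  f 0 + ∑ (n ℕ.+ suc n) (λ i → f (suc i))
    ≡⟨ cong (λ m → f 0 + ∑ m (λ i → f (suc i))) (ℕP.+-suc n n) ⟩
  f 0 + (f 1 + ∑ (n ℕ.+ n) (λ i → f (suc (suc i))))
    ≡⟨ cong (λ u → f 0 + (f 1 + u)) (∑-interleave n (λ i → f (suc (suc i)))) ⟩
  f 0 + (f 1 + (∑ n (λ i → f (suc (suc (i ℕ.+ i)))) + ∑ n (λ i → f (suc (suc (suc (i ℕ.+ i)))))))
    ≡⟨ cong₂ (λ u v → f 0 + (f 1 + (u + v))) (∑-cong n (λ i _ → cong (λ m → f (suc m)) (sym (ℕP.+-suc i i)))) (∑-cong n (λ i _ → cong (λ m → f (suc (suc m))) (sym (ℕP.+-suc i i)))) ⟩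
  f 0 + (f 1 + (∑ n (λ i → f (suc (i ℕ.+ suc i))) + ∑ n (λ i → f (suc (suc (i ℕ.+ suc i))))))
    ≡⟨ lemma (f 0) (f 1) (∑ n (λ i → f (suc (i ℕ.+ suc i)))) (∑ n (λ i → f (suc (suc (i ℕ.+ suc i))))) ⟩
  (f 0 + ∑ n (λ i → f (suc (i ℕ.+ suc i)))) + (f 1 + ∑ n (λ i → f (suc (suc (i ℕ.+ suc i))))) ∎
  where
  open ≡-Reasoning
  lemma : ∀ a b x y → a + (b + (x + y)) ≡ (a + x) + (b + y)
  lemma = solve-∀ ℚring

-- With F i = f (i + 1) and p = 2h + 1, doubling the residues 1, …, 2h permutes them modulo p:
-- those above h are taken to the odd numbers below p, shifted by p.
∑-doubling : ∀ h F → ∑ (h ℕ.+ h) F - ∑ (h ℕ.+ h) (λ i → F (suc (i ℕ.+ i))) ≡ ∑ h (λ j → F (j ℕ.+ j) - F (j ℕ.+ j ℕ.+ suc (h ℕ.+ h)))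
∑-doubling h F = begin
  ∑ (h ℕ.+ h) F - ∑ (h ℕ.+ h) (λ i → F (suc (i ℕ.+ i)))
    ≡⟨ cong₂ _-_ (∑-interleave h F) (∑-split h h (λ i → F (suc (i ℕ.+ i)))) ⟩
  (X + Y) - (Y + ∑ h (λ j → F (suc ((h ℕ.+ j) ℕ.+ (h ℕ.+ j)))))
    ≡⟨ cong (λ u → (X + Y) - (Y + u)) (∑-cong h (λ j _ → cong F (index h j))) ⟩
  (X + Y) - (Y + Z)
    ≡⟨ lemma X Y Z ⟩
  X + - 1ℚ * Z
    ≡⟨ cong₂ _+_ (refl {x = X}) (∑-*ˡ h (- 1ℚ) (λ j → F (j ℕ.+ j ℕ.+ suc (h ℕ.+ h)))) ⟨
  X + ∑ h (λ j → - 1ℚ * F (j ℕ.+ j ℕ.+ suc (h ℕ.+ h)))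
    ≡⟨ ∑-+ h (λ j → F (j ℕ.+ j)) (λ j → - 1ℚ * F (j ℕ.+ j ℕ.+ suc (h ℕ.+ h))) ⟨
  ∑ h (λ j → F (j ℕ.+ j) + - 1ℚ * F (j ℕ.+ j ℕ.+ suc (h ℕ.+ h)))
    ≡⟨ ∑-cong h (λ j _ → lemma′ (F (j ℕ.+ j)) (F (j ℕ.+ j ℕ.+ suc (h ℕ.+ h)))) ⟩
  ∑ h (λ j → F (j ℕ.+ j) - F (j ℕ.+ j ℕ.+ suc (h ℕ.+ h))) ∎
  where
  open ≡-Reasoning
  X Y Z : ℚ
  X = ∑ h (λ j → F (j ℕ.+ j))
  Y = ∑ h (λ j → F (suc (j ℕ.+ j)))
  Z = ∑ h (λ j → F (j ℕ.+ j ℕ.+ suc (h ℕ.+ h)))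
  lemma : ∀ x y z → (x + y) - (y + z) ≡ x + - 1ℚ * z
  lemma = solve-∀ ℚring
  lemma′ : ∀ x y → x + - 1ℚ * y ≡ x - y
  lemma′ = solve-∀ ℚring
  index : ∀ h j → suc ((h ℕ.+ j) ℕ.+ (h ℕ.+ j)) ≡ j ℕ.+ j ℕ.+ suc (h ℕ.+ h)
  index = ℕR.solve-∀

module _ (p : ℕ) .{{nz : ℕ.NonZero p}} (pr : Prime p) (7≤p : 7 ≤ p) where

  -- Divisibility by powers of p among p-integral rationals

  P : ℚ
  P = ℕ→ℚ p

  ℕ→ℚ-^ : ∀ n k → ℕ→ℚ (n ℕ.^ k) ≡ ℕ→ℚ n ^ k
  ℕ→ℚ-^ n zero    = refl
  ℕ→ℚ-^ n (suc k) = trans (ℕ→ℚ-* n (n ℕ.^ k)) (cong (ℕ→ℚ n *_) (ℕ→ℚ-^ n k))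

  p∤* : ∀ {m n} → ¬ (p ∣ m) → ¬ (p ∣ n) → ¬ (p ∣ m ℕ.* n)
  p∤* {m} {n} p∤m p∤n p∣mn = [ p∤m , p∤n ]′ (euclidsLemma m n pr p∣mn)

  p∤< : ∀ {n} → 0 < n → n < p → ¬ (p ∣ n)
  p∤< {suc n} _ n<p p∣n = ℕP.<⇒≱ n<p (∣.∣⇒≤ p∣n)

  1<p : 1 < p
  1<p = ℕP.≤-trans (s≤s (s≤s z≤n)) 7≤p

  p∤1 : ¬ (p ∣ 1)
  p∤1 = p∤< (s≤s z≤n) 1<p

  p^∣-cancel : ∀ k {m n} → ¬ (p ∣ n) → p ℕ.^ k ∣ m ℕ.* n → p ℕ.^ k ∣ m
  p^∣-cancel zero    {m} _ _ = ∣.1∣ m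
  p^∣-cancel (suc k) {m} {n} p∤n d with euclidsLemma m n pr (∣.∣-trans (∣.m∣m*n (p ℕ.^ k)) d)
  ... | inj₂ p∣n = ⊥-elim (p∤n p∣n)
  ... | inj₁ (divides q refl) = subst (p ℕ.* p ℕ.^ k ∣_) (ℕP.*-comm p q) (∣.*-monoʳ-∣ p (p^∣-cancel k p∤n
          (∣.*-cancelˡ-∣ p (subst (p ℕ.* p ℕ.^ k ∣_) (rearrange q p n) d))))
    where
    rearrange : ∀ q p n → q ℕ.* p ℕ.* n ≡ p ℕ.* (q ℕ.* n)
    rearrange = ℕR.solve-∀

  -- Membership in the localisation of ℤ at p. The fraction need not be reduced, so sums and
  -- products simply multiply denominators.
  record Int (x : ℚ) : Set where
    constructor int
    field
      num   : ℤ
      den   : ℕ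
      p∤den : ¬ (p ∣ den)
      eq    : x * ℕ→ℚ den ≡ ι num

  Int-ι : ∀ a → Int (ι a)
  Int-ι a = int a 1 p∤1 (ℚP.*-identityʳ (ι a))

  Int-ℕ : ∀ n → Int (ℕ→ℚ n)
  Int-ℕ n = Int-ι (+ n)

  Int-+ : ∀ {x y} → Int x → Int y → Int (x + y)
  Int-+ {x} {y} (int a d p∤d e) (int b d′ p∤d′ e′) = int (a ℤ.* + d′ ℤ.+ b ℤ.* + d) (d ℕ.* d′) (p∤* p∤d p∤d′) (begin
    (x + y) * ℕ→ℚ (d ℕ.* d′)
      ≡⟨ cong ((x + y) *_) (ℕ→ℚ-* d d′) ⟩
    (x + y) * (ℕ→ℚ d * ℕ→ℚ d′)
      ≡⟨ lemma x y (ℕ→ℚ d) (ℕ→ℚ d′) ⟩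
    x * ℕ→ℚ d * ℕ→ℚ d′ + y * ℕ→ℚ d′ * ℕ→ℚ d
      ≡⟨ cong₂ (λ u v → u * ℕ→ℚ d′ + v * ℕ→ℚ d) e e′ ⟩
    ι a * ι (+ d′) + ι b * ι (+ d)
      ≡⟨ cong₂ _+_ (ι-* a (+ d′)) (ι-* b (+ d)) ⟨
    ι (a ℤ.* + d′) + ι (b ℤ.* + d)
      ≡⟨ ι-+ (a ℤ.* + d′) (b ℤ.* + d) ⟨
    ι (a ℤ.* + d′ ℤ.+ b ℤ.* + d) ∎)
    where
    open ≡-Reasoning
    lemma : ∀ x y d e → (x + y) * (d * e) ≡ x * d * e + y * e * d
    lemma = solve-∀ ℚring

  Int-* : ∀ {x y} → Int x → Int y → Int (x * y)
  Int-* {x} {y} (int a d p∤d e) (int b d′ p∤d′ e′) = int (a ℤ.* b) (d ℕ.* d′) (p∤* p∤d p∤d′) (begin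
    x * y * ℕ→ℚ (d ℕ.* d′)            ≡⟨ cong (x * y *_) (ℕ→ℚ-* d d′) ⟩
    x * y * (ℕ→ℚ d * ℕ→ℚ d′)          ≡⟨ lemma x y (ℕ→ℚ d) (ℕ→ℚ d′) ⟩
    x * ℕ→ℚ d * (y * ℕ→ℚ d′)          ≡⟨ cong₂ _*_ e e′ ⟩
    ι a * ι b                         ≡⟨ ι-* a b ⟨
    ι (a ℤ.* b)                       ∎)
    where
    open ≡-Reasoning
    lemma : ∀ x y d e → x * y * (d * e) ≡ x * d * (y * e)
    lemma = solve-∀ ℚring

  Int-neg : ∀ {x} → Int x → Int (- x)
  Int-neg {x} i = subst Int (lemma x) (Int-* (Int-ι (ℤ.- (+ 1))) i)
    where
    lemma : ∀ x → (- 1ℚ) * x ≡ - x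
    lemma = solve-∀ ℚring

  Int-- : ∀ {x y} → Int x → Int y → Int (x - y)
  Int-- i j = Int-+ i (Int-neg j)

  Int-^ : ∀ {x} n → Int x → Int (x ^ n)
  Int-^ zero    i = Int-ℕ 1
  Int-^ (suc n) i = Int-* i (Int-^ n i)

  Int-1/ : ∀ d .{{_ : ℕ.NonZero d}} → ¬ (p ∣ d) → Int (+ 1 / d)
  Int-1/ d p∤d = int (+ 1) d p∤d (1/-inverse d)

  Int-1/< : ∀ n → suc n < p → Int (+ 1 / suc n)
  Int-1/< n n<p = Int-1/ (suc n) (p∤< (s≤s z≤n) n<p)

  Int-1/! : ∀ n → n < p → Int (1/! n)
  Int-1/! zero    _     = Int-ℕ 1
  Int-1/! (suc n) n<p = Int-* (Int-1/! n (ℕP.<-trans (ℕP.n<1+n n) n<p)) (Int-1/< n n<p)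

  Int-⊛ : ∀ n {f g} → (∀ i → i ≤ n → Int (f i)) → (∀ i → i ≤ n → Int (g i)) → Int ((f ⊛ g) n)
  Int-⊛ zero    If Ig = Int-* (If 0 z≤n) (Ig 0 z≤n)
  Int-⊛ (suc n) If Ig = Int-+ (Int-* (If 0 z≤n) (Ig (suc n) ℕP.≤-refl)) (Int-⊛ n (λ i i≤n → If (suc i) (s≤s i≤n)) (λ i i≤n → Ig i (ℕP.m≤n⇒m≤1+n i≤n)))

  -- Membership in p^k times the p-integral rationals. Keeping the quotient makes exponents add
  -- under multiplication and lets a factor p be cancelled.
  record Div (k : ℕ) (x : ℚ) : Set where
    constructor div
    field
      quot    : ℚ
      isInt   : Int quot
      factors : x ≡ P ^ k * quot

  Div-0 : ∀ {x} → Int x → Div 0 x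
  Div-0 {x} i = div x i (sym (ℚP.*-identityˡ x))

  Div⇒Int : ∀ {k x} → Div k x → Int x
  Div⇒Int {k} (div q i e) = subst Int (sym e) (Int-* (Int-^ k (Int-ℕ p)) i)

  Div-* : ∀ {k l x y} → Div k x → Div l y → Div (k ℕ.+ l) (x * y)
  Div-* {k} {l} (div q i e) (div r j f) = div (q * r) (Int-* i j) (trans (cong₂ _*_ e f) (trans (lemma (P ^ k) q (P ^ l) r) (cong (_* (q * r)) (sym (^-homo-* P k l)))))
    where
    lemma : ∀ a b c d → a * b * (c * d) ≡ a * c * (b * d)
    lemma = solve-∀ ℚring

  Div-+ : ∀ {k x y} → Div k x → Div k y → Div k (x + y)
  Div-+ {k} (div q i e) (div r j f) = div (q + r) (Int-+ i j) (trans (cong₂ _+_ e f) (sym (ℚP.*-distribˡ-+ (P ^ k) q r)))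

  Div-*ˡ : ∀ {k c x} → Int c → Div k x → Div k (c * x)
  Div-*ˡ i d = Div-* (Div-0 i) d

  Div-*ʳ : ∀ {k c x} → Int c → Div k x → Div k (x * c)
  Div-*ʳ {k} {c} {x} i d = subst (Div k) (ℚP.*-comm c x) (Div-*ˡ i d)

  Div-neg : ∀ {k x} → Div k x → Div k (- x)
  Div-neg {k} {x} d = subst (Div k) (lemma x) (Div-*ˡ (Int-ι (ℤ.- (+ 1))) d)
    where
    lemma : ∀ x → (- 1ℚ) * x ≡ - x
    lemma = solve-∀ ℚring

  Div-- : ∀ {k x y} → Div k x → Div k y → Div k (x - y)
  Div-- d e = Div-+ d (Div-neg e)

  Div-P^ : ∀ k → Div k (P ^ k)
  Div-P^ k = div 1ℚ (Int-ℕ 1) (sym (ℚP.*-identityʳ (P ^ k)))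

  Div-P : Div 1 P
  Div-P = subst (Div 1) (ℚP.*-identityʳ P) (Div-P^ 1)

  Div-≤ : ∀ {k l x} → l ≤ k → Div k x → Div l x
  Div-≤ {k} {l} l≤k (div q i e) = div (P ^ (k ∸ l) * q) (Int-* (Int-^ (k ∸ l) (Int-ℕ p)) i)
    (trans e (trans (cong (λ m → P ^ m * q) (sym (ℕP.m+[n∸m]≡n l≤k))) (trans (cong (_* q) (^-homo-* P l (k ∸ l))) (ℚP.*-assoc (P ^ l) (P ^ (k ∸ l)) q))))

  Div-0ℚ : ∀ k → Div k 0ℚ
  Div-0ℚ k = div 0ℚ (Int-ℕ 0) (sym (ℚP.*-zeroʳ (P ^ k)))

  Div-∑ : ∀ {k} n {f} → (∀ i → i < n → Div k (f i)) → Div k (∑ n f)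
  Div-∑ {k} zero    d = Div-0ℚ k
  Div-∑     (suc n) d = Div-+ (d 0 (s≤s z≤n)) (Div-∑ n (λ i i<n → d (suc i) (s≤s i<n)))

  Div-unit : ∀ {k x} d .{{_ : ℕ.NonZero d}} → ¬ (p ∣ d) → Div k (ℕ→ℚ d * x) → Div k x
  Div-unit {k} {x} d p∤d D = subst (Div k) (trans (sym (ℚP.*-assoc (+ 1 / d) (ℕ→ℚ d) x)) (trans (cong (_* x) (1/-inverse d)) (ℚP.*-identityˡ x))) (Div-*ˡ (Int-1/ d p∤d) D)

  Div-unit< : ∀ {k x} n → suc n < p → Div k (ℕ→ℚ (suc n) * x) → Div k x
  Div-unit< n n<p = Div-unit (suc n) (p∤< (s≤s z≤n) n<p)

  Div-/P : ∀ {k x} → Div (suc k) (P * x) → Div k x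
  Div-/P {k} {x} (div q i e) = div q i (*-cancelʳ-ℕ→ℚ p (trans (ℚP.*-comm x P) (trans e (lemma P (P ^ k) q))))
    where
    lemma : ∀ a b c → a * b * c ≡ b * c * a
    lemma = solve-∀ ℚring

  -- Only here do reduced fractions enter. Cross-multiplying gives numerator · `d` = `a` ·
  -- denominator · p^k; since p does not divide `d`, p^k divides the numerator. A factor p of the
  -- denominator would divide the numerator too, against coprimality.
  Div⇒mod : ∀ {k x y} → Div k (x - y) → x ≡ y [mod p ^ k ]
  Div⇒mod {k} {x} {y} (div q (int a d p∤d e) f) = go (x - y) refl
    where
    go : ∀ z → z ≡ x - y → (p ℕ.^ k ∣ ℤ.∣ ↥ z ∣) × ¬ (p ∣ ↧ₙ z)
    go z@(mkℚ n d-1 c) z≡ = p^∣-cancel k p∤d (divides (ℤ.∣ a ∣ ℕ.* suc d-1) abs-eq) , p∤denominator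
      where
      open ≡-Reasoning
      lemma₁ : ∀ n d s → n * d * s ≡ n * s * d
      lemma₁ = solve-∀ ℚring
      lemma₂ : ∀ P q d s → P * q * d * s ≡ q * d * s * P
      lemma₂ = solve-∀ ℚring
      int-eq : n ℤ.* + d ≡ a ℤ.* + suc d-1 ℤ.* + (p ℕ.^ k)
      int-eq = ι-injective (begin
        ι (n ℤ.* + d)                        ≡⟨ ι-* n (+ d) ⟩
        ι n * ℕ→ℚ d                          ≡⟨ cong (_* ℕ→ℚ d) (↥-* z) ⟨
        z * ℕ→ℚ (suc d-1) * ℕ→ℚ d            ≡⟨ lemma₁ z (ℕ→ℚ (suc d-1)) (ℕ→ℚ d) ⟩
        z * ℕ→ℚ d * ℕ→ℚ (suc d-1)            ≡⟨ cong (λ u → u * ℕ→ℚ d * ℕ→ℚ (suc d-1)) (trans z≡ f) ⟩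
        P ^ k * q * ℕ→ℚ d * ℕ→ℚ (suc d-1)    ≡⟨ lemma₂ (P ^ k) q (ℕ→ℚ d) (ℕ→ℚ (suc d-1)) ⟩
        q * ℕ→ℚ d * ℕ→ℚ (suc d-1) * P ^ k    ≡⟨ cong₂ (λ u v → u * ℕ→ℚ (suc d-1) * v) e (sym (ℕ→ℚ-^ p k)) ⟩
        ι a * ℕ→ℚ (suc d-1) * ℕ→ℚ (p ℕ.^ k)  ≡⟨ cong (_* ℕ→ℚ (p ℕ.^ k)) (ι-* a (+ suc d-1)) ⟨
        ι (a ℤ.* + suc d-1) * ℕ→ℚ (p ℕ.^ k)  ≡⟨ ι-* (a ℤ.* + suc d-1) (+ (p ℕ.^ k)) ⟨
        ι (a ℤ.* + suc d-1 ℤ.* + (p ℕ.^ k))  ∎)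
      abs-eq : ℤ.∣ n ∣ ℕ.* d ≡ ℤ.∣ a ∣ ℕ.* suc d-1 ℕ.* p ℕ.^ k
      abs-eq = begin
        ℤ.∣ n ∣ ℕ.* d                                ≡⟨ ℤP.abs-* n (+ d) ⟨
        ℤ.∣ n ℤ.* + d ∣                              ≡⟨ cong ℤ.∣_∣ int-eq ⟩
        ℤ.∣ a ℤ.* + suc d-1 ℤ.* + (p ℕ.^ k) ∣        ≡⟨ ℤP.abs-* (a ℤ.* + suc d-1) (+ (p ℕ.^ k)) ⟩
        ℤ.∣ a ℤ.* + suc d-1 ∣ ℕ.* p ℕ.^ k            ≡⟨ cong (ℕ._* p ℕ.^ k) (ℤP.abs-* a (+ suc d-1)) ⟩
        ℤ.∣ a ∣ ℕ.* suc d-1 ℕ.* p ℕ.^ k              ∎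
      p∤denominator : ¬ (p ∣ suc d-1)
      p∤denominator p∣s = p∤1 (subst (p ∣_) (Coprime.recompute c (p∣n , p∣s)) ∣.∣-refl)
        where
        p∣n : p ∣ ℤ.∣ n ∣
        p∣n = [ (λ h → h) , (λ p∣d → ⊥-elim (p∤d p∣d)) ]′ (euclidsLemma ℤ.∣ n ∣ d pr
          (subst (p ∣_) (sym abs-eq) (∣.∣m⇒∣m*n (p ℕ.^ k) (∣.∣n⇒∣m*n ℤ.∣ a ∣ p∣s))))

  -- p ^ k / (k + 1)
  P^/suc : ℕ → ℚ
  P^/suc k = P ^ k * (+ 1 / suc k)

  -- If `k + 1 = (c + 1) p`, the quotient is `P ^ r` times `P^/suc c` with `r = k − (c + 1)`. As p ≥
  -- 7 forces `r ≥ 3`, up to the cap 3 mere integrality of the smaller quotient suffices.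
  P^/suc-Div : ∀ k m → m ≤ k → m ≤ 3 → Div m (P^/suc k)
  P^/suc-Div = <-rec _ step
    where
    step : ∀ k → (∀ {j} → j < k → ∀ m → m ≤ j → m ≤ 3 → Div m (P^/suc j)) → ∀ m → m ≤ k → m ≤ 3 → Div m (P^/suc k)
    step k rec m m≤k m≤3 with p ∣? suc k
    ... | no  p∤k = Div-≤ m≤k (Div-*ʳ (Int-1/ (suc k) p∤k) (Div-P^ k))
    ... | yes (divides (suc c) e) = Div-≤ (ℕP.≤-trans m≤3 3≤r) (subst (Div r) (sym split) (Div-*ʳ (Div⇒Int (rec c<k 0 z≤n z≤n)) (Div-P^ r)))
      where
      open ≡-Reasoning
      r : ℕ
      r = k ∸ suc c
      bound : suc c ℕ.+ 3 ≤ k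
      bound = ℕP.≤-pred (ℕP.≤-trans (ℕP.≤-trans (ℕP.≤-trans (ℕP.m≤m+n _ (2 ℕ.+ 6 ℕ.* c)) (ℕP.≤-reflexive (lemma c))) (ℕP.*-monoʳ-≤ (suc c) 7≤p)) (ℕP.≤-reflexive (sym e)))
        where
        lemma : ∀ c → suc (suc c ℕ.+ 3) ℕ.+ (2 ℕ.+ 6 ℕ.* c) ≡ suc c ℕ.* 7
        lemma = ℕR.solve-∀
      c<k : c < k
      c<k = ℕP.≤-trans (ℕP.m≤m+n (suc c) 3) bound
      3≤r : 3 ≤ r
      3≤r = ℕP.≤-trans (ℕP.≤-reflexive (sym (ℕP.m+n∸m≡n (suc c) 3))) (ℕP.∸-monoˡ-≤ (suc c) bound)
      lemma₁ : ∀ i p s → i * p * s ≡ i * (s * p)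
      lemma₁ = solve-∀ ℚring
      lemma₂ : ∀ p a b i → p * a * b * i ≡ b * (a * (i * p))
      lemma₂ = solve-∀ ℚring
      recip : (+ 1 / suc k) * P ≡ + 1 / suc c
      recip = *-cancelʳ-ℕ→ℚ (suc c) (begin
        (+ 1 / suc k) * P * ℕ→ℚ (suc c)      ≡⟨ lemma₁ (+ 1 / suc k) P (ℕ→ℚ (suc c)) ⟩
        (+ 1 / suc k) * (ℕ→ℚ (suc c) * P)    ≡⟨ cong ((+ 1 / suc k) *_) (trans (sym (ℕ→ℚ-* (suc c) p)) (cong ℕ→ℚ (sym e))) ⟩
        (+ 1 / suc k) * ℕ→ℚ (suc k)          ≡⟨ 1/-inverse (suc k) ⟩
        1ℚ                                   ≡⟨ 1/-inverse (suc c) ⟨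
        (+ 1 / suc c) * ℕ→ℚ (suc c)          ∎)
      split : P^/suc k ≡ P ^ r * P^/suc c
      split = begin
        P ^ k * (+ 1 / suc k)                    ≡⟨ cong (λ n → P ^ n * (+ 1 / suc k)) (ℕP.m+[n∸m]≡n c<k) ⟨
        P ^ (suc c ℕ.+ r) * (+ 1 / suc k)        ≡⟨ cong (_* (+ 1 / suc k)) (^-homo-* P (suc c) r) ⟩
        P * P ^ c * P ^ r * (+ 1 / suc k)        ≡⟨ lemma₂ P (P ^ c) (P ^ r) (+ 1 / suc k) ⟩
        P ^ r * (P ^ c * ((+ 1 / suc k) * P))    ≡⟨ cong (λ u → P ^ r * (P ^ c * u)) recip ⟩
        P ^ r * P^/suc c                         ∎

  -- Fermat's little theorem

  fermat-step : ∀ m → p ≡ suc (suc m) → ∀ x → Int x → Div 1 ((x + 1ℚ) ^ p - x ^ p - 1ℚ)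
  fermat-step m p≡ x Ix = subst (Div 1) (sym expand) (Div-*ʳ (Int-* (Int-ℕ (suc m !)) middle) Div-P)
    where
    open ≡-Reasoning
    f g : ℕ → ℚ
    f i = expS x (suc i)
    g i = expS 1ℚ (suc i)
    small : ∀ {i} → i ≤ m → suc i < p
    small i≤m = ℕP.≤-trans (s≤s (s≤s i≤m)) (ℕP.≤-reflexive (sym p≡))
    -- The inner binomial terms contain only factorials below p, so the factor p of `p !` survives.
    middle : Int ((f ⊛ g) m)
    middle = Int-⊛ m (λ i i≤m → Int-* (Int-^ (suc i) Ix) (Int-1/! (suc i) (small i≤m))) (λ i i≤m → Int-* (Int-^ (suc i) (Int-ℕ 1)) (Int-1/! (suc i) (small i≤m)))
    scale : ∀ y → ℕ→ℚ (p !) * expS y p ≡ y ^ p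
    scale y = trans (lemma (ℕ→ℚ (p !)) (y ^ p) (1/! p)) (trans (cong (y ^ p *_) (!*1/! p)) (ℚP.*-identityʳ (y ^ p)))
      where
      lemma : ∀ a b c → a * (b * c) ≡ b * (a * c)
      lemma = solve-∀ ℚring
    binomial : expS (x + 1ℚ) p ≡ expS 1ℚ p + ((f ⊛ g) m + expS x p)
    binomial = begin
      expS (x + 1ℚ) p
        ≡⟨ expS-+ x 1ℚ p ⟨
      (expS x ⊛ expS 1ℚ) p
        ≡⟨ cong (expS x ⊛ expS 1ℚ) p≡ ⟩
      1ℚ * 1ℚ * expS 1ℚ (suc (suc m)) + (f ⊛ expS 1ℚ) (suc m)
        ≡⟨ cong₂ (λ u v → u + v) (ℚP.*-identityˡ (expS 1ℚ (suc (suc m)))) (trans (⊛-snoc f (expS 1ℚ) m) (cong₂ _+_ (refl {x = (f ⊛ g) m}) (ℚP.*-identityʳ (f (suc m))))) ⟩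
      expS 1ℚ (suc (suc m)) + ((f ⊛ g) m + expS x (suc (suc m)))
        ≡⟨ cong (λ n → expS 1ℚ n + ((f ⊛ g) m + expS x n)) p≡ ⟨
      expS 1ℚ p + ((f ⊛ g) m + expS x p) ∎
    p! : ℕ→ℚ (p !) ≡ P * ℕ→ℚ (suc m !)
    p! = trans (cong (λ n → ℕ→ℚ (n !)) p≡) (trans (ℕ→ℚ-* (suc (suc m)) (suc m !)) (cong (λ n → ℕ→ℚ n * ℕ→ℚ (suc m !)) (sym p≡)))
    lemma₁ : ∀ a b c d → a * (b + (c + d)) ≡ a * b + (a * c + a * d)
    lemma₁ = solve-∀ ℚring
    lemma₂ : ∀ p f c y → (1ℚ + (p * f * c + y)) - y - 1ℚ ≡ p * (f * c)
    lemma₂ = solve-∀ ℚring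
    expand : (x + 1ℚ) ^ p - x ^ p - 1ℚ ≡ P * (ℕ→ℚ (suc m !) * (f ⊛ g) m)
    expand = begin
      (x + 1ℚ) ^ p - x ^ p - 1ℚ
        ≡⟨ cong (λ u → u - x ^ p - 1ℚ) (scale (x + 1ℚ)) ⟨
      ℕ→ℚ (p !) * expS (x + 1ℚ) p - x ^ p - 1ℚ
        ≡⟨ cong (λ u → u - x ^ p - 1ℚ) (trans (cong (ℕ→ℚ (p !) *_) binomial) (lemma₁ (ℕ→ℚ (p !)) (expS 1ℚ p) ((f ⊛ g) m) (expS x p))) ⟩
      (ℕ→ℚ (p !) * expS 1ℚ p + (ℕ→ℚ (p !) * (f ⊛ g) m + ℕ→ℚ (p !) * expS x p)) - x ^ p - 1ℚ
        ≡⟨ cong₂ (λ u v → (u + (ℕ→ℚ (p !) * (f ⊛ g) m + v)) - x ^ p - 1ℚ) (trans (scale 1ℚ) (1^ p)) (scale x) ⟩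
      (1ℚ + (ℕ→ℚ (p !) * (f ⊛ g) m + x ^ p)) - x ^ p - 1ℚ
        ≡⟨ cong (λ u → (1ℚ + (u * (f ⊛ g) m + x ^ p)) - x ^ p - 1ℚ) p! ⟩
      (1ℚ + (P * ℕ→ℚ (suc m !) * (f ⊛ g) m + x ^ p)) - x ^ p - 1ℚ
        ≡⟨ lemma₂ P (ℕ→ℚ (suc m !)) ((f ⊛ g) m) (x ^ p) ⟩
      P * (ℕ→ℚ (suc m !) * (f ⊛ g) m) ∎

  p≡suc : p ≡ suc (p ∸ 1)
  p≡suc = sym (ℕP.m+[n∸m]≡n (ℕP.≤-trans (s≤s z≤n) 7≤p))

  fermat : ∀ n → Div 1 (ℕ→ℚ n ^ p - ℕ→ℚ n)
  fermat zero    = subst (Div 1) (sym (trans (cong (λ m → 0ℚ ^ m - 0ℚ) p≡suc) (lemma (0ℚ ^ (p ∸ 1))))) (Div-0ℚ 1)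
    where
    lemma : ∀ x → 0ℚ * x - 0ℚ ≡ 0ℚ
    lemma = solve-∀ ℚring
  fermat (suc n) = subst (Div 1) (trans (lemma (ℕ→ℚ n) (ℕ→ℚ n ^ p) ((ℕ→ℚ n + 1ℚ) ^ p)) (cong (λ u → u ^ p - u) (trans (ℚP.+-comm (ℕ→ℚ n) 1ℚ) (sym (ℕ→ℚ-suc n)))))
    (Div-+ (fermat-step (p ∸ 2) (sym (ℕP.m+[n∸m]≡n 1<p)) (ℕ→ℚ n) (Int-ℕ n)) (fermat n))
    where
    lemma : ∀ x y z → (z - y - 1ℚ) + (y - x) ≡ z - (x + 1ℚ)
    lemma = solve-∀ ℚring

  fermat-unit : ∀ n → ¬ (p ∣ n) → Div 1 (ℕ→ℚ n ^ (p ∸ 1) - 1ℚ)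
  fermat-unit zero      p∤n = ⊥-elim (p∤n (p ∣.∣0))
  fermat-unit n@(suc _) p∤n = Div-unit n p∤n (subst (Div 1) (trans (cong (λ m → ℕ→ℚ n ^ m - ℕ→ℚ n) p≡suc) (lemma (ℕ→ℚ n) (ℕ→ℚ n ^ (p ∸ 1)))) (fermat n))
    where
    lemma : ∀ x y → x * y - x ≡ x * (y - 1ℚ)
    lemma = solve-∀ ℚring

  -- Power sums of 1, …, p − 1

  S : ℕ → ℚ
  S k = ∑ (p ∸ 1) (λ i → ℕ→ℚ (suc i) ^ k)

  Int-S : ∀ k → Int (S k)
  Int-S k = Div⇒Int (Div-∑ {0} (p ∸ 1) (λ i _ → Div-0 (Int-^ k (Int-ℕ (suc i)))))

  private
    coefficient : ℕ → ℕ → ℚ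
    coefficient N k = ℕ→ℚ (N !) * (1/! k * 1/! (N ∸ k))

    Int-coefficient : ∀ {N k} → k ≤ N → Int (coefficient N k)
    Int-coefficient {N} {k} k≤N = subst Int (ℕ→ℚ-C k≤N) (Int-ℕ (N C k))

    -- The summand of Faulhaber's formula for `S N`, grouped so that every factor is p-integral: one
    -- p stays with the Bernoulli number to absorb its denominator.
    term : ℕ → ℕ → ℚ
    term N k = coefficient N k * ((P * B (N ∸ k)) * P^/suc k)

  S-faulhaber : ∀ n → S (suc n) ≡ ∑ (suc (suc n)) (term (suc n))
  S-faulhaber n = begin
    S N
      ≡⟨ lemma₀ (0ℚ ^ n) (S N) ⟩
    0ℚ * 0ℚ ^ n + S N
      ≡⟨ cong (λ k → ∑ k (λ i → ℕ→ℚ i ^ N)) p≡suc ⟨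
    ∑ p (λ i → ℕ→ℚ i ^ N)
      ≡⟨ ∑-cong p (λ i _ → sym (scale (ℕ→ℚ i ^ N))) ⟩
    ∑ p (λ i → ℕ→ℚ (N !) * expS (ℕ→ℚ i) N)
      ≡⟨ ∑-*ˡ p (ℕ→ℚ (N !)) (λ i → expS (ℕ→ℚ i) N) ⟩
    ℕ→ℚ (N !) * ∑ p (λ i → expS (ℕ→ℚ i) N)
      ≡⟨ cong (ℕ→ℚ (N !) *_) (trans (faulhaber p N) (trans (⊛-comm bernS (expₙS p) N) (⊛-∑ (expₙS p) bernS N))) ⟩
    ℕ→ℚ (N !) * ∑ (suc N) (λ k → expₙS p k * bernS (N ∸ k))
      ≡⟨ ∑-*ˡ (suc N) (ℕ→ℚ (N !)) (λ k → expₙS p k * bernS (N ∸ k)) ⟨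
    ∑ (suc N) (λ k → ℕ→ℚ (N !) * (expₙS p k * bernS (N ∸ k)))
      ≡⟨ ∑-cong (suc N) (λ k _ → lemma (ℕ→ℚ (N !)) P (P ^ k) (1/! k) (+ 1 / suc k) (B (N ∸ k)) (1/! (N ∸ k))) ⟩
    ∑ (suc N) (term N) ∎
    where
    open ≡-Reasoning
    N : ℕ
    N = suc n
    lemma₀ : ∀ x y → y ≡ 0ℚ * x + y
    lemma₀ = solve-∀ ℚring
    lemma₁ : ∀ a b c → a * (b * c) ≡ b * (a * c)
    lemma₁ = solve-∀ ℚring
    scale : ∀ x → ℕ→ℚ (N !) * (x * 1/! N) ≡ x
    scale x = trans (lemma₁ (ℕ→ℚ (N !)) x (1/! N)) (trans (cong (x *_) (!*1/! N)) (ℚP.*-identityʳ x))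
    lemma : ∀ f p q r s b t → f * (p * q * (r * s) * (b * t)) ≡ f * (r * t) * (p * b * (q * s))
    lemma = solve-∀ ℚring

  private
    term-0 : ∀ N → term N 0 ≡ P * B N
    term-0 N = trans (lemma (ℕ→ℚ (N !)) (1/! N) (P * B N)) (trans (cong (_* (P * B N)) (!*1/! N)) (ℚP.*-identityˡ (P * B N)))
      where
      lemma : ∀ a b x → a * (1ℚ * b) * (x * (1ℚ * 1ℚ)) ≡ a * b * x
      lemma = solve-∀ ℚring

    term-Div : ∀ N k j l → k ≤ N → Div j (P * B (N ∸ k)) → l ≤ k → l ≤ 3 → Div (j ℕ.+ l) (term N k)
    term-Div N k j l k≤N D l≤k l≤3 = Div-*ˡ (Int-coefficient k≤N) (Div-* D (P^/suc-Div k l l≤k l≤3))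

    S-tail : ∀ {k} n → Div k (∑ (suc n) (λ i → term (suc n) (suc i))) → Div k (S (suc n) - P * B (suc n))
    S-tail {k} n D = subst (Div k) (sym (trans (cong₂ _-_ (S-faulhaber n) (sym (term-0 (suc n)))) (lemma (term (suc n) 0) (∑ (suc n) (λ i → term (suc n) (suc i)))))) D
      where
      lemma : ∀ x y → (x + y) - x ≡ y
      lemma = solve-∀ ℚring

  -- A weak form of the von Staudt-Clausen theorem. In Faulhaber's formula `S N` is an integer and
  -- the other summands only involve Bernoulli numbers of smaller index, so integrality passes
  -- upwards.
  Int-PB : ∀ N → Int (P * B N)
  Int-PB = <-rec _ step
    where
    lemma : ∀ x y → x - (x - y) ≡ y
    lemma = solve-∀ ℚring
    step : ∀ N → (∀ {j} → j < N → Int (P * B j)) → Int (P * B N)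
    step zero    rec = Int-* (Int-ℕ p) (Int-ℕ 1)
    step (suc n) rec = subst Int (lemma (S (suc n)) (P * B (suc n)))
      (Int-- (Int-S (suc n)) (Div⇒Int (S-tail {0} n (Div-∑ (suc n) (λ { i (s≤s i≤n) →
        term-Div (suc n) (suc i) 0 0 (s≤s i≤n) (Div-0 (rec (s≤s (ℕP.m∸n≤m n i)))) z≤n z≤n })))))

  S≡PB-mod-p : ∀ n → Div 1 (S (suc n) - P * B (suc n))
  S≡PB-mod-p n = S-tail n (Div-∑ (suc n) (λ { i (s≤s i≤n) → term-Div (suc n) (suc i) 0 1 (s≤s i≤n) (Div-0 (Int-PB (n ∸ i))) (s≤s z≤n) (s≤s z≤n) }))

  -- The terms with `k ≥ 2` have p² from `P^/suc k`; the term `k = 1` has one p there and takes the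
  -- other from `P * B n`.
  S≡PB-mod-p² : ∀ n → Int (B n) → Div 2 (S (suc n) - P * B (suc n))
  S≡PB-mod-p² n IB = S-tail n (Div-+
    (term-Div (suc n) 1 1 1 (s≤s z≤n) (Div-*ʳ IB Div-P) (s≤s z≤n) (s≤s z≤n))
    (Div-∑ n (λ i i<n → term-Div (suc n) (suc (suc i)) 0 2 (s≤s i<n) (Div-0 (Int-PB (n ∸ suc i))) (s≤s (s≤s z≤n)) (s≤s (s≤s z≤n)))))

  -- The term `k = 1` vanishes with `B (suc n)`, and `k = 2` has p² from `P^/suc 2` and a third p
  -- from `P * B n`. For even power sums the vanishing is `B-odd`.
  S≡PB-mod-p³ : ∀ n → B (suc n) ≡ 0ℚ → Int (B n) → Div 3 (S (suc (suc n)) - P * B (suc (suc n)))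
  S≡PB-mod-p³ n B≡0 IB = S-tail (suc n) (Div-+ (subst (Div 3) (sym term₁) (Div-0ℚ 3)) (Div-+
    (term-Div (suc (suc n)) 2 1 2 (s≤s (s≤s z≤n)) (Div-*ʳ IB Div-P) (s≤s (s≤s z≤n)) (s≤s (s≤s z≤n)))
    (Div-∑ n (λ i i<n → term-Div (suc (suc n)) (suc (suc (suc i))) 0 3 (s≤s (s≤s i<n)) (Div-0 (Int-PB (n ∸ suc i))) (s≤s (s≤s (s≤s z≤n))) ℕP.≤-refl))))
    where
    lemma : ∀ c p q → c * (p * 0ℚ * q) ≡ 0ℚ
    lemma = solve-∀ ℚring
    term₁ : term (suc (suc n)) 1 ≡ 0ℚ
    term₁ = trans (cong (λ b → coefficient (suc (suc n)) 1 * (P * b * P^/suc 1)) B≡0) (lemma (coefficient (suc (suc n)) 1) P (P^/suc 1))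

  -- Serves indices beyond p, where the recursion for the Bernoulli numbers no longer divides by
  -- units only: it suffices that p divides the power sum.
  Int-B : ∀ n → Div 1 (S (suc n)) → Int (B (suc n))
  Int-B n D = Div⇒Int (Div-/P {0} (subst (Div 1) (lemma (S (suc n)) (P * B (suc n))) (Div-- D (S≡PB-mod-p n))))
    where
    lemma : ∀ x y → x - (x - y) ≡ y
    lemma = solve-∀ ℚring

  -- Up to index `p − 2` the recursion divides only by numbers below p.
  Int-B< : ∀ n → suc n < p → Int (B n)
  Int-B< = <-rec _ step
    where
    step : ∀ n → (∀ {j} → j < n → suc j < p → Int (B j)) → suc n < p → Int (B n)
    step zero    rec _   = Int-ℕ 1
    step (suc n) rec n<p = subst Int (sym (B-suc n)) (Int-neg (Int-* (Int-1/< (suc n) n<p)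
      (Div⇒Int (Div-∑ {0} (suc n) (λ i i≤n → Div-0 (Int-* (Int-ℕ (suc (suc n) C i)) (rec i≤n (ℕP.<-trans (s≤s i≤n) n<p))))))))

  Div-S : ∀ n → suc (suc n) < p → Div 1 (S (suc n))
  Div-S n n<p = subst (Div 1) (lemma (S (suc n)) (P * B (suc n))) (Div-+ (S≡PB-mod-p n) (Div-*ʳ (Int-B< (suc n) n<p) Div-P))
    where
    lemma : ∀ x y → (x - y) + y ≡ x
    lemma = solve-∀ ℚring

  Div-∑-diff : ∀ {k} n {f g} → (∀ i → i < n → Div k (f i - g i)) → Div k (∑ n f - ∑ n g)
  Div-∑-diff {k} zero    D = Div-0ℚ k
  Div-∑-diff {k} (suc n) {f} {g} D = subst (Div k) (lemma (f 0) (g 0) (∑ n (λ i → f (suc i))) (∑ n (λ i → g (suc i))))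
    (Div-+ (D 0 (s≤s z≤n)) (Div-∑-diff n (λ i i<n → D (suc i) (s≤s i<n))))
    where
    lemma : ∀ a b x y → (a - b) + (x - y) ≡ (a + x) - (b + y)
    lemma = solve-∀ ℚring

  p∤suc : ∀ {i} → i < p ∸ 1 → ¬ (p ∣ suc i)
  p∤suc {i} i< = p∤< (s≤s z≤n) (ℕP.≤-trans (s≤s i<) (ℕP.≤-reflexive (sym p≡suc)))

  S-periodic : ∀ k → Div 1 (S (k ℕ.+ (p ∸ 1)) - S k)
  S-periodic k = Div-∑-diff (p ∸ 1) (λ i i< → subst (Div 1)
    (trans (lemma (ℕ→ℚ (suc i) ^ k) (ℕ→ℚ (suc i) ^ (p ∸ 1))) (cong (_- ℕ→ℚ (suc i) ^ k) (sym (^-homo-* (ℕ→ℚ (suc i)) k (p ∸ 1)))))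
    (Div-*ˡ (Int-^ k (Int-ℕ (suc i))) (fermat-unit (suc i) (p∤suc i<))))
    where
    lemma : ∀ x y → x * (y - 1ℚ) ≡ x * y - x
    lemma = solve-∀ ℚring

  ℕ→ℚ-p∸1 : ℕ→ℚ (p ∸ 1) ≡ P - 1ℚ
  ℕ→ℚ-p∸1 = ℕ→ℚ-∸ (ℕP.≤-trans (s≤s z≤n) 7≤p)

  ∑-const : ∀ n → ∑ n (λ _ → 1ℚ) ≡ ℕ→ℚ n
  ∑-const zero    = refl
  ∑-const (suc n) = trans (cong (λ u → 1ℚ + u) (∑-const n)) (sym (ℕ→ℚ-suc n))

  S-p∸1 : Div 1 (S (p ∸ 1) - (P - 1ℚ))
  S-p∸1 = subst (λ u → Div 1 (S (p ∸ 1) - u)) (trans (∑-const (p ∸ 1)) ℕ→ℚ-p∸1) (Div-∑-diff (p ∸ 1) (λ i i< → fermat-unit (suc i) (p∤suc i<)))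

  Div-⊛ : ∀ {k l} n {f g} → (∀ i → i ≤ n → Div k (f i)) → (∀ i → i ≤ n → Div l (g i)) → Div (k ℕ.+ l) ((f ⊛ g) n)
  Div-⊛ zero    Df Dg = Div-* (Df 0 z≤n) (Dg 0 z≤n)
  Div-⊛ (suc n) Df Dg = Div-+ (Div-* (Df 0 z≤n) (Dg (suc n) ℕP.≤-refl)) (Div-⊛ n (λ i i≤n → Df (suc i) (s≤s i≤n)) (λ i i≤n → Dg i (ℕP.m≤n⇒m≤1+n i≤n)))

  ⊛-diff : ∀ f g f′ g′ n → ((λ i → f i - f′ i) ⊛ g) n + (f′ ⊛ (λ i → g i - g′ i)) n ≡ (f ⊛ g) n - (f′ ⊛ g′) n
  ⊛-diff f g f′ g′ zero = lemma (f 0) (g 0) (f′ 0) (g′ 0)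
    where
    lemma : ∀ a b c d → (a - c) * b + c * (b - d) ≡ a * b - c * d
    lemma = solve-∀ ℚring
  ⊛-diff f g f′ g′ (suc n) = trans (lemma (f 0) (g (suc n)) (f′ 0) (g′ (suc n)) (((λ i → f (suc i) - f′ (suc i)) ⊛ g) n) (((λ i → f′ (suc i)) ⊛ (λ i → g i - g′ i)) n))
    (trans (cong (λ u → f 0 * g (suc n) - f′ 0 * g′ (suc n) + u) (⊛-diff (λ i → f (suc i)) g (λ i → f′ (suc i)) g′ n))
      (lemma′ (f 0 * g (suc n)) (f′ 0 * g′ (suc n)) (((λ i → f (suc i)) ⊛ g) n) (((λ i → f′ (suc i)) ⊛ g′) n)))
    where
    lemma : ∀ a b c d x y → ((a - c) * b + x) + (c * (b - d) + y) ≡ a * b - c * d + (x + y)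
    lemma = solve-∀ ℚring
    lemma′ : ∀ a b x y → a - b + (x - y) ≡ (a + x) - (b + y)
    lemma′ = solve-∀ ℚring

  -- Elementary symmetric functions of 1, ..., p - 1 modulo p, p² and p³

  L : List ℚ
  L = [1⋯ p ∸ 1 ]

  psum-L : ∀ k → psum k L ≡ S k
  psum-L k = psum-upTo k (λ i → ℕ→ℚ (suc i)) (p ∸ 1)

  Int-esym : ∀ k is → Int (esym k (map (λ i → ℕ→ℚ (suc i)) is))
  Int-esym zero    is       = Int-ℕ 1
  Int-esym (suc k) []       = Int-ℕ 0
  Int-esym (suc k) (i ∷ is) = Int-+ (Int-* (Int-ℕ (suc i)) (Int-esym k is)) (Int-esym (suc k) is)

  Int-A : ∀ k → Int (A p k)
  Int-A k = Int-esym k (upTo (p ∸ 1))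

  S₁ : ℕ → ℚ
  S₁ i = S (suc i)

  newton-A : ∀ k → ℕ→ℚ (suc k) * A p (suc k) ≡ (alt S₁ ⊛ A p) k
  newton-A k = trans (newton L k) (⊛-congʳ {g = A p} (λ i → cong ((- 1ℚ) ^ i *_) (psum-L (suc i))) k)

  -- Splits off the summand with `A p 0 = 1`; in the others, below the top range of indices, both
  -- factors are divisible by p.
  newton-A′ : ∀ k → ℕ→ℚ (suc (suc k)) * A p (suc (suc k)) ≡ (alt S₁ ⊛ (λ i → A p (suc i))) k + alt S₁ (suc k)
  newton-A′ k = trans (newton-A (suc k)) (trans (⊛-snoc (alt S₁) (A p) k) (cong (λ u → (alt S₁ ⊛ (λ i → A p (suc i))) k + u) (ℚP.*-identityʳ (alt S₁ (suc k)))))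

  Int-[-1]^ : ∀ n → Int ((- 1ℚ) ^ n)
  Int-[-1]^ n = Int-^ n (Int-ι (ℤ.- (+ 1)))

  Div-alt : ∀ {k} f n → Div k (f n) → Div k (alt f n)
  Div-alt f n = Div-*ˡ (Int-[-1]^ n)

  Div-A : ∀ k → suc (suc k) < p → Div 1 (A p (suc k))
  Div-A k k<p = Div-unit< k (ℕP.<-trans (ℕP.n<1+n (suc k)) k<p) (subst (Div 1) (sym (newton-A k))
    (Div-⊛ {1} {0} k (λ i i≤k → Div-alt S₁ i (Div-S i (ℕP.≤-<-trans (s≤s (s≤s i≤k)) k<p))) (λ i _ → Div-0 (Int-A i))))

  B₁ : ℕ → ℚ
  B₁ i = B (suc i)

  𝓑₁ : ℕ → ℚ
  𝓑₁ i = 𝓑 (suc i)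

  B₁≡ : ∀ i → B₁ i ≡ ℕ→ℚ (suc i) * 𝓑₁ i
  B₁≡ i = trans (sym (trans (cong (B₁ i *_) (1/-inverse (suc i))) (ℚP.*-identityʳ (B₁ i)))) (lemma (B₁ i) (+ 1 / suc i) (ℕ→ℚ (suc i)))
    where
    lemma : ∀ b i n → b * (i * n) ≡ n * (b * i)
    lemma = solve-∀ ℚring

  S₁-mod-p² : ∀ k → suc k < p → Div 2 (S₁ k - P * B₁ k)
  S₁-mod-p² k k<p = S≡PB-mod-p² k (Int-B< k k<p)

  -- In Newton's identity the products `Sᵢ Aⱼ` with `j ≥ 1` are divisible by p², so only the last
  -- power sum counts.
  A-mod-p² : ∀ k → suc (suc k) < p → Div 2 (A p (suc k) - alt (λ i → P * 𝓑₁ i) k)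
  A-mod-p² k k<p = Div-unit< k (ℕP.<-trans (ℕP.n<1+n (suc k)) k<p) (subst (Div 2) combine
    (Div-+ (newton-Div k k<p) (Div-alt (λ i → S₁ i - P * B₁ i) k (S₁-mod-p² k (ℕP.<-trans (ℕP.n<1+n (suc k)) k<p)))))
    where
    lemma₀ : ∀ n → 1ℚ * n * 1ℚ - 1ℚ * n ≡ 0ℚ
    lemma₀ = solve-∀ ℚring
    lemma₁ : ∀ x y → (x + y) - y ≡ x
    lemma₁ = solve-∀ ℚring
    newton-Div : ∀ k → suc (suc k) < p → Div 2 (ℕ→ℚ (suc k) * A p (suc k) - alt S₁ k)
    newton-Div zero    k<p = subst (Div 2) (sym (trans (cong (_- alt S₁ 0) (newton-A 0)) (lemma₀ (S₁ 0)))) (Div-0ℚ 2)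
    newton-Div (suc k) k<p = subst (Div 2) (sym (trans (cong (_- alt S₁ (suc k)) (newton-A′ k)) (lemma₁ ((alt S₁ ⊛ (λ i → A p (suc i))) k) (alt S₁ (suc k)))))
      (Div-⊛ {1} {1} k (λ i i≤k → Div-alt S₁ i (Div-S i (bound i≤k))) (λ i i≤k → Div-A i (bound i≤k)))
      where
      bound : ∀ {i} → i ≤ k → suc (suc i) < p
      bound i≤k = ℕP.<-trans (s≤s (s≤s (s≤s i≤k))) k<p
    lemma : ∀ n a s x p b → (n * a - s * x) + s * (x - p * (n * b)) ≡ n * (a - s * (p * b))
    lemma = solve-∀ ℚring
    combine : (ℕ→ℚ (suc k) * A p (suc k) - alt S₁ k) + alt (λ i → S₁ i - P * B₁ i) k ≡ ℕ→ℚ (suc k) * (A p (suc k) - alt (λ i → P * 𝓑₁ i) k)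
    combine = trans (cong (λ b → (ℕ→ℚ (suc k) * A p (suc k) - alt S₁ k) + (- 1ℚ) ^ k * (S₁ k - P * b)) (B₁≡ k))
      (lemma (ℕ→ℚ (suc k)) (A p (suc k)) ((- 1ℚ) ^ k) (S₁ k) P (𝓑₁ k))

  -- Symmetrisation: `B₁ i` is `i + 1` times `𝓑₁ i`, and averaging with the reversed convolution
  -- replaces this weight by half the total degree `n + 2`.
  B₁⊛𝓑₁ : ∀ n → (B₁ ⊛ 𝓑₁) n ≡ (+ 1 / 2) * ℕ→ℚ (suc (suc n)) * (𝓑₁ ⊛ 𝓑₁) n
  B₁⊛𝓑₁ n = begin
    (B₁ ⊛ 𝓑₁) n
      ≡⟨ ⊛-congʳ {g = 𝓑₁} (λ i → trans (B₁≡ i) (trans (cong (_* 𝓑₁ i) (ℕ→ℚ-suc i)) (lemma₁ (ℕ→ℚ i) (𝓑₁ i)))) n ⟩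
    ((λ i → 𝓑₁ i + θ i) ⊛ 𝓑₁) n
      ≡⟨ ⊛-distribʳ-+ 𝓑₁ θ 𝓑₁ n ⟩
    (𝓑₁ ⊛ 𝓑₁) n + (θ ⊛ 𝓑₁) n
      ≡⟨ lemma₂ ((𝓑₁ ⊛ 𝓑₁) n) ((θ ⊛ 𝓑₁) n) ⟩
    (+ 1 / 2) * ((+ 2 / 1) * (𝓑₁ ⊛ 𝓑₁) n + ((θ ⊛ 𝓑₁) n + (θ ⊛ 𝓑₁) n))
      ≡⟨ cong (λ u → (+ 1 / 2) * ((+ 2 / 1) * (𝓑₁ ⊛ 𝓑₁) n + u)) (trans (cong₂ _+_ (refl {x = (θ ⊛ 𝓑₁) n}) (⊛-comm θ 𝓑₁ n)) (sym (⊛-euler 𝓑₁ 𝓑₁ n))) ⟩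
    (+ 1 / 2) * ((+ 2 / 1) * (𝓑₁ ⊛ 𝓑₁) n + ℕ→ℚ n * (𝓑₁ ⊛ 𝓑₁) n)
      ≡⟨ lemma₃ ((𝓑₁ ⊛ 𝓑₁) n) (ℕ→ℚ n) ⟩
    (+ 1 / 2) * ((+ 2 / 1) + ℕ→ℚ n) * (𝓑₁ ⊛ 𝓑₁) n
      ≡⟨ cong (λ u → (+ 1 / 2) * u * (𝓑₁ ⊛ 𝓑₁) n) (ℕ→ℚ-+ 2 n) ⟨
    (+ 1 / 2) * ℕ→ℚ (suc (suc n)) * (𝓑₁ ⊛ 𝓑₁) n ∎
    where
    open ≡-Reasoning
    θ : ℕ → ℚ
    θ i = ℕ→ℚ i * 𝓑₁ i
    lemma₁ : ∀ n b → (1ℚ + n) * b ≡ b + n * b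
    lemma₁ = solve-∀ ℚring
    lemma₂ : ∀ x y → x + y ≡ (+ 1 / 2) * ((+ 2 / 1) * x + (y + y))
    lemma₂ = solve-∀ ℚring
    lemma₃ : ∀ x n → (+ 1 / 2) * ((+ 2 / 1) * x + n * x) ≡ (+ 1 / 2) * ((+ 2 / 1) + n) * x
    lemma₃ = solve-∀ ℚring

  𝓑-odd : ∀ t → 𝓑 (3 ℕ.+ 2 ℕ.* t) ≡ 0ℚ
  𝓑-odd t = trans (cong (_* (+ 1 / (3 ℕ.+ 2 ℕ.* t))) (B-odd t)) (ℚP.*-zeroˡ (+ 1 / (3 ℕ.+ 2 ℕ.* t)))

  -- The convolution over all indices from 1 has two extra end terms; each contains a `𝓑` of odd
  -- index at least 3 and vanishes.
  𝓒≡⊛ : ∀ t → (𝓑₁ ⊛ 𝓑₁) (2 ℕ.+ 2 ℕ.* t) ≡ 𝓒 (4 ℕ.+ 2 ℕ.* t)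
  𝓒≡⊛ t = begin
    𝓑₁ 0 * 𝓑₁ (2 ℕ.+ n) + (𝓑₂ ⊛ 𝓑₁) (suc n)
      ≡⟨ cong₂ (λ u v → 𝓑₁ 0 * u + v) (𝓑-odd t) (trans (⊛-snoc 𝓑₂ 𝓑₁ n) (cong (λ u → (𝓑₂ ⊛ 𝓑₂) n + u * 𝓑₁ 0) (𝓑-odd t))) ⟩
    𝓑₁ 0 * 0ℚ + ((𝓑₂ ⊛ 𝓑₂) n + 0ℚ * 𝓑₁ 0)
      ≡⟨ lemma (𝓑₁ 0) ((𝓑₂ ⊛ 𝓑₂) n) ⟩
    (𝓑₂ ⊛ 𝓑₂) n
      ≡⟨ ⊛-∑ 𝓑₂ 𝓑₂ n ⟩
    ∑ (suc n) (λ j → 𝓑₂ j * 𝓑₂ (n ∸ j))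
      ≡⟨ ∑-cong (suc n) (λ { j (s≤s j≤n) → cong (λ m → 𝓑₂ j * 𝓑 m) (sym (ℕP.+-∸-assoc 2 j≤n)) }) ⟩
    ∑ (suc n) (λ j → 𝓑 (suc (suc j)) * 𝓑 (4 ℕ.+ n ∸ suc (suc j)))
      ≡⟨ sum-map-applyUpTo (λ j → 𝓑 (suc (suc j)) * 𝓑 (4 ℕ.+ n ∸ suc (suc j))) (λ i → i) (suc n) ⟨
    𝓒 (4 ℕ.+ n) ∎
    where
    open ≡-Reasoning
    n : ℕ
    n = 2 ℕ.* t
    𝓑₂ : ℕ → ℚ
    𝓑₂ i = 𝓑 (suc (suc i))
    lemma : ∀ a x → a * 0ℚ + (x + 0ℚ * a) ≡ x
    lemma = solve-∀ ℚring

  Int-𝓑₁ : ∀ k → suc (suc k) < p → Int (𝓑₁ k)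
  Int-𝓑₁ k k<p = Int-* (Int-B< (suc k) k<p) (Int-1/< k (ℕP.<-trans (ℕP.n<1+n (suc k)) k<p))

  [-1]^-even : ∀ t → (- 1ℚ) ^ (2 ℕ.+ 2 ℕ.* t) ≡ 1ℚ
  [-1]^-even t = trans (cong (λ u → - 1ℚ * (- 1ℚ * u)) ([-1]^2* t)) refl

  -- Both factors of `Sᵢ Aⱼ` in Newton's identity are divisible by p, so each may be replaced by its
  -- value modulo p². Their main terms give `P² (m / 2) 𝓒 m`, the split-off power sum gives
  -- `− P B m`, and `m` is a unit.
  A-even-mod-p³ : ∀ t → let m = 4 ℕ.+ 2 ℕ.* t in suc m < p → Div 3 (A p m - ((+ 1 / 2) * P ^ 2 * 𝓒 m - P * 𝓑 m))
  A-even-mod-p³ t m<p = Div-unit< (suc k) (ℕP.<-trans (ℕP.n<1+n m) m<p) (subst (Div 3) (sym combine)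
    (Div-- (subst (Div 3) (⊛-diff (alt S₁) A₁ (alt (λ i → P * B₁ i)) (alt (λ i → P * 𝓑₁ i)) k) (Div-+
        (Div-⊛ {2} {1} k (λ i i≤k → subst (Div 2) (altsub i) (Div-alt (λ i → S₁ i - P * B₁ i) i (S₁-mod-p² i (ℕP.<-trans (ℕP.n<1+n (suc i)) (bound i≤k))))) (λ i i≤k → Div-A i (bound i≤k)))
        (Div-⊛ {1} {2} k (λ i i≤k → Div-alt (λ i → P * B₁ i) i (Div-*ʳ (Int-B< (suc i) (bound i≤k)) Div-P)) (λ i i≤k → A-mod-p² i (bound i≤k)))))
      (S≡PB-mod-p³ k (B-odd t) (Int-B< k (ℕP.<-trans (ℕP.n<1+n (suc k)) (bound ℕP.≤-refl))))))
    where
    open ≡-Reasoning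
    k m : ℕ
    k = 2 ℕ.+ 2 ℕ.* t
    m = suc (suc k)
    A₁ : ℕ → ℚ
    A₁ i = A p (suc i)
    bound : ∀ {i} → i ≤ k → suc (suc i) < p
    bound i≤k = ℕP.<-trans (s≤s (s≤s (s≤s i≤k))) m<p
    altsub-lemma : ∀ s x y → s * (x - y) ≡ s * x - s * y
    altsub-lemma = solve-∀ ℚring
    altsub : ∀ i → alt (λ i → S₁ i - P * B₁ i) i ≡ alt S₁ i - alt (λ i → P * B₁ i) i
    altsub i = altsub-lemma ((- 1ℚ) ^ i) (S₁ i) (P * B₁ i)
    lemma₁ : ∀ x → - 1ℚ * 1ℚ * x ≡ - x
    lemma₁ = solve-∀ ℚring
    lemma₂ : ∀ p x → 1ℚ * (p * (p * x)) ≡ p * p * x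
    lemma₂ = solve-∀ ℚring
    main-term : (alt (λ i → P * B₁ i) ⊛ alt (λ i → P * 𝓑₁ i)) k ≡ P * P * ((+ 1 / 2) * ℕ→ℚ m * 𝓒 m)
    main-term = begin
      (alt (λ i → P * B₁ i) ⊛ alt (λ i → P * 𝓑₁ i)) k
        ≡⟨ alt-⊛ (λ i → P * B₁ i) (λ i → P * 𝓑₁ i) k ⟩
      alt ((λ i → P * B₁ i) ⊛ (λ i → P * 𝓑₁ i)) k
        ≡⟨ cong₂ _*_ ([-1]^-even t) (trans (⊛-scaleˡ P B₁ (λ i → P * 𝓑₁ i) k) (cong (P *_) (⊛-scaleʳ P 𝓑₁ B₁ k))) ⟩
      1ℚ * (P * (P * (B₁ ⊛ 𝓑₁) k))
        ≡⟨ lemma₂ P ((B₁ ⊛ 𝓑₁) k) ⟩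
      P * P * (B₁ ⊛ 𝓑₁) k
        ≡⟨ cong (P * P *_) (trans (B₁⊛𝓑₁ k) (cong ((+ 1 / 2) * ℕ→ℚ m *_) (𝓒≡⊛ t))) ⟩
      P * P * ((+ 1 / 2) * ℕ→ℚ m * 𝓒 m) ∎
    lemma₃ : ∀ n c s p h 𝒞 b → n * (c - (h * (p * (p * 1ℚ)) * 𝒞 - p * b)) ≡ n * c + s - p * p * (h * n * 𝒞) - (s - p * (n * b))
    lemma₃ = solve-∀ ℚring
    lemma₄ : ∀ x s y → x + - s + s - y ≡ x - y
    lemma₄ = solve-∀ ℚring
    combine : ℕ→ℚ m * (A p m - ((+ 1 / 2) * P ^ 2 * 𝓒 m - P * 𝓑 m))
      ≡ ((alt S₁ ⊛ A₁) k - (alt (λ i → P * B₁ i) ⊛ alt (λ i → P * 𝓑₁ i)) k) - (S m - P * B m)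
    combine = begin
      ℕ→ℚ m * (A p m - ((+ 1 / 2) * P ^ 2 * 𝓒 m - P * 𝓑 m))
        ≡⟨ lemma₃ (ℕ→ℚ m) (A p m) (S m) P (+ 1 / 2) (𝓒 m) (𝓑 m) ⟩
      ℕ→ℚ m * A p m + S m - P * P * ((+ 1 / 2) * ℕ→ℚ m * 𝓒 m) - (S m - P * (ℕ→ℚ m * 𝓑 m))
        ≡⟨ cong₂ (λ u v → u + S m - P * P * ((+ 1 / 2) * ℕ→ℚ m * 𝓒 m) - (S m - P * v))
             (trans (newton-A′ k) (cong (λ u → (alt S₁ ⊛ A₁) k + u) (trans (cong (λ u → - 1ℚ * u * S m) ([-1]^-even t)) (lemma₁ (S m)))))
             (sym (B₁≡ (suc k))) ⟩
      (alt S₁ ⊛ A₁) k + - S m + S m - P * P * ((+ 1 / 2) * ℕ→ℚ m * 𝓒 m) - (S m - P * B m)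
        ≡⟨ cong (_- (S m - P * B m)) (trans (lemma₄ ((alt S₁ ⊛ A₁) k) (S m) (P * P * ((+ 1 / 2) * ℕ→ℚ m * 𝓒 m))) (cong (λ u → (alt S₁ ⊛ A₁) k - u) (sym main-term))) ⟩
      ((alt S₁ ⊛ A₁) k - (alt (λ i → P * B₁ i) ⊛ alt (λ i → P * 𝓑₁ i)) k) - (S m - P * B m) ∎

  -- The Wilson quotient

  even⊎odd : ∀ n → (∃ λ h → n ≡ 2 ℕ.* h) ⊎ (∃ λ h → n ≡ 1 ℕ.+ 2 ℕ.* h)
  even⊎odd zero    = inj₁ (0 , refl)
  even⊎odd (suc n) with even⊎odd n
  ... | inj₁ (h , e) = inj₂ (h , cong suc e)
  ... | inj₂ (h , e) = inj₁ (suc h , trans (cong suc e) (lemma h))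
    where
    lemma : ∀ h → 2 ℕ.+ 2 ℕ.* h ≡ 2 ℕ.* suc h
    lemma = ℕR.solve-∀

  -- Oddness of p, normalised so that indices such as `p ∸ 3` become sums `4 + 2 r` of visible
  -- parity.
  p≡7+2r : ∃ λ r → p ≡ 7 ℕ.+ 2 ℕ.* r
  p≡7+2r with even⊎odd p
  ... | inj₁ (h , e) = ⊥-elim (absurd (prime⇒irreducible pr (divides h (trans e (ℕP.*-comm 2 h)))))
    where
    absurd : ¬ (2 ≡ 1 ⊎ 2 ≡ p)
    absurd (inj₂ 2≡p) with subst (7 ≤_) (sym 2≡p) 7≤p
    ... | s≤s (s≤s ())
  ... | inj₂ (zero , e) with subst (7 ≤_) e 7≤p
  ...   | s≤s ()
  p≡7+2r | inj₂ (suc zero , e) with subst (7 ≤_) e 7≤p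
  ...   | s≤s (s≤s (s≤s ()))
  p≡7+2r | inj₂ (suc (suc zero) , e) with subst (7 ≤_) e 7≤p
  ...   | s≤s (s≤s (s≤s (s≤s (s≤s ()))))
  p≡7+2r | inj₂ (suc (suc (suc r)) , e) = r , trans e (lemma r)
    where
    lemma : ∀ r → 1 ℕ.+ 2 ℕ.* (3 ℕ.+ r) ≡ 7 ℕ.+ 2 ℕ.* r
    lemma = ℕR.solve-∀

  r : ℕ
  r = proj₁ p≡7+2r

  p≡ : p ≡ 7 ℕ.+ 2 ℕ.* r
  p≡ = proj₂ p≡7+2r

  p∸1≡ : p ∸ 1 ≡ 6 ℕ.+ 2 ℕ.* r
  p∸1≡ = cong (_∸ 1) p≡

  B-odd′ : ∀ t {n} → n ≡ 3 ℕ.+ 2 ℕ.* t → B n ≡ 0ℚ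
  B-odd′ t refl = B-odd t

  <p : ∀ {n} → n < 7 ℕ.+ 2 ℕ.* r → n < p
  <p {n} = subst (n <_) (sym p≡)

  [-1]^p : (- 1ℚ) ^ p ≡ - 1ℚ
  [-1]^p = trans (cong ((- 1ℚ) ^_) p≡) (trans (^-homo-* (- 1ℚ) 7 (2 ℕ.* r)) (cong ((- 1ℚ) ^ 7 *_) ([-1]^2* r)))

  z : ℚ
  z = P * w p

  z-1≡! : z - 1ℚ ≡ ℕ→ℚ ((p ∸ 1) !)
  z-1≡! = trans (cong (_- 1ℚ) (trans (ℚP.*-comm P (w p)) (trans (/-*-cancel (+ ((p ∸ 1) ! ℕ.+ 1)) p) (ℕ→ℚ-+ ((p ∸ 1) !) 1)))) (lemma (ℕ→ℚ ((p ∸ 1) !)))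
    where
    lemma : ∀ x → (x + 1ℚ) - 1ℚ ≡ x
    lemma = solve-∀ ℚring

  A⋆-reciprocal : ∀ k m → k ℕ.+ m ≡ p ∸ 1 → A⋆ p k * (z - 1ℚ) ≡ A p m
  A⋆-reciprocal k m k+m = trans (cong (A⋆ p k *_) (trans z-1≡! (sym (prod-[1⋯] (p ∸ 1)))))
    (esym-reciprocal (λ i → ℕ→ℚ (suc i)) (λ i → + 1 / suc i) (λ i → trans (ℚP.*-comm (ℕ→ℚ (suc i)) (+ 1 / suc i)) (1/-inverse (suc i)))
      (upTo (p ∸ 1)) k m (trans k+m (sym (ListP.length-upTo (p ∸ 1)))))

  A⋆≡ : ∀ k m → k ℕ.+ m ≡ p ∸ 1 → A⋆ p k ≡ - A p m + z * A⋆ p k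
  A⋆≡ k m k+m = trans (lemma (A⋆ p k) z) (cong (λ u → - u + z * A⋆ p k) (A⋆-reciprocal k m k+m))
    where
    lemma : ∀ t z → t ≡ - (t * (z - 1ℚ)) + z * t
    lemma = solve-∀ ℚring

  -- Newton's identity for the full product (p − 1)! involves only power sums divisible by p,
  -- except the last one, which is −1 modulo p.
  wilson : Div 1 z
  wilson = Div-unit (p ∸ 1) {{subst ℕ.NonZero (sym p∸1≡) _}} (p∤< (subst (0 <_) (sym p∸1≡) (s≤s z≤n)) (subst (p ∸ 1 <_) (sym p≡suc) ℕP.≤-refl)) (subst (Div 1) (sym combine)
    (Div-+ (Div-⊛ {1} {0} k (λ i i≤k → Div-alt S₁ i (Div-S i (bound i≤k))) (λ i _ → Div-0 (Int-A (suc i)))) (Div-neg S-p∸1)))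
    where
    open ≡-Reasoning
    k : ℕ
    k = 4 ℕ.+ 2 ℕ.* r
    bound : ∀ {i} → i ≤ k → suc (suc i) < p
    bound i≤k = <p (s≤s (s≤s (s≤s i≤k)))
    A-last : A p (p ∸ 1) ≡ z - 1ℚ
    A-last = trans (sym (A⋆-reciprocal 0 (p ∸ 1) refl)) (ℚP.*-identityˡ (z - 1ℚ))
    N : (P - 1ℚ) * (z - 1ℚ) ≡ (alt S₁ ⊛ (λ i → A p (suc i))) k + alt S₁ (suc k)
    N = trans (cong₂ _*_ (sym ℕ→ℚ-p∸1) (sym A-last)) (trans (cong (λ n → ℕ→ℚ n * A p n) p∸1≡) (newton-A′ k))
    sign : (- 1ℚ) ^ suc k ≡ - 1ℚ
    sign = trans (^-homo-* (- 1ℚ) 5 (2 ℕ.* r)) (cong ((- 1ℚ) ^ 5 *_) ([-1]^2* r))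
    lemma₁ : ∀ p z → (p - 1ℚ) * z ≡ (p - 1ℚ) * (z - 1ℚ) + (p - 1ℚ)
    lemma₁ = solve-∀ ℚring
    lemma₂ : ∀ x s p → x + (- 1ℚ) * s + (p - 1ℚ) ≡ x + - (s - (p - 1ℚ))
    lemma₂ = solve-∀ ℚring
    combine : ℕ→ℚ (p ∸ 1) * z ≡ (alt S₁ ⊛ (λ i → A p (suc i))) k + - (S (p ∸ 1) - (P - 1ℚ))
    combine = begin
      ℕ→ℚ (p ∸ 1) * z
        ≡⟨ cong (_* z) ℕ→ℚ-p∸1 ⟩
      (P - 1ℚ) * z
        ≡⟨ lemma₁ P z ⟩
      (P - 1ℚ) * (z - 1ℚ) + (P - 1ℚ)
        ≡⟨ cong (_+ (P - 1ℚ)) N ⟩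
      (alt S₁ ⊛ (λ i → A p (suc i))) k + (- 1ℚ) ^ suc k * S (suc (suc k)) + (P - 1ℚ)
        ≡⟨ cong₂ (λ u n → (alt S₁ ⊛ (λ i → A p (suc i))) k + u * S n + (P - 1ℚ)) sign (sym p∸1≡) ⟩
      (alt S₁ ⊛ (λ i → A p (suc i))) k + (- 1ℚ) * S (p ∸ 1) + (P - 1ℚ)
        ≡⟨ lemma₂ ((alt S₁ ⊛ (λ i → A p (suc i))) k) (S (p ∸ 1)) P ⟩
      (alt S₁ ⊛ (λ i → A p (suc i))) k + - (S (p ∸ 1) - (P - 1ℚ)) ∎

  Int-w : Int (w p)
  Int-w = Div⇒Int (Div-/P {0} wilson)

  Int-A⋆ : ∀ k → Int (A⋆ p k)
  Int-A⋆ k = go k (p ∸ 1) (λ i → i) (λ i i< → p∤suc i<)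
    where
    go : ∀ k n (f : ℕ → ℕ) → (∀ i → i < n → ¬ (p ∣ suc (f i))) → Int (esym k (map (λ i → + 1 / suc i) (List.applyUpTo f n)))
    go zero    n       f h = Int-ℕ 1
    go (suc k) zero    f h = Int-ℕ 0
    go (suc k) (suc n) f h = Int-+ (Int-* (Int-1/ (suc (f 0)) (h 0 (s≤s z≤n))) (go k n (λ i → f (suc i)) (λ i i<n → h (suc i) (s≤s i<n))))
      (go (suc k) n (λ i → f (suc i)) (λ i i<n → h (suc i) (s≤s i<n)))

  Div-A⋆ : ∀ k m → k ℕ.+ m ≡ p ∸ 1 → Div 1 (A p m) → Div 1 (A⋆ p k)
  Div-A⋆ k m k+m DA = subst (Div 1) (sym (A⋆≡ k m k+m)) (Div-+ (Div-neg DA) (Div-*ʳ (Int-A⋆ k) wilson))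

  -- Iterates `A⋆≡` three times. Once p divides `A⋆ p k`, the remainder is divisible by p⁴, so a
  -- closed form of `A p m` settles the congruence.
  A⋆-expand : ∀ k m → k ℕ.+ m ≡ p ∸ 1 → A⋆ p k ≡ - A p m * (1ℚ + z + z * z) + z * z * z * A⋆ p k
  A⋆-expand k m k+m = lemma (A p m) z (A⋆ p k) (A⋆≡ k m k+m)
    where
    lemma₁ : ∀ a z t → - a + z * (- a + z * (- a + z * t)) ≡ - a * (1ℚ + z + z * z) + z * z * z * t
    lemma₁ = solve-∀ ℚring
    lemma : ∀ a z t → t ≡ - a + z * t → t ≡ - a * (1ℚ + z + z * z) + z * z * z * t
    lemma a z t e = trans e (trans (cong (λ u → - a + z * u) (trans e (cong (λ u → - a + z * u) e))) (lemma₁ a z t))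

  -- The product of the i ^ (p − 1) = 1 + xᵢ, with p ∣ xᵢ, expanded to second order.
  !^[p-1]-expansion : ∀ n → n ≤ p ∸ 1 → let a = ∑ n (λ i → ℕ→ℚ (suc i) ^ (p ∸ 1) - 1ℚ) ; b = ∑ n (λ i → (ℕ→ℚ (suc i) ^ (p ∸ 1) - 1ℚ) * (ℕ→ℚ (suc i) ^ (p ∸ 1) - 1ℚ)) in
    Div 1 a × Div 2 b × Div 3 ((+ 2 / 1) * ℕ→ℚ (n !) ^ (p ∸ 1) - ((+ 2 / 1) + (+ 2 / 1) * a + a * a - b))
  !^[p-1]-expansion zero    _   = Div-0ℚ 1 , Div-0ℚ 2 , subst (λ u → Div 3 ((+ 2 / 1) * u - (+ 2 / 1))) (sym (1^ (p ∸ 1))) (Div-0ℚ 3)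
  !^[p-1]-expansion (suc n) n<p = let (Da , Db , DQ) = !^[p-1]-expansion n (ℕP.≤-trans (ℕP.n≤1+n n) n<p) in
      subst (Div 1) (sym (∑-snoc n X)) (Div-+ Da Dx)
    , subst (Div 2) (sym (∑-snoc n (λ i → X i * X i))) (Div-+ Db (Div-* Dx Dx))
    , subst (Div 3) (sym combine) (Div-+ (Div-*ˡ (Int-+ (Int-ℕ 1) (Div⇒Int Dx)) DQ) (Div-* Dx (Div-- (Div-* Da Da) Db)))
    where
    open ≡-Reasoning
    X : ℕ → ℚ
    X i = ℕ→ℚ (suc i) ^ (p ∸ 1) - 1ℚ
    Dx : Div 1 (X n)
    Dx = fermat-unit (suc n) (p∤suc n<p)
    a b Q : ℚ
    a = ∑ n X
    b = ∑ n (λ i → X i * X i)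
    Q = ℕ→ℚ (n !) ^ (p ∸ 1)
    Q-suc : ℕ→ℚ (suc n !) ^ (p ∸ 1) ≡ (1ℚ + X n) * Q
    Q-suc = trans (cong (_^ (p ∸ 1)) (ℕ→ℚ-* (suc n) (n !))) (trans (^-distrib-* (ℕ→ℚ (suc n)) (ℕ→ℚ (n !)) (p ∸ 1)) (cong (_* Q) (lemma₀ (ℕ→ℚ (suc n) ^ (p ∸ 1)))))
      where
      lemma₀ : ∀ x → x ≡ 1ℚ + (x - 1ℚ)
      lemma₀ = solve-∀ ℚring
    lemma : ∀ a b q x → (+ 2 / 1) * ((1ℚ + x) * q) - ((+ 2 / 1) + (+ 2 / 1) * (a + x) + (a + x) * (a + x) - (b + x * x))
      ≡ (1ℚ + x) * ((+ 2 / 1) * q - ((+ 2 / 1) + (+ 2 / 1) * a + a * a - b)) + x * (a * a - b)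
    lemma = solve-∀ ℚring
    combine : (+ 2 / 1) * ℕ→ℚ (suc n !) ^ (p ∸ 1) - ((+ 2 / 1) + (+ 2 / 1) * ∑ (suc n) X + ∑ (suc n) X * ∑ (suc n) X - ∑ (suc n) (λ i → X i * X i))
      ≡ (1ℚ + X n) * ((+ 2 / 1) * Q - ((+ 2 / 1) + (+ 2 / 1) * a + a * a - b)) + X n * (a * a - b)
    combine = begin
      (+ 2 / 1) * ℕ→ℚ (suc n !) ^ (p ∸ 1) - ((+ 2 / 1) + (+ 2 / 1) * ∑ (suc n) X + ∑ (suc n) X * ∑ (suc n) X - ∑ (suc n) (λ i → X i * X i))
        ≡⟨ cong (λ u → (+ 2 / 1) * u - ((+ 2 / 1) + (+ 2 / 1) * ∑ (suc n) X + ∑ (suc n) X * ∑ (suc n) X - ∑ (suc n) (λ i → X i * X i))) Q-suc ⟩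
      (+ 2 / 1) * ((1ℚ + X n) * Q) - ((+ 2 / 1) + (+ 2 / 1) * ∑ (suc n) X + ∑ (suc n) X * ∑ (suc n) X - ∑ (suc n) (λ i → X i * X i))
        ≡⟨ cong₂ (λ u v → (+ 2 / 1) * ((1ℚ + X n) * Q) - ((+ 2 / 1) + (+ 2 / 1) * u + u * u - v)) (∑-snoc n X) (∑-snoc n (λ i → X i * X i)) ⟩
      (+ 2 / 1) * ((1ℚ + X n) * Q) - ((+ 2 / 1) + (+ 2 / 1) * (a + X n) + (a + X n) * (a + X n) - (b + X n * X n))
        ≡⟨ lemma a b Q (X n) ⟩
      (1ℚ + X n) * ((+ 2 / 1) * Q - ((+ 2 / 1) + (+ 2 / 1) * a + a * a - b)) + X n * (a * a - b) ∎

  -- The binomial expansion to second order, doubled to keep it free of fractions; each induction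
  -- step adds the error `n (n − 1) y³`.
  [1+y]^n-expansion : ∀ {y} → Div 1 y → ∀ n → Div 3 ((+ 2 / 1) * (1ℚ + y) ^ n - ((+ 2 / 1) + (+ 2 / 1) * ℕ→ℚ n * y + ℕ→ℚ n * (ℕ→ℚ n - 1ℚ) * (y * y)))
  [1+y]^n-expansion {y} Dy zero    = subst (Div 3) (sym (lemma y)) (Div-0ℚ 3)
    where
    lemma : ∀ y → (+ 2 / 1) * 1ℚ - ((+ 2 / 1) + (+ 2 / 1) * 0ℚ * y + 0ℚ * (0ℚ - 1ℚ) * (y * y)) ≡ 0ℚ
    lemma = solve-∀ ℚring
  [1+y]^n-expansion {y} Dy (suc n) = subst (Div 3) (trans (sym (lemma y (ℕ→ℚ n) ((1ℚ + y) ^ n))) (cong (λ u → (+ 2 / 1) * ((1ℚ + y) * (1ℚ + y) ^ n) - ((+ 2 / 1) + (+ 2 / 1) * u * y + u * (u - 1ℚ) * (y * y))) (sym (ℕ→ℚ-suc n))))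
    (Div-+ (Div-*ˡ (Int-+ (Int-ℕ 1) (Div⇒Int Dy)) ([1+y]^n-expansion Dy n)) (Div-*ˡ (Int-* (Int-ℕ n) (Int-- (Int-ℕ n) (Int-ℕ 1))) (Div-* Dy (Div-* Dy Dy))))
    where
    lemma : ∀ y n q → (+ 2 / 1) * ((1ℚ + y) * q) - ((+ 2 / 1) + (+ 2 / 1) * (1ℚ + n) * y + (1ℚ + n) * ((1ℚ + n) - 1ℚ) * (y * y))
      ≡ (1ℚ + y) * ((+ 2 / 1) * q - ((+ 2 / 1) + (+ 2 / 1) * n * y + n * (n - 1ℚ) * (y * y))) + n * (n - 1ℚ) * (y * (y * y))
    lemma = solve-∀ ℚring

  -- The sums of `xᵢ` and of `xᵢ²` for `xᵢ = i ^ (p − 1) − 1`, written through power sums so that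
  -- Bernoulli numbers can replace them.
  a b : ℚ
  a = S (p ∸ 1) - (P - 1ℚ)
  b = S ((p ∸ 1) ℕ.+ (p ∸ 1)) - (+ 2 / 1) * S (p ∸ 1) + (P - 1ℚ)

  ∑-p∸1 : ∑ (p ∸ 1) (λ _ → 1ℚ) ≡ P - 1ℚ
  ∑-p∸1 = trans (∑-const (p ∸ 1)) ℕ→ℚ-p∸1

  a≡ : ∑ (p ∸ 1) (λ i → ℕ→ℚ (suc i) ^ (p ∸ 1) - 1ℚ) ≡ a
  a≡ = trans (∑-cong (p ∸ 1) (λ i _ → lemma₁ (ℕ→ℚ (suc i) ^ (p ∸ 1)))) (trans (∑-+ (p ∸ 1) (λ i → ℕ→ℚ (suc i) ^ (p ∸ 1)) (λ _ → - 1ℚ * 1ℚ))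
    (trans (cong (λ u → S (p ∸ 1) + u) (trans (∑-*ˡ (p ∸ 1) (- 1ℚ) (λ _ → 1ℚ)) (cong (- 1ℚ *_) ∑-p∸1))) (lemma₂ (S (p ∸ 1)) (P - 1ℚ))))
    where
    lemma₁ : ∀ x → x - 1ℚ ≡ x + - 1ℚ * 1ℚ
    lemma₁ = solve-∀ ℚring
    lemma₂ : ∀ x y → x + - 1ℚ * y ≡ x - y
    lemma₂ = solve-∀ ℚring

  b≡ : ∑ (p ∸ 1) (λ i → (ℕ→ℚ (suc i) ^ (p ∸ 1) - 1ℚ) * (ℕ→ℚ (suc i) ^ (p ∸ 1) - 1ℚ)) ≡ b
  b≡ = begin
    ∑ (p ∸ 1) (λ i → (y i - 1ℚ) * (y i - 1ℚ))
      ≡⟨ ∑-cong (p ∸ 1) (λ i _ → trans (lemma₁ (y i)) (cong (λ u → u + - (+ 2 / 1) * y i + 1ℚ) (sym (^-homo-* (ℕ→ℚ (suc i)) (p ∸ 1) (p ∸ 1))))) ⟩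
    ∑ (p ∸ 1) (λ i → ℕ→ℚ (suc i) ^ ((p ∸ 1) ℕ.+ (p ∸ 1)) + - (+ 2 / 1) * y i + 1ℚ)
      ≡⟨ ∑-+ (p ∸ 1) (λ i → ℕ→ℚ (suc i) ^ ((p ∸ 1) ℕ.+ (p ∸ 1)) + - (+ 2 / 1) * y i) (λ _ → 1ℚ) ⟩
    ∑ (p ∸ 1) (λ i → ℕ→ℚ (suc i) ^ ((p ∸ 1) ℕ.+ (p ∸ 1)) + - (+ 2 / 1) * y i) + ∑ (p ∸ 1) (λ _ → 1ℚ)
      ≡⟨ cong₂ _+_ (trans (∑-+ (p ∸ 1) (λ i → ℕ→ℚ (suc i) ^ ((p ∸ 1) ℕ.+ (p ∸ 1))) (λ i → - (+ 2 / 1) * y i)) (cong (λ u → S ((p ∸ 1) ℕ.+ (p ∸ 1)) + u) (∑-*ˡ (p ∸ 1) (- (+ 2 / 1)) y))) ∑-p∸1 ⟩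
    S ((p ∸ 1) ℕ.+ (p ∸ 1)) + - (+ 2 / 1) * S (p ∸ 1) + (P - 1ℚ)
      ≡⟨ lemma₂ (S ((p ∸ 1) ℕ.+ (p ∸ 1))) (S (p ∸ 1)) (P - 1ℚ) ⟩
    b ∎
    where
    open ≡-Reasoning
    y : ℕ → ℚ
    y i = ℕ→ℚ (suc i) ^ (p ∸ 1)
    lemma₁ : ∀ y → (y - 1ℚ) * (y - 1ℚ) ≡ y * y + - (+ 2 / 1) * y + 1ℚ
    lemma₁ = solve-∀ ℚring
    lemma₂ : ∀ x y z → x + - (+ 2 / 1) * y + z ≡ x - (+ 2 / 1) * y + z
    lemma₂ = solve-∀ ℚring

  ab-expansion : Div 1 a × Div 2 b × Div 3 ((+ 2 / 1) * (z - 1ℚ) ^ (p ∸ 1) - ((+ 2 / 1) + (+ 2 / 1) * a + a * a - b))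
  ab-expansion = let (Da , Db , DQ) = !^[p-1]-expansion (p ∸ 1) ℕP.≤-refl in
      subst (Div 1) a≡ Da , subst (Div 2) b≡ Db
    , subst (Div 3) (trans (cong₂ (λ u v → (+ 2 / 1) * ℕ→ℚ ((p ∸ 1) !) ^ (p ∸ 1) - ((+ 2 / 1) + (+ 2 / 1) * u + u * u - v)) a≡ b≡)
        (cong (λ u → (+ 2 / 1) * u ^ (p ∸ 1) - ((+ 2 / 1) + (+ 2 / 1) * a + a * a - b)) (sym z-1≡!))) DQ

  Div-a : Div 1 a
  Div-a = proj₁ ab-expansion

  Div-b : Div 2 b
  Div-b = proj₁ (proj₂ ab-expansion)

  -- As p is odd, the power is `− (1 − z) ^ p`; the quadratic term of its expansion carries `p z²`
  -- and disappears modulo p³.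
  [z-1]^p : Div 3 ((+ 2 / 1) * ((z - 1ℚ) * (z - 1ℚ) ^ (p ∸ 1)) - ((+ 2 / 1) * P * z - (+ 2 / 1)))
  [z-1]^p = subst (Div 3) (sym combine) (Div-- (Div-neg ([1+y]^n-expansion (Div-neg wilson) p)) (Div-*ʳ (Int-- (Int-ℕ p) (Int-ℕ 1)) (Div-* Div-P (Div-* wilson wilson))))
    where
    open ≡-Reasoning
    lemma₁ : ∀ z → z - 1ℚ ≡ - 1ℚ * (1ℚ + - z)
    lemma₁ = solve-∀ ℚring
    lemma₂ : ∀ p z q → (+ 2 / 1) * (- 1ℚ * q) - ((+ 2 / 1) * p * z - (+ 2 / 1))
      ≡ - ((+ 2 / 1) * q - ((+ 2 / 1) + (+ 2 / 1) * p * (- z) + p * (p - 1ℚ) * ((- z) * (- z)))) - p * (z * z) * (p - 1ℚ)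
    lemma₂ = solve-∀ ℚring
    combine : (+ 2 / 1) * ((z - 1ℚ) * (z - 1ℚ) ^ (p ∸ 1)) - ((+ 2 / 1) * P * z - (+ 2 / 1))
      ≡ - ((+ 2 / 1) * (1ℚ + - z) ^ p - ((+ 2 / 1) + (+ 2 / 1) * P * (- z) + P * (P - 1ℚ) * ((- z) * (- z)))) - P * (z * z) * (P - 1ℚ)
    combine = begin
      (+ 2 / 1) * ((z - 1ℚ) ^ suc (p ∸ 1)) - ((+ 2 / 1) * P * z - (+ 2 / 1))
        ≡⟨ cong₂ (λ n u → (+ 2 / 1) * u ^ n - ((+ 2 / 1) * P * z - (+ 2 / 1))) (sym p≡suc) (lemma₁ z) ⟩
      (+ 2 / 1) * ((- 1ℚ * (1ℚ + - z)) ^ p) - ((+ 2 / 1) * P * z - (+ 2 / 1))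
        ≡⟨ cong (λ u → (+ 2 / 1) * u - ((+ 2 / 1) * P * z - (+ 2 / 1))) (trans (^-distrib-* (- 1ℚ) (1ℚ + - z) p) (cong (_* (1ℚ + - z) ^ p) [-1]^p)) ⟩
      (+ 2 / 1) * (- 1ℚ * (1ℚ + - z) ^ p) - ((+ 2 / 1) * P * z - (+ 2 / 1))
        ≡⟨ lemma₂ P z ((1ℚ + - z) ^ p) ⟩
      - ((+ 2 / 1) * (1ℚ + - z) ^ p - ((+ 2 / 1) + (+ 2 / 1) * P * (- z) + P * (P - 1ℚ) * ((- z) * (- z)))) - P * (z * z) * (P - 1ℚ) ∎

  -- Compares the two expansions of 2 (z − 1) ^ p.
  z-a-b : Div 3 ((z - 1ℚ) * ((+ 2 / 1) + (+ 2 / 1) * a + a * a - b) + (+ 2 / 1) - (+ 2 / 1) * P * z)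
  z-a-b = subst (Div 3) (lemma z P ((z - 1ℚ) ^ (p ∸ 1)) ((+ 2 / 1) + (+ 2 / 1) * a + a * a - b))
    (Div-- [z-1]^p (Div-*ˡ (Int-- (Div⇒Int wilson) (Int-ℕ 1)) (proj₂ (proj₂ ab-expansion))))
    where
    lemma : ∀ z p q e → ((+ 2 / 1) * ((z - 1ℚ) * q) - ((+ 2 / 1) * p * z - (+ 2 / 1))) - (z - 1ℚ) * ((+ 2 / 1) * q - e)
      ≡ (z - 1ℚ) * e + (+ 2 / 1) - (+ 2 / 1) * p * z
    lemma = solve-∀ ℚring

  2<p : 2 < p
  2<p = ℕP.≤-trans (s≤s (s≤s (s≤s z≤n))) 7≤p

  -- Lerch's congruence: modulo p, the Wilson quotient is the sum of the Fermat quotients. Modulo p²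
  -- the expression in `z-a-b` reduces to `2 (z − a)`.
  z≡a : Div 2 (z - a)
  z≡a = Div-unit< 1 2<p (subst (Div 2) (lemma z a b P)
    (Div-+ (Div-- (Div-≤ (s≤s (s≤s z≤n)) z-a-b)
       (Div-+ (Div-*ˡ (Int-- (Div⇒Int wilson) (Int-ℕ 1)) (Div-- (Div-* Div-a Div-a) Div-b)) (Div-*ˡ (Int-ℕ 2) (Div-* wilson Div-a))))
       (Div-*ˡ (Int-ℕ 2) (Div-* Div-P wilson))))
    where
    lemma : ∀ z a b p → ((z - 1ℚ) * ((+ 2 / 1) + (+ 2 / 1) * a + a * a - b) + (+ 2 / 1) - (+ 2 / 1) * p * z)
      - ((z - 1ℚ) * (a * a - b) + (+ 2 / 1) * (z * a)) + (+ 2 / 1) * (p * z) ≡ (+ 2 / 1) * (z - a)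
    lemma = solve-∀ ℚring

  S-p∸1-mod-p³ : Div 3 (S (p ∸ 1) - P * B (p ∸ 1))
  S-p∸1-mod-p³ = subst (λ N → Div 3 (S N - P * B N)) (sym p∸1≡)
    (S≡PB-mod-p³ (4 ℕ.+ 2 ℕ.* r) (B-odd′ (1 ℕ.+ r) (lemma r)) (Int-B< (4 ℕ.+ 2 ℕ.* r) (<p (s≤s (ℕP.n≤1+n _)))))
    where
    lemma : ∀ r → suc (4 ℕ.+ 2 ℕ.* r) ≡ 3 ℕ.+ 2 ℕ.* (1 ℕ.+ r)
    lemma = ℕR.solve-∀

  Div-S-periodic : ∀ n → suc (suc n) < p → Div 1 (S (suc n ℕ.+ (p ∸ 1)))
  Div-S-periodic n n<p = subst (Div 1) (lemma (S (suc n ℕ.+ (p ∸ 1))) (S (suc n))) (Div-+ (S-periodic (suc n)) (Div-S n n<p))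
    where
    lemma : ∀ x y → (x - y) + y ≡ x
    lemma = solve-∀ ℚring

  -- The Bernoulli number of index 2p - 4 is integral because S at 2p - 4 is congruent modulo p to S
  -- at p - 3, which is 0.
  S-2[p∸1]-mod-p³ : Div 3 (S ((p ∸ 1) ℕ.+ (p ∸ 1)) - P * B ((p ∸ 1) ℕ.+ (p ∸ 1)))
  S-2[p∸1]-mod-p³ = subst (λ N → Div 3 (S N - P * B N)) (cong (ℕ._+ (p ∸ 1)) (sym p∸1≡))
    (S≡PB-mod-p³ (4 ℕ.+ 2 ℕ.* r ℕ.+ (p ∸ 1)) (B-odd′ (4 ℕ.+ 2 ℕ.* r) (trans (cong (λ n → suc (4 ℕ.+ 2 ℕ.* r ℕ.+ n)) p∸1≡) (lemma r)))
      (Int-B (3 ℕ.+ 2 ℕ.* r ℕ.+ (p ∸ 1)) (Div-S-periodic (3 ℕ.+ 2 ℕ.* r) (<p (s≤s (ℕP.n≤1+n _))))))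
    where
    lemma : ∀ r → suc (4 ℕ.+ 2 ℕ.* r ℕ.+ (6 ℕ.+ 2 ℕ.* r)) ≡ 3 ℕ.+ 2 ℕ.* (4 ℕ.+ 2 ℕ.* r)
    lemma = ℕR.solve-∀

  P*AG : P * AG p ≡ P * B (p ∸ 1) + 1ℚ
  P*AG = trans (lemma P (P * B (p ∸ 1) + 1ℚ) (+ 1 / p)) (trans (cong ((P * B (p ∸ 1) + 1ℚ) *_) (1/-inverse p)) (ℚP.*-identityʳ (P * B (p ∸ 1) + 1ℚ)))
    where
    lemma : ∀ p x i → p * (x * i) ≡ x * (i * p)
    lemma = solve-∀ ℚring

  -- Modulo p², `P * AG p` is `S (p ∸ 1) + 1 = a + P`, and `z≡a` replaces `a` by `z`.
  AG≡w+1 : Div 1 (AG p - (w p + 1ℚ))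
  AG≡w+1 = Div-/P (subst (Div 2) (sym combine) (Div-- (Div-neg z≡a) (Div-≤ (s≤s (s≤s z≤n)) S-p∸1-mod-p³)))
    where
    lemma₁ : ∀ p g w → p * (g - (w + 1ℚ)) ≡ p * g - p * w - p
    lemma₁ = solve-∀ ℚring
    lemma₂ : ∀ p x z s → (x + 1ℚ) - z - p ≡ - (z - (s - (p - 1ℚ))) - (s - x)
    lemma₂ = solve-∀ ℚring
    combine : P * (AG p - (w p + 1ℚ)) ≡ - (z - a) - (S (p ∸ 1) - P * B (p ∸ 1))
    combine = trans (lemma₁ P (AG p) (w p)) (trans (cong (λ u → u - z - P) P*AG) (lemma₂ P (P * B (p ∸ 1)) z (S (p ∸ 1))))

  -- The congruences modulo p⁴, except the one for `A⋆ p 2`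

  infix 4 _≈_
  record _≈_ (x y : ℚ) : Set where
    constructor mod-p⁴
    field
      p⁴∣difference : Div 4 (x - y)

  ≈⇒mod : ∀ {x y} → x ≈ y → x ≡ y [mod p ^ 4 ]
  ≈⇒mod {x} {y} (mod-p⁴ d) = Div⇒mod {4} {x} {y} d

  private
    P²≡ : ℕ→ℚ (p ℕ.^ 2) ≡ P ^ 2
    P²≡ = ℕ→ℚ-^ p 2

    P³≡ : ℕ→ℚ (p ℕ.^ 3) ≡ P ^ 3
    P³≡ = ℕ→ℚ-^ p 3

  p∤≤6 : ∀ n → suc n ≤ 6 → ¬ (p ∣ suc n)
  p∤≤6 n n≤6 = p∤< (s≤s z≤n) (ℕP.≤-trans (s≤s n≤6) 7≤p)

  Int-𝓒 : ∀ t → suc (4 ℕ.+ 2 ℕ.* t) < p → Int (𝓒 (4 ℕ.+ 2 ℕ.* t))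
  Int-𝓒 t t<p = subst Int (𝓒≡⊛ t) (Int-⊛ (2 ℕ.+ 2 ℕ.* t) (λ i i≤ → Int-𝓑₁ i (bound i≤)) (λ i i≤ → Int-𝓑₁ i (bound i≤)))
    where
    bound : ∀ {i} → i ≤ 2 ℕ.+ 2 ℕ.* t → suc (suc i) < p
    bound i≤ = ℕP.<-trans (s≤s (s≤s (s≤s i≤))) t<p

  -- With A_m = ½ P² C − P 𝓑 + d and T = −A_m + z T, the difference is z (z² T − (1 + z) d − ½ P² z C).
  A⋆-even-Div : ∀ k t → k ℕ.+ (4 ℕ.+ 2 ℕ.* t) ≡ p ∸ 1 → suc (4 ℕ.+ 2 ℕ.* t) < p →
    let m = 4 ℕ.+ 2 ℕ.* t in
    Div 4 (A⋆ p k - (- A p m + P ^ 2 * w p * (1ℚ + P * w p) * 𝓑 m - P ^ 3 * w p * (+ 1 / 2) * 𝓒 m))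
  A⋆-even-Div k t k+m m<p = subst (Div 4) (sym combine)
    (Div-* wilson (Div-- (Div-- (Div-* (Div-* wilson wilson) (Div-A⋆ k m k+m (Div-A (3 ℕ.+ 2 ℕ.* t) m<p)))
      (Div-*ˡ (Int-+ (Int-ℕ 1) (Div⇒Int wilson)) (A-even-mod-p³ t m<p)))
      (Div-* (Div-*ˡ (Int-1/< 1 2<p) (Div-* Div-P Div-P)) (Div-*ʳ (Int-𝓒 t m<p) wilson))))
    where
    open ≡-Reasoning
    m : ℕ
    m = 4 ℕ.+ 2 ℕ.* t
    T d : ℚ
    T = A⋆ p k
    d = A p m - ((+ 1 / 2) * P ^ 2 * 𝓒 m - P * 𝓑 m)
    T≡ : T ≡ - A p m + z * (- A p m + z * T)
    T≡ = trans (A⋆≡ k m k+m) (cong (λ u → - A p m + z * u) (A⋆≡ k m k+m))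
    lemma : ∀ a p w b c t → let z = p * w ; h = + 1 / 2 ; d = a - (h * (p * (p * 1ℚ)) * c - p * b) in
      (- a + z * (- a + z * t)) - (- a + p * (p * 1ℚ) * w * (1ℚ + p * w) * b - p * (p * (p * 1ℚ)) * w * h * c)
      ≡ z * (z * z * t - (1ℚ + z) * d - h * (p * p) * (z * c) + (t - (- a + z * t)) * z)
    lemma = solve-∀ ℚring
    lemma′ : ∀ z x y → z * (x + (y - y) * z) ≡ z * x
    lemma′ = solve-∀ ℚring
    combine : T - (- A p m + P ^ 2 * w p * (1ℚ + P * w p) * 𝓑 m - P ^ 3 * w p * (+ 1 / 2) * 𝓒 m)
      ≡ z * (z * z * T - (1ℚ + z) * d - (+ 1 / 2) * (P * P) * (z * 𝓒 m))
    combine = begin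
      T - (- A p m + P ^ 2 * w p * (1ℚ + P * w p) * 𝓑 m - P ^ 3 * w p * (+ 1 / 2) * 𝓒 m)
        ≡⟨ cong (_- (- A p m + P ^ 2 * w p * (1ℚ + P * w p) * 𝓑 m - P ^ 3 * w p * (+ 1 / 2) * 𝓒 m)) T≡ ⟩
      (- A p m + z * (- A p m + z * T)) - (- A p m + P ^ 2 * w p * (1ℚ + P * w p) * 𝓑 m - P ^ 3 * w p * (+ 1 / 2) * 𝓒 m)
        ≡⟨ lemma (A p m) P (w p) (𝓑 m) (𝓒 m) T ⟩
      z * (z * z * T - (1ℚ + z) * d - (+ 1 / 2) * (P * P) * (z * 𝓒 m) + (T - (- A p m + z * T)) * z)
        ≡⟨ cong (λ u → z * (z * z * T - (1ℚ + z) * d - (+ 1 / 2) * (P * P) * (z * 𝓒 m) + (T - u) * z)) (A⋆≡ k m k+m) ⟨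
      z * (z * z * T - (1ℚ + z) * d - (+ 1 / 2) * (P * P) * (z * 𝓒 m) + (T - T) * z)
        ≡⟨ lemma′ z (z * z * T - (1ℚ + z) * d - (+ 1 / 2) * (P * P) * (z * 𝓒 m)) T ⟩
      z * (z * z * T - (1ℚ + z) * d - (+ 1 / 2) * (P * P) * (z * 𝓒 m)) ∎

  A⋆-even-mod-p⁴ : (n : ℕ) → 4 ≤ 2 ℕ.* n → 2 ℕ.* n ≤ p ∸ 7 →
    A⋆ p (2 ℕ.* n) ≈
      - A p (p ∸ 1 ∸ 2 ℕ.* n)
      + ℕ→ℚ (p ℕ.^ 2) * w p * (1ℚ + ℕ→ℚ p * w p) * 𝓑 (p ∸ 1 ∸ 2 ℕ.* n)
      - ℕ→ℚ (p ℕ.^ 3) * w p * (+ 1 / 2) * 𝓒 (p ∸ 1 ∸ 2 ℕ.* n)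
  A⋆-even-mod-p⁴ n 4≤2n 2n≤p∸7 = mod-p⁴ (subst (λ m → Div 4 (A⋆ p (2 ℕ.* n) - (- A p m + ℕ→ℚ (p ℕ.^ 2) * w p * (1ℚ + P * w p) * 𝓑 m - ℕ→ℚ (p ℕ.^ 3) * w p * (+ 1 / 2) * 𝓒 m))) (sym m≡)
    (subst₂ (λ u v → Div 4 (A⋆ p (2 ℕ.* n) - (- A p m + u * w p * (1ℚ + P * w p) * 𝓑 m - v * w p * (+ 1 / 2) * 𝓒 m))) (sym P²≡) (sym P³≡)
      (A⋆-even-Div (2 ℕ.* n) t k+m m<p)))
    where
    n≤r : n ≤ r
    n≤r = ℕP.*-cancelˡ-≤ 2 (subst (2 ℕ.* n ≤_) (cong (_∸ 7) p≡) 2n≤p∸7)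
    -- `m` is `p − 1 − 2n`; the bound on `n` makes it at least 6, hence `4 + 2 t`.
    t m : ℕ
    t = suc (r ∸ n)
    m = 4 ℕ.+ 2 ℕ.* t
    k+m : 2 ℕ.* n ℕ.+ m ≡ p ∸ 1
    k+m = trans (lemma n (r ∸ n)) (trans (cong (λ s → 6 ℕ.+ 2 ℕ.* s) (ℕP.m+[n∸m]≡n n≤r)) (sym p∸1≡))
      where
      lemma : ∀ n s → 2 ℕ.* n ℕ.+ (4 ℕ.+ 2 ℕ.* suc s) ≡ 6 ℕ.+ 2 ℕ.* (n ℕ.+ s)
      lemma = ℕR.solve-∀
    m≡ : p ∸ 1 ∸ 2 ℕ.* n ≡ m
    m≡ = trans (cong (_∸ 2 ℕ.* n) (sym k+m)) (ℕP.m+n∸m≡n (2 ℕ.* n) m)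
    m<p : suc m < p
    m<p = ℕP.≤-trans (s≤s (ℕP.+-monoˡ-≤ m {1} {2 ℕ.* n} (ℕP.≤-trans (s≤s z≤n) 4≤2n))) (ℕP.≤-reflexive (trans (cong suc k+m) (sym p≡suc)))

  A⋆[p∸5]-mod-p⁴ :
    A⋆ p (p ∸ 5) ≈
      (+ 1 / 8) * (ℕ→ℚ (5 ℕ.* p ℕ.^ 3) * (+ 1 / 4) - ℕ→ℚ p * (+ 1 / 15) - ℕ→ℚ (p ℕ.^ 2) * (+ 1 / 36))
      + ℕ→ℚ p * w p * (+ 1 / 120)
        * (ℕ→ℚ (7 ℕ.* p ℕ.^ 2) * (+ 1 / 12) - ℕ→ℚ p * (1ℚ + ℕ→ℚ p * AG p))
  A⋆[p∸5]-mod-p⁴ = mod-p⁴ (go (trans (ℕ→ℚ-* 5 (p ℕ.^ 3)) (cong (ℕ→ℚ 5 *_) P³≡)) P²≡ (trans (ℕ→ℚ-* 7 (p ℕ.^ 2)) (cong (ℕ→ℚ 7 *_) P²≡)))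
    where
    k+4 : p ∸ 5 ℕ.+ 4 ≡ p ∸ 1
    k+4 = trans (cong (λ n → n ∸ 5 ℕ.+ 4) p≡) (trans (ℕP.+-comm (2 ℕ.+ 2 ℕ.* r) 4) (sym p∸1≡))
    T : ℚ
    T = A⋆ p (p ∸ 5)
    -- Comes from `5760 e₄(1, …, p − 1) = 48 p + 20 p² − 900 p³ + p⁴ q(p)`: the first three
    -- coefficients give the fractions of the statement, the rest is divisible by p⁴.
    q : ℚ → ℚ
    q x = (+ 2015 / 1) - (+ 1848 / 1) * x + (+ 830 / 1) * (x * x) - (+ 180 / 1) * (x * x * x) + (+ 15 / 1) * (x * x * x * x)
    Int-q : Int (q P)
    Int-q = Int-+ (Int-- (Int-+ (Int-- (Int-ℕ 2015) (Int-* (Int-ℕ 1848) IP)) (Int-* (Int-ℕ 830) (Int-* IP IP))) (Int-* (Int-ℕ 180) (Int-* (Int-* IP IP) IP)))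
        (Int-* (Int-ℕ 15) (Int-* (Int-* (Int-* IP IP) IP) IP))
      where
      IP : Int P
      IP = Int-ℕ p
    p∤5760 : ¬ (p ∣ 5760)
    p∤5760 = p∤* {5} {1152} (p∤≤6 4 (ℕP.m≤m+n 5 1)) (p∤* {6} {192} (p∤≤6 5 ℕP.≤-refl) (p∤* {6} {32} (p∤≤6 5 ℕP.≤-refl)
      (p∤* {4} {8} (p∤≤6 3 (ℕP.m≤m+n 4 2)) (p∤* {4} {2} (p∤≤6 3 (ℕP.m≤m+n 4 2)) (p∤≤6 1 (ℕP.m≤m+n 2 4))))))
    -- `w` in the term `z p² w` is traded for `g − 1` at the cost of `z p² ε`; this turns the
    -- coefficient -5/12 of p² into 7/12.
    lemma : ∀ p w t g →
      let z = p * w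
          x = p - 1ℚ
          c = + 1 / 5760
          ε = g - (w + 1ℚ)
          A₄ = c * ((x - (+ 3 / 1)) * (x - (+ 2 / 1)) * (x - 1ℚ) * x * (x + 1ℚ) * ((+ 15 / 1) * x * x * x + (+ 15 / 1) * x * x - (+ 10 / 1) * x - (+ 8 / 1)))
          Q = (+ 2015 / 1) - (+ 1848 / 1) * p + (+ 830 / 1) * (p * p) - (+ 180 / 1) * (p * p * p) + (+ 15 / 1) * (p * p * p * p)
      in
      (- A₄ * (1ℚ + z + z * z) + z * z * z * t)
        - ((+ 1 / 8) * ((+ 5 / 1) * (p * (p * (p * 1ℚ))) * (+ 1 / 4) - p * (+ 1 / 15) - p * (p * 1ℚ) * (+ 1 / 36))
           + p * w * (+ 1 / 120) * ((+ 7 / 1) * (p * (p * 1ℚ)) * (+ 1 / 12) - p * (1ℚ + p * g)))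
      ≡ p * (p * (p * (p * 1ℚ))) * (c * (w * ((+ 900 / 1) - p * Q) - Q - w * w * ((+ 20 / 1) - (+ 900 / 1) * p + p * p * Q)))
        + (+ 1 / 120) * (z * (p * p) * ε) + z * z * z * t
    lemma = solve-∀ ℚring
    T≡ : T ≡ - esym₄ (P - 1ℚ) * (1ℚ + z + z * z) + z * z * z * T
    T≡ = trans (A⋆-expand (p ∸ 5) 4 k+4) (cong (λ u → - u * (1ℚ + z + z * z) + z * z * z * T) (trans (esym₄-correct (p ∸ 1)) (cong esym₄ ℕ→ℚ-p∸1)))
    5<p : 5 < p
    5<p = ℕP.≤-trans (ℕP.m≤m+n 6 1) 7≤p
    go : ∀ {u v v′} → u ≡ ℕ→ℚ 5 * P ^ 3 → v ≡ P ^ 2 → v′ ≡ ℕ→ℚ 7 * P ^ 2 →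
      Div 4 (T - ((+ 1 / 8) * (u * (+ 1 / 4) - P * (+ 1 / 15) - v * (+ 1 / 36)) + P * w p * (+ 1 / 120) * (v′ * (+ 1 / 12) - P * (1ℚ + P * AG p))))
    go refl refl refl = subst (Div 4) (sym (trans (cong (_- ((+ 1 / 8) * (ℕ→ℚ 5 * P ^ 3 * (+ 1 / 4) - P * (+ 1 / 15) - P ^ 2 * (+ 1 / 36)) + P * w p * (+ 1 / 120) * (ℕ→ℚ 7 * P ^ 2 * (+ 1 / 12) - P * (1ℚ + P * AG p)))) T≡) (lemma P (w p) T (AG p))))
      (Div-+ (Div-+
        (Div-*ʳ (Int-* (Int-1/ 5760 p∤5760) (Int-- (Int-- (Int-* Int-w (Int-- (Int-ℕ 900) (Int-* (Int-ℕ p) Int-q))) Int-q) (Int-* (Int-* Int-w Int-w)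
            (Int-+ (Int-- (Int-ℕ 20) (Int-* (Int-ℕ 900) (Int-ℕ p))) (Int-* (Int-* (Int-ℕ p) (Int-ℕ p)) Int-q)))))
          (Div-P^ 4))
        (Div-*ˡ (Int-1/ 120 (p∤* {5} {24} (p∤≤6 4 (ℕP.m≤m+n 5 1)) (p∤* {4} {6} (p∤≤6 3 (ℕP.m≤m+n 4 2)) (p∤≤6 5 ℕP.≤-refl)))) (Div-* (Div-* wilson (Div-* Div-P Div-P)) AG≡w+1)))
        (Div-* (Div-* (Div-* wilson wilson) wilson) (Div-A⋆ (p ∸ 5) 4 k+4 (Div-A 3 5<p))))

  A⋆[p∸3]-mod-p⁴ : A⋆ p (p ∸ 3) ≈
      (+ 1 / 24) * (ℕ→ℚ (p ℕ.* (2 ℕ.* p ∸ 1) ℕ.* (5 ℕ.* p ∸ 2))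
        + ℕ→ℚ p * w p * (ℕ→ℚ (2 ℕ.* p) - ℕ→ℚ (11 ℕ.* p ℕ.^ 2) + ℕ→ℚ (2 ℕ.* p ℕ.^ 2) * AG p))
  A⋆[p∸3]-mod-p⁴ = mod-p⁴ (go
      -- The truncated subtractions are exact since p ≥ 2.
      (trans (ℕ→ℚ-* (p ℕ.* (2 ℕ.* p ∸ 1)) (5 ℕ.* p ∸ 2)) (cong₂ _*_
        (trans (ℕ→ℚ-* p (2 ℕ.* p ∸ 1)) (cong (P *_) (trans (ℕ→ℚ-∸ (ℕP.≤-trans 1≤p (ℕP.m≤n*m p 2))) (cong (_- 1ℚ) (ℕ→ℚ-* 2 p)))))
        (trans (ℕ→ℚ-∸ (ℕP.≤-trans 2≤p (ℕP.m≤n*m p 5))) (cong (_- ℕ→ℚ 2) (ℕ→ℚ-* 5 p)))))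
      (ℕ→ℚ-* 2 p)
      (trans (ℕ→ℚ-* 11 (p ℕ.^ 2)) (cong (ℕ→ℚ 11 *_) P²≡))
      (trans (ℕ→ℚ-* 2 (p ℕ.^ 2)) (cong (ℕ→ℚ 2 *_) P²≡)))
    where
    1≤p : 1 ≤ p
    1≤p = ℕP.≤-trans (ℕP.m≤m+n 1 6) 7≤p
    2≤p : 2 ≤ p
    2≤p = ℕP.≤-trans (ℕP.m≤m+n 2 5) 7≤p
    k+2 : p ∸ 3 ℕ.+ 2 ≡ p ∸ 1
    k+2 = trans (cong (λ n → n ∸ 3 ℕ.+ 2) p≡) (trans (ℕP.+-comm (4 ℕ.+ 2 ℕ.* r) 2) (sym p∸1≡))
    T : ℚ
    T = A⋆ p (p ∸ 3)
    -- Uses `24 e₂(1, …, p − 1) = − 2 p + 9 p² − 10 p³ + 3 p⁴`; trading `w` for `g −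
    -- 1` moves the coefficient of p² next to `p w` from -9 to -11.
    lemma : ∀ p w t g →
      let z = p * w
          x = p - 1ℚ
          ε = g - (w + 1ℚ)
          A₂ = (+ 1 / 24) * ((x - 1ℚ) * x * (x + 1ℚ) * ((+ 3 / 1) * x + (+ 2 / 1)))
      in
      (- A₂ * (1ℚ + z + z * z) + z * z * z * t)
        - (+ 1 / 24) * (p * ((+ 2 / 1) * p - 1ℚ) * ((+ 5 / 1) * p - (+ 2 / 1))
           + p * w * ((+ 2 / 1) * p - (+ 11 / 1) * (p * (p * 1ℚ)) + (+ 2 / 1) * (p * (p * 1ℚ)) * g))
      ≡ p * (p * (p * (p * 1ℚ))) * ((+ 1 / 24) * (- (+ 3 / 1) - w * ((+ 3 / 1) * p - (+ 10 / 1) + (+ 3 / 1) * p * (p * w) - (+ 10 / 1) * (p * w) + (+ 9 / 1) * w)))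
        - (+ 1 / 12) * (z * (p * p) * ε) + z * z * z * t
    lemma = solve-∀ ℚring
    T≡ : T ≡ - esym₂ (P - 1ℚ) * (1ℚ + z + z * z) + z * z * z * T
    T≡ = trans (A⋆-expand (p ∸ 3) 2 k+2) (cong (λ u → - u * (1ℚ + z + z * z) + z * z * z * T) (trans (esym₂-correct (p ∸ 1)) (cong esym₂ ℕ→ℚ-p∸1)))
    go : ∀ {u v v′ v″} → u ≡ P * (ℕ→ℚ 2 * P - 1ℚ) * (ℕ→ℚ 5 * P - ℕ→ℚ 2) → v ≡ ℕ→ℚ 2 * P → v′ ≡ ℕ→ℚ 11 * P ^ 2 → v″ ≡ ℕ→ℚ 2 * P ^ 2 →
      Div 4 (T - (+ 1 / 24) * (u + P * w p * (v - v′ + v″ * AG p)))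
    go refl refl refl refl = subst (Div 4) (sym (trans (cong (_- (+ 1 / 24) * (P * (ℕ→ℚ 2 * P - 1ℚ) * (ℕ→ℚ 5 * P - ℕ→ℚ 2) + P * w p * (ℕ→ℚ 2 * P - ℕ→ℚ 11 * P ^ 2 + ℕ→ℚ 2 * P ^ 2 * AG p))) T≡) (lemma P (w p) T (AG p))))
      (Div-+ (Div--
        (Div-*ʳ (Int-* (Int-1/ 24 (p∤* {4} {6} (p∤≤6 3 (ℕP.m≤m+n 4 2)) (p∤≤6 5 ℕP.≤-refl))) (Int-- (Int-neg (Int-ℕ 3)) (Int-* Int-w
            (Int-+ (Int-- (Int-+ (Int-- (Int-* (Int-ℕ 3) (Int-ℕ p)) (Int-ℕ 10)) (Int-* (Int-* (Int-ℕ 3) (Int-ℕ p)) (Div⇒Int wilson))) (Int-* (Int-ℕ 10) (Div⇒Int wilson)))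
              (Int-* (Int-ℕ 9) Int-w)))))
          (Div-P^ 4))
        (Div-*ˡ (Int-1/ 12 (p∤* {2} {6} (p∤≤6 1 (ℕP.m≤m+n 2 4)) (p∤≤6 5 ℕP.≤-refl))) (Div-* (Div-* wilson (Div-* Div-P Div-P)) AG≡w+1)))
        (Div-* (Div-* (Div-* wilson wilson) wilson) (Div-A⋆ (p ∸ 3) 2 k+2 (Div-A 1 (ℕP.≤-trans (ℕP.m≤m+n 4 3) 7≤p)))))

  B≡ : ∀ n → 0 < n → B n ≡ ℕ→ℚ n * 𝓑 n
  B≡ (suc n) _ = B₁≡ n

  -- `T` is the inverse of `z − 1`. Because `T = − 1 + z T`, an inverse modulo p³ is enough, and
  -- `z-a-b` provides `R` as such an inverse.
  A⋆[p∸1]-mod-p⁴ : A⋆ p (p ∸ 1) ≈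
      - 1ℚ + ℕ→ℚ p * w p
        * (ℕ→ℚ 3 * (ℕ→ℚ p * 𝓑 (p ∸ 1) - 1ℚ) - ℕ→ℚ p * 𝓑 (2 ℕ.* (p ∸ 1))
           - (+ 1 / 2) * ℕ→ℚ (p ℕ.^ 2) * (𝓑 (p ∸ 1) * 𝓑 (p ∸ 1)))
  A⋆[p∸1]-mod-p⁴ = mod-p⁴ (subst₂ (λ n x → Div 4 (T - (- 1ℚ + z * (ℕ→ℚ 3 * (P * 𝓑 (p ∸ 1) - 1ℚ) - P * 𝓑 n - (+ 1 / 2) * x * (𝓑 (p ∸ 1) * 𝓑 (p ∸ 1))))))
      (cong (p ∸ 1 ℕ.+_) (sym (ℕP.+-identityʳ (p ∸ 1)))) (sym P²≡)
      (subst (Div 4) (sym difference) (Div-* wilson T-R)))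
    where
    N : ℕ
    N = (p ∸ 1) ℕ.+ (p ∸ 1)
    T y₁ y₂ u t R D₁ D₂ : ℚ
    T = A⋆ p (p ∸ 1)
    y₁ = P * 𝓑 (p ∸ 1)
    y₂ = P * 𝓑 N
    u = y₁ - 1ℚ
    -- In these variables `R` is `− 1 + u − t − u² / 2`. Modulo p³, `a` is `(P − 1) u` and `b` is
    -- `2 (P − 1) t`, with p dividing `u` and p² dividing `t`.
    t = y₂ - u - (+ 1 / 2)
    R = ℕ→ℚ 3 * u - y₂ - (+ 1 / 2) * P ^ 2 * (𝓑 (p ∸ 1) * 𝓑 (p ∸ 1))
    D₁ = S (p ∸ 1) - P * B (p ∸ 1)
    D₂ = S N - P * B N
    0<p∸1 : 0 < p ∸ 1
    0<p∸1 = subst (0 <_) (sym p∸1≡) (s≤s z≤n)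
    T≡ : T ≡ - 1ℚ + z * T
    T≡ = A⋆≡ (p ∸ 1) 0 (ℕP.+-identityʳ (p ∸ 1))
    T[z-1] : T * (z - 1ℚ) ≡ 1ℚ
    T[z-1] = A⋆-reciprocal (p ∸ 1) 0 (ℕP.+-identityʳ (p ∸ 1))
    lemma₁ : ∀ z t r → (- 1ℚ + z * t) - (- 1ℚ + z * r) ≡ z * (t - r)
    lemma₁ = solve-∀ ℚring
    difference : T - (- 1ℚ + z * R) ≡ z * (T - R)
    difference = trans (cong (_- (- 1ℚ + z * R)) T≡) (lemma₁ z T R)
    PB₁ : P * B (p ∸ 1) ≡ (P - 1ℚ) * y₁
    PB₁ = trans (cong (P *_) (trans (B≡ (p ∸ 1) 0<p∸1) (cong (_* 𝓑 (p ∸ 1)) ℕ→ℚ-p∸1))) (lemma P (P - 1ℚ) (𝓑 (p ∸ 1)))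
      where
      lemma : ∀ a b c → a * (b * c) ≡ b * (a * c)
      lemma = solve-∀ ℚring
    PB₂ : P * B N ≡ (+ 2 / 1) * (P - 1ℚ) * y₂
    PB₂ = trans (cong (P *_) (trans (B≡ N (ℕP.≤-trans 0<p∸1 (ℕP.m≤m+n (p ∸ 1) (p ∸ 1)))) (cong (_* 𝓑 N) (trans (ℕ→ℚ-+ (p ∸ 1) (p ∸ 1)) (cong₂ _+_ ℕ→ℚ-p∸1 ℕ→ℚ-p∸1))))) (lemma P (𝓑 N))
      where
      lemma : ∀ p b → p * ((p - 1ℚ + (p - 1ℚ)) * b) ≡ (+ 2 / 1) * (p - 1ℚ) * (p * b)
      lemma = solve-∀ ℚring
    unit : ∀ {k x} → Div k ((P - 1ℚ) * x) → Div k x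
    unit {k} {x} D = Div-unit (p ∸ 1) {{subst ℕ.NonZero (sym p∸1≡) _}} (p∤< 0<p∸1 (subst (p ∸ 1 <_) (sym p≡suc) ℕP.≤-refl)) (subst (λ v → Div k (v * x)) (sym ℕ→ℚ-p∸1) D)
    a≡u : a ≡ (P - 1ℚ) * u + D₁
    a≡u = trans (lemma (S (p ∸ 1)) ((P - 1ℚ) * y₁) (P - 1ℚ)) (trans (cong (λ v → (P - 1ℚ) * y₁ - (P - 1ℚ) + (S (p ∸ 1) - v)) (sym PB₁)) (cong (_+ D₁) (lemma′ (P - 1ℚ) y₁)))
      where
      lemma : ∀ s x q → s - q ≡ x - q + (s - x)
      lemma = solve-∀ ℚring
      lemma′ : ∀ q y → q * y - q ≡ q * (y - 1ℚ)
      lemma′ = solve-∀ ℚring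
    b≡t : b ≡ (+ 2 / 1) * (P - 1ℚ) * t + (D₂ - (+ 2 / 1) * D₁)
    b≡t = trans (lemma P (S N) (S (p ∸ 1)) y₁ y₂) (cong₂ (λ v v′ → (+ 2 / 1) * (P - 1ℚ) * t + ((S N - v) - (+ 2 / 1) * (S (p ∸ 1) - v′))) (sym PB₂) (sym PB₁))
      where
      lemma : ∀ p s s′ y₁ y₂ → s - (+ 2 / 1) * s′ + (p - 1ℚ)
        ≡ (+ 2 / 1) * (p - 1ℚ) * (y₂ - (y₁ - 1ℚ) - (+ 1 / 2)) + ((s - (+ 2 / 1) * (p - 1ℚ) * y₂) - (+ 2 / 1) * (s′ - (p - 1ℚ) * y₁))
      lemma = solve-∀ ℚring
    Div-u : Div 1 u
    Div-u = unit (subst (Div 1) (trans (cong (_- D₁) a≡u) (lemma ((P - 1ℚ) * u) D₁)) (Div-- Div-a (Div-≤ (s≤s z≤n) S-p∸1-mod-p³)))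
      where
      lemma : ∀ x y → (x + y) - y ≡ x
      lemma = solve-∀ ℚring
    Div-D₂₁ : Div 3 (D₂ - (+ 2 / 1) * D₁)
    Div-D₂₁ = Div-- S-2[p∸1]-mod-p³ (Div-*ˡ (Int-ℕ 2) S-p∸1-mod-p³)
    Div-t : Div 2 t
    Div-t = unit (Div-unit< 1 2<p (subst (Div 2) (trans (cong (_- (D₂ - (+ 2 / 1) * D₁)) b≡t) (lemma P t (D₂ - (+ 2 / 1) * D₁))) (Div-- Div-b (Div-≤ (s≤s (s≤s z≤n)) Div-D₂₁))))
      where
      lemma : ∀ p t x → ((+ 2 / 1) * (p - 1ℚ) * t + x) - x ≡ (+ 2 / 1) * ((p - 1ℚ) * t)
      lemma = solve-∀ ℚring
    -- Modulo p², `a` is `− u`, so `z≡a` makes the leftover term `2 P (z + u)` negligible modulo p³.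
    z+u : Div 2 (z + u)
    z+u = subst (Div 2) (trans (cong (λ v → (z - v) + (P * u + D₁)) a≡u) (lemma z P u D₁)) (Div-+ z≡a (Div-+ (Div-* Div-P Div-u) (Div-≤ (s≤s (s≤s z≤n)) S-p∸1-mod-p³)))
      where
      lemma : ∀ z p u d → (z - ((p - 1ℚ) * u + d)) + (p * u + d) ≡ z + u
      lemma = solve-∀ ℚring
    E : ℚ
    E = (z - 1ℚ) * ((+ 2 / 1) + (+ 2 / 1) * a + a * a - b) + (+ 2 / 1) - (+ 2 / 1) * P * z
    -- 2 (1 − (z − 1) R) and E agree modulo p³.
    lemma₂ : ∀ z p 𝒷 y₂ d₁ d → let u = p * 𝒷 - 1ℚ ; t = y₂ - u - (+ 1 / 2) ; a = (p - 1ℚ) * u + d₁ ; b = (+ 2 / 1) * (p - 1ℚ) * t + d in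
      (+ 2 / 1) * (1ℚ - (z - 1ℚ) * ((+ 3 / 1) * u - y₂ - (+ 1 / 2) * (p * (p * 1ℚ)) * (𝒷 * 𝒷)))
      ≡ ((z - 1ℚ) * ((+ 2 / 1) + (+ 2 / 1) * a + a * a - b) + (+ 2 / 1) - (+ 2 / 1) * p * z)
        + ((+ 2 / 1) * (p * (z + u)) - (+ 2 / 1) * (z * (p * u)) + (z - 1ℚ) * ((+ 2 / 1) * (p * t) + ((+ 2 / 1) - p) * (p * (u * u))))
        + (z - 1ℚ) * (d - ((+ 2 / 1) + (+ 2 / 1) * (p - 1ℚ) * u + d₁) * d₁)
    lemma₂ = solve-∀ ℚring
    expand : (+ 2 / 1) * (1ℚ - (z - 1ℚ) * R)
      ≡ E + ((+ 2 / 1) * (P * (z + u)) - (+ 2 / 1) * (z * (P * u)) + (z - 1ℚ) * ((+ 2 / 1) * (P * t) + ((+ 2 / 1) - P) * (P * (u * u))))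
        + (z - 1ℚ) * ((D₂ - (+ 2 / 1) * D₁) - ((+ 2 / 1) + (+ 2 / 1) * (P - 1ℚ) * u + D₁) * D₁)
    expand = trans (lemma₂ z P (𝓑 (p ∸ 1)) y₂ D₁ (D₂ - (+ 2 / 1) * D₁))
      (cong₂ (λ a b → ((z - 1ℚ) * ((+ 2 / 1) + (+ 2 / 1) * a + a * a - b) + (+ 2 / 1) - (+ 2 / 1) * P * z)
        + ((+ 2 / 1) * (P * (z + u)) - (+ 2 / 1) * (z * (P * u)) + (z - 1ℚ) * ((+ 2 / 1) * (P * t) + ((+ 2 / 1) - P) * (P * (u * u))))
        + (z - 1ℚ) * ((D₂ - (+ 2 / 1) * D₁) - ((+ 2 / 1) + (+ 2 / 1) * (P - 1ℚ) * u + D₁) * D₁)) (sym a≡u) (sym b≡t))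
    Iz-1 : Int (z - 1ℚ)
    Iz-1 = Int-- (Div⇒Int wilson) (Int-ℕ 1)
    1-[z-1]R : Div 3 (1ℚ - (z - 1ℚ) * R)
    1-[z-1]R = Div-unit< 1 2<p (subst (Div 3) (sym expand)
      (Div-+ (Div-+ z-a-b (Div-+ (Div-- (Div-*ˡ (Int-ℕ 2) (Div-* Div-P z+u)) (Div-*ˡ (Int-ℕ 2) (Div-* wilson (Div-* Div-P Div-u))))
          (Div-*ˡ Iz-1 (Div-+ (Div-*ˡ (Int-ℕ 2) (Div-* Div-P Div-t)) (Div-*ˡ (Int-- (Int-ℕ 2) (Int-ℕ p)) (Div-* Div-P (Div-* Div-u Div-u)))))))
        (Div-*ˡ Iz-1 (Div-- Div-D₂₁ (Div-*ˡ (Int-+ (Int-+ (Int-ℕ 2) (Int-* (Int-* (Int-ℕ 2) (Int-- (Int-ℕ p) (Int-ℕ 1))) (Div⇒Int Div-u))) (Div⇒Int S-p∸1-mod-p³)) S-p∸1-mod-p³)))))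
    T-R : Div 3 (T - R)
    T-R = subst (Div 3) (trans (lemma T z R) (trans (cong (λ v → T - v * R) T[z-1]) (cong (λ v → T - v) (ℚP.*-identityˡ R)))) (Div-*ˡ (Int-A⋆ (p ∸ 1)) 1-[z-1]R)
      where
      lemma : ∀ t z r → t * (1ℚ - (z - 1ℚ) * r) ≡ t - (t * (z - 1ℚ)) * r
      lemma = solve-∀ ℚring

  -- Exponents −2, p − 3, 2p − 4

  h n₁ n₂ : ℕ
  h = 3 ℕ.+ r
  n₁ = 4 ℕ.+ 2 ℕ.* r
  n₂ = n₁ ℕ.+ (p ∸ 1)

  p≡suc[h+h] : p ≡ suc (h ℕ.+ h)
  p≡suc[h+h] = trans p≡ (lemma r)
    where
    lemma : ∀ r → 7 ℕ.+ 2 ℕ.* r ≡ suc ((3 ℕ.+ r) ℕ.+ (3 ℕ.+ r))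
    lemma = ℕR.solve-∀

  p∸1≡h+h : p ∸ 1 ≡ h ℕ.+ h
  p∸1≡h+h = cong (_∸ 1) p≡suc[h+h]

  p∸1≡n₁+2 : p ∸ 1 ≡ n₁ ℕ.+ 2
  p∸1≡n₁+2 = trans p∸1≡ (ℕP.+-comm 2 n₁)

  P≡ : P ≡ (+ 7 / 1) + ℕ→ℚ (2 ℕ.* r)
  P≡ = trans (cong ℕ→ℚ p≡) (ℕ→ℚ-+ 7 (2 ℕ.* r))

  ℕ→ℚ-n₁ : ℕ→ℚ n₁ ≡ P - (+ 3 / 1)
  ℕ→ℚ-n₁ = trans (ℕ→ℚ-+ 4 (2 ℕ.* r)) (trans (lemma (ℕ→ℚ (2 ℕ.* r))) (cong (_- (+ 3 / 1)) (sym P≡)))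
    where
    lemma : ∀ x → (+ 4 / 1) + x ≡ (+ 7 / 1) + x - (+ 3 / 1)
    lemma = solve-∀ ℚring

  ℕ→ℚ-n₂ : ℕ→ℚ n₂ ≡ (+ 2 / 1) * P - (+ 4 / 1)
  ℕ→ℚ-n₂ = trans (ℕ→ℚ-+ n₁ (p ∸ 1)) (trans (cong₂ _+_ ℕ→ℚ-n₁ ℕ→ℚ-p∸1) (lemma P))
    where
    lemma : ∀ p → p - (+ 3 / 1) + (p - 1ℚ) ≡ (+ 2 / 1) * p - (+ 4 / 1)
    lemma = solve-∀ ℚring

  p∤n₁ : ¬ (p ∣ n₁)
  p∤n₁ = p∤< (s≤s z≤n) (<p (s≤s (ℕP.m≤n+m (4 ℕ.+ 2 ℕ.* r) 2)))

  p∤n₂ : ¬ (p ∣ n₂)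
  p∤n₂ p∣n₂ = p∤* {2} {5 ℕ.+ 2 ℕ.* r} (p∤≤6 1 (ℕP.m≤m+n 2 4)) (p∤< (s≤s z≤n) (<p (s≤s (ℕP.m≤n+m (5 ℕ.+ 2 ℕ.* r) 1))))
    (subst (p ∣_) (trans (cong (n₁ ℕ.+_) p∸1≡) (lemma r)) p∣n₂)
    where
    lemma : ∀ r → 4 ℕ.+ 2 ℕ.* r ℕ.+ (6 ℕ.+ 2 ℕ.* r) ≡ 2 ℕ.* (5 ℕ.+ 2 ℕ.* r)
    lemma = ℕR.solve-∀

  κ₁ κ₂ : ℚ
  κ₁ = + 1 / n₁
  κ₂ = + 1 / n₂

  -- i ↦ (i + 1) ^ n / n for n = −2, p − 3, 2p − 4.
  G₀ G₁ G₂ : ℕ → ℚ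
  G₀ i = (- (+ 1 / 2)) * (+ 1 / suc i) ^ 2
  G₁ i = κ₁ * ℕ→ℚ (suc i) ^ n₁
  G₂ i = κ₂ * ℕ→ℚ (suc i) ^ n₂

  Y₀ Y₁ Y₂ : ℚ
  Y₀ = ∑ (p ∸ 1) G₀
  Y₁ = ∑ (p ∸ 1) G₁
  Y₂ = ∑ (p ∸ 1) G₂

  Δ : (ℕ → ℚ) → ℕ → ℚ
  Δ G j = G (j ℕ.+ j) - G (j ℕ.+ j ℕ.+ suc (h ℕ.+ h))

  -- Doubling scales the sum by `s` exactly but permutes the arguments only modulo p, so `1 − s`
  -- times the sum is a sum of differences at arguments p apart. In each use `s` is 1/4 modulo p,
  -- hence `1 − s` is a unit.
  ∑-doubling-scaled : ∀ G s → (∀ i → G (suc (i ℕ.+ i)) ≡ s * G i) → ∑ (p ∸ 1) G * (1ℚ - s) ≡ ∑ h (Δ G)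
  ∑-doubling-scaled G s G-double = begin
    ∑ (p ∸ 1) G * (1ℚ - s)
      ≡⟨ cong (λ n → ∑ n G * (1ℚ - s)) p∸1≡h+h ⟩
    ∑ (h ℕ.+ h) G * (1ℚ - s)
      ≡⟨ lemma (∑ (h ℕ.+ h) G) s ⟩
    ∑ (h ℕ.+ h) G - s * ∑ (h ℕ.+ h) G
      ≡⟨ cong (λ u → ∑ (h ℕ.+ h) G - u) (trans (sym (∑-*ˡ (h ℕ.+ h) s G)) (∑-cong (h ℕ.+ h) (λ i _ → sym (G-double i)))) ⟩
    ∑ (h ℕ.+ h) G - ∑ (h ℕ.+ h) (λ i → G (suc (i ℕ.+ i)))
      ≡⟨ ∑-doubling h G ⟩
    ∑ h (Δ G) ∎
    where
    open ≡-Reasoning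
    lemma : ∀ x s → x * (1ℚ - s) ≡ x - s * x
    lemma = solve-∀ ℚring

  ℕ→ℚ-double : ∀ i → ℕ→ℚ (suc (suc (i ℕ.+ i))) ≡ ℕ→ℚ 2 * ℕ→ℚ (suc i)
  ℕ→ℚ-double i = trans (cong ℕ→ℚ (lemma i)) (ℕ→ℚ-* 2 (suc i))
    where
    lemma : ∀ i → suc (suc (i ℕ.+ i)) ≡ 2 ℕ.* suc i
    lemma = ℕR.solve-∀

  G₀-double : ∀ i → G₀ (suc (i ℕ.+ i)) ≡ (+ 1 / 4) * G₀ i
  G₀-double i = trans (cong (λ x → (- (+ 1 / 2)) * x ^ 2) half) (lemma (+ 1 / suc i))
    where
    open ≡-Reasoning
    half : + 1 / suc (suc (i ℕ.+ i)) ≡ (+ 1 / 2) * (+ 1 / suc i)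
    half = *-cancelʳ-ℕ→ℚ (suc (suc (i ℕ.+ i))) (begin
      (+ 1 / suc (suc (i ℕ.+ i))) * ℕ→ℚ (suc (suc (i ℕ.+ i)))       ≡⟨ 1/-inverse (suc (suc (i ℕ.+ i))) ⟩
      1ℚ                                                            ≡⟨ 1/-inverse (suc i) ⟨
      (+ 1 / suc i) * ℕ→ℚ (suc i)                                   ≡⟨ lemma₁ (+ 1 / suc i) (ℕ→ℚ (suc i)) ⟩
      (+ 1 / 2) * (+ 1 / suc i) * ((+ 2 / 1) * ℕ→ℚ (suc i))         ≡⟨ cong ((+ 1 / 2) * (+ 1 / suc i) *_) (ℕ→ℚ-double i) ⟨
      (+ 1 / 2) * (+ 1 / suc i) * ℕ→ℚ (suc (suc (i ℕ.+ i)))         ∎)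
      where
      lemma₁ : ∀ x n → x * n ≡ (+ 1 / 2) * x * ((+ 2 / 1) * n)
      lemma₁ = solve-∀ ℚring
    lemma : ∀ x → (- (+ 1 / 2)) * ((+ 1 / 2) * x * ((+ 1 / 2) * x * 1ℚ)) ≡ (+ 1 / 4) * ((- (+ 1 / 2)) * (x * (x * 1ℚ)))
    lemma = solve-∀ ℚring

  monomial-double : ∀ κ n i → κ * ℕ→ℚ (suc (suc (i ℕ.+ i))) ^ n ≡ ℕ→ℚ 2 ^ n * (κ * ℕ→ℚ (suc i) ^ n)
  monomial-double κ n i = trans (cong (λ x → κ * x ^ n) (ℕ→ℚ-double i)) (trans (cong (κ *_) (^-distrib-* (ℕ→ℚ 2) (ℕ→ℚ (suc i)) n)) (lemma κ (ℕ→ℚ 2 ^ n) (ℕ→ℚ (suc i) ^ n)))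
    where
    lemma : ∀ k x y → k * (x * y) ≡ x * (k * y)
    lemma = solve-∀ ℚring

  -- `p − 3` is `(p − 1) − 2`: all three exponents share the factor `c²` and differ by powers of
  -- `u ^ (p ∸ 1)`.
  n₁-power : ∀ u c → u * c ≡ 1ℚ → u ^ n₁ ≡ c * c * u ^ (p ∸ 1)
  n₁-power u c uc = begin
    u ^ n₁                        ≡⟨ lemma₁ (u ^ n₁) ⟩
    1ℚ * 1ℚ * u ^ n₁              ≡⟨ cong (λ x → x * x * u ^ n₁) uc ⟨
    u * c * (u * c) * u ^ n₁      ≡⟨ lemma₂ u c (u ^ n₁) ⟩
    c * c * (u ^ n₁ * u ^ 2)      ≡⟨ cong (c * c *_) (^-homo-* u n₁ 2) ⟨
    c * c * u ^ (n₁ ℕ.+ 2)        ≡⟨ cong (λ n → c * c * u ^ n) p∸1≡n₁+2 ⟨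
    c * c * u ^ (p ∸ 1)           ∎
    where
    open ≡-Reasoning
    lemma₁ : ∀ x → x ≡ 1ℚ * 1ℚ * x
    lemma₁ = solve-∀ ℚring
    lemma₂ : ∀ u c x → u * c * (u * c) * x ≡ c * c * (x * (u * (u * 1ℚ)))
    lemma₂ = solve-∀ ℚring

  n₂-power : ∀ u c → u * c ≡ 1ℚ → u ^ n₂ ≡ c * c * (u ^ (p ∸ 1) * u ^ (p ∸ 1))
  n₂-power u c uc = trans (^-homo-* u n₁ (p ∸ 1)) (trans (cong (_* u ^ (p ∸ 1)) (n₁-power u c uc)) (ℚP.*-assoc (c * c) (u ^ (p ∸ 1)) (u ^ (p ∸ 1))))

  module Differences (j : ℕ) (j<h : j < h) where

    -- `v = 2j + 1` and `u = v + p` are the numbers compared by `Δ`, with inverses `d` and `c`. Here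
    -- `v = u (1 + y)`, `ε` is the Fermat defect of `u`, and `e₁`, `e₂` are the errors of
    -- second-order binomial expansions.
    v u c d y ε e₁ e₂ : ℚ
    v = ℕ→ℚ (suc (j ℕ.+ j))
    u = ℕ→ℚ (suc (j ℕ.+ j ℕ.+ suc (h ℕ.+ h)))
    c = + 1 / suc (j ℕ.+ j ℕ.+ suc (h ℕ.+ h))
    d = + 1 / suc (j ℕ.+ j)
    y = - (P * c)
    ε = u ^ (p ∸ 1) - 1ℚ
    e₁ = (+ 2 / 1) * (1ℚ + y) ^ n₁ - ((+ 2 / 1) + (+ 2 / 1) * ℕ→ℚ n₁ * y + ℕ→ℚ n₁ * (ℕ→ℚ n₁ - 1ℚ) * (y * y))
    e₂ = (+ 2 / 1) * (1ℚ + y) ^ n₂ - ((+ 2 / 1) + (+ 2 / 1) * ℕ→ℚ n₂ * y + ℕ→ℚ n₂ * (ℕ→ℚ n₂ - 1ℚ) * (y * y))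

    p∤v : ¬ (p ∣ suc (j ℕ.+ j))
    p∤v = p∤< (s≤s z≤n) (subst (suc (j ℕ.+ j) <_) (sym p≡suc[h+h]) (s≤s (ℕP.≤-trans (ℕP.+-mono-≤-< (ℕP.<⇒≤ j<h) j<h) ℕP.≤-refl)))

    p∤u : ¬ (p ∣ suc (j ℕ.+ j ℕ.+ suc (h ℕ.+ h)))
    p∤u p∣u = p∤v (∣.∣m+n∣m⇒∣n (subst (p ∣_) (ℕP.+-comm (suc (j ℕ.+ j)) p) (subst (λ n → p ∣ suc (j ℕ.+ j ℕ.+ n)) (sym p≡suc[h+h]) p∣u)) ∣.∣-refl)

    uc≡1 : u * c ≡ 1ℚ
    uc≡1 = trans (ℚP.*-comm u c) (1/-inverse (suc (j ℕ.+ j ℕ.+ suc (h ℕ.+ h))))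

    vd≡1 : v * d ≡ 1ℚ
    vd≡1 = trans (ℚP.*-comm v d) (1/-inverse (suc (j ℕ.+ j)))

    v≡ : v ≡ u * (1ℚ + y)
    v≡ = begin
      v                          ≡⟨ lemma₁ v P ⟩
      (v + P) - P * 1ℚ           ≡⟨ cong₂ (λ x x′ → x - P * x′) (trans (cong (λ n → v + ℕ→ℚ n) p≡suc[h+h]) (sym (ℕ→ℚ-+ (suc (j ℕ.+ j)) (suc (h ℕ.+ h))))) (sym uc≡1) ⟩
      u - P * (u * c)            ≡⟨ lemma₂ u P c ⟩
      u * (1ℚ + y)               ∎
      where
      open ≡-Reasoning
      lemma₁ : ∀ v p → v ≡ (v + p) - p * 1ℚ
      lemma₁ = solve-∀ ℚring
      lemma₂ : ∀ u p c → u - p * (u * c) ≡ u * (1ℚ + - (p * c))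
      lemma₂ = solve-∀ ℚring

    -- Eliminates `c` in favour of `d`, which makes the difference for the exponent -2 an exact
    -- polynomial identity.
    c≡ : c ≡ (1ℚ + y) * d
    c≡ = begin
      c                                ≡⟨ ℚP.*-identityʳ c ⟨
      c * 1ℚ                           ≡⟨ cong (c *_) vd≡1 ⟨
      c * (v * d)                      ≡⟨ cong (λ x → c * (x * d)) v≡ ⟩
      c * (u * (1ℚ + y) * d)           ≡⟨ lemma c u (1ℚ + y) d ⟩
      u * c * ((1ℚ + y) * d)           ≡⟨ cong (_* ((1ℚ + y) * d)) uc≡1 ⟩
      1ℚ * ((1ℚ + y) * d)              ≡⟨ ℚP.*-identityˡ ((1ℚ + y) * d) ⟩
      (1ℚ + y) * d                     ∎
      where
      open ≡-Reasoning
      lemma : ∀ c u x d → c * (u * x * d) ≡ u * c * (x * d)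
      lemma = solve-∀ ℚring

    Int-c : Int c
    Int-c = Int-1/ (suc (j ℕ.+ j ℕ.+ suc (h ℕ.+ h))) p∤u

    Int-d : Int d
    Int-d = Int-1/ (suc (j ℕ.+ j)) p∤v

    Div-y : Div 1 y
    Div-y = Div-neg (Div-*ʳ Int-c Div-P)

    Div-ε : Div 1 ε
    Div-ε = fermat-unit (suc (j ℕ.+ j ℕ.+ suc (h ℕ.+ h))) p∤u

    Div-e₁ : Div 3 e₁
    Div-e₁ = [1+y]^n-expansion Div-y n₁

    Div-e₂ : Div 3 e₂
    Div-e₂ = [1+y]^n-expansion Div-y n₂

    -- This and ΔG-monomial below have the same shape, uⁿ (2y + (n − 1) y²) up to terms divisible by p³,
    -- with n = −2 here.
    ΔG₀ : (+ 2 / 1) * Δ G₀ j ≡ c * c * ((+ 2 / 1) * y - (+ 3 / 1) * (y * y)) + d * d * (y * (y * y)) * ((+ 4 / 1) + (+ 3 / 1) * y)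
    ΔG₀ = subst (λ x → (+ 2 / 1) * ((- (+ 1 / 2)) * d ^ 2 - (- (+ 1 / 2)) * x ^ 2) ≡ x * x * ((+ 2 / 1) * y - (+ 3 / 1) * (y * y)) + d * d * (y * (y * y)) * ((+ 4 / 1) + (+ 3 / 1) * y)) (sym c≡) (lemma y d)
      where
      lemma : ∀ y d → (+ 2 / 1) * ((- (+ 1 / 2)) * (d * (d * 1ℚ)) - (- (+ 1 / 2)) * ((1ℚ + y) * d * ((1ℚ + y) * d * 1ℚ)))
        ≡ (1ℚ + y) * d * ((1ℚ + y) * d) * ((+ 2 / 1) * y - (+ 3 / 1) * (y * y)) + d * d * (y * (y * y)) * ((+ 4 / 1) + (+ 3 / 1) * y)
      lemma = solve-∀ ℚring

    -- Dividing by `n` makes the linear coefficient the same for all exponents, so differences in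
    -- `n` affect only `u ^ n` and the coefficient of `y²`.
    ΔG-monomial : ∀ n κ → κ * ℕ→ℚ n ≡ 1ℚ → (+ 2 / 1) * (κ * v ^ n - κ * u ^ n)
      ≡ u ^ n * (κ * ((+ 2 / 1) * (1ℚ + y) ^ n - ((+ 2 / 1) + (+ 2 / 1) * ℕ→ℚ n * y + ℕ→ℚ n * (ℕ→ℚ n - 1ℚ) * (y * y))) + ((+ 2 / 1) * y + (ℕ→ℚ n - 1ℚ) * (y * y)))
    ΔG-monomial n κ κn = begin
      (+ 2 / 1) * (κ * v ^ n - κ * u ^ n)
        ≡⟨ cong (λ x → (+ 2 / 1) * (κ * x - κ * u ^ n)) (trans (cong (_^ n) v≡) (^-distrib-* u (1ℚ + y) n)) ⟩
      (+ 2 / 1) * (κ * (u ^ n * (1ℚ + y) ^ n) - κ * u ^ n)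
        ≡⟨ lemma κ (u ^ n) ((1ℚ + y) ^ n) (ℕ→ℚ n) y ⟩
      u ^ n * (κ * ((+ 2 / 1) * (1ℚ + y) ^ n - ((+ 2 / 1) + (+ 2 / 1) * ℕ→ℚ n * y + ℕ→ℚ n * (ℕ→ℚ n - 1ℚ) * (y * y))) + κ * ℕ→ℚ n * ((+ 2 / 1) * y + (ℕ→ℚ n - 1ℚ) * (y * y)))
        ≡⟨ cong (λ x → u ^ n * (κ * ((+ 2 / 1) * (1ℚ + y) ^ n - ((+ 2 / 1) + (+ 2 / 1) * ℕ→ℚ n * y + ℕ→ℚ n * (ℕ→ℚ n - 1ℚ) * (y * y))) + x)) (trans (cong (_* ((+ 2 / 1) * y + (ℕ→ℚ n - 1ℚ) * (y * y))) κn) (ℚP.*-identityˡ ((+ 2 / 1) * y + (ℕ→ℚ n - 1ℚ) * (y * y)))) ⟩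
      u ^ n * (κ * ((+ 2 / 1) * (1ℚ + y) ^ n - ((+ 2 / 1) + (+ 2 / 1) * ℕ→ℚ n * y + ℕ→ℚ n * (ℕ→ℚ n - 1ℚ) * (y * y))) + ((+ 2 / 1) * y + (ℕ→ℚ n - 1ℚ) * (y * y))) ∎
      where
      open ≡-Reasoning
      lemma : ∀ κ x q n y → (+ 2 / 1) * (κ * (x * q) - κ * x)
        ≡ x * (κ * ((+ 2 / 1) * q - ((+ 2 / 1) + (+ 2 / 1) * n * y + n * (n - 1ℚ) * (y * y))) + κ * n * ((+ 2 / 1) * y + (n - 1ℚ) * (y * y)))
      lemma = solve-∀ ℚring

    g≡ : u ^ (p ∸ 1) ≡ 1ℚ + ε
    g≡ = lemma (u ^ (p ∸ 1))
      where
      lemma : ∀ x → x ≡ 1ℚ + (x - 1ℚ)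
      lemma = solve-∀ ℚring

    ΔG₁ : (+ 2 / 1) * Δ G₁ j ≡ c * c * (1ℚ + ε) * (κ₁ * e₁ + ((+ 2 / 1) * y + (P - (+ 4 / 1)) * (y * y)))
    ΔG₁ = trans (ΔG-monomial n₁ κ₁ (1/-inverse n₁)) (cong₂ (λ x n → x * (κ₁ * e₁ + ((+ 2 / 1) * y + n * (y * y))))
      (trans (n₁-power u c uc≡1) (cong (c * c *_) g≡)) (trans (cong (_- 1ℚ) ℕ→ℚ-n₁) (lemma P)))
      where
      lemma : ∀ p → p - (+ 3 / 1) - 1ℚ ≡ p - (+ 4 / 1)
      lemma = solve-∀ ℚring

    ΔG₂ : (+ 2 / 1) * Δ G₂ j ≡ c * c * ((1ℚ + ε) * (1ℚ + ε)) * (κ₂ * e₂ + ((+ 2 / 1) * y + ((+ 2 / 1) * P - (+ 5 / 1)) * (y * y)))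
    ΔG₂ = trans (ΔG-monomial n₂ κ₂ (1/-inverse n₂)) (cong₂ (λ x n → x * (κ₂ * e₂ + ((+ 2 / 1) * y + n * (y * y))))
      (trans (n₂-power u c uc≡1) (cong (λ x → c * c * (x * x)) g≡)) (trans (cong (_- 1ℚ) ℕ→ℚ-n₂) (lemma P)))
      where
      lemma : ∀ p → (+ 2 / 1) * p - (+ 4 / 1) - 1ℚ ≡ (+ 2 / 1) * p - (+ 5 / 1)
      lemma = solve-∀ ℚring

    Int-κ₁ : Int κ₁
    Int-κ₁ = Int-1/ n₁ p∤n₁

    Int-κ₂ : Int κ₂
    Int-κ₂ = Int-1/ n₂ p∤n₂

    Int-1+ε : Int (1ℚ + ε)
    Int-1+ε = Int-+ (Int-ℕ 1) (Div⇒Int Div-ε)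

    -- Modulo p² both differences are `c² y`, because p divides `ε` and `y`.
    first-difference : Div 2 (Δ G₂ j - Δ G₁ j)
    first-difference = Div-unit< 1 2<p (subst (Div 2) (sym (trans (lemma₁ (Δ G₂ j) (Δ G₁ j)) (trans (cong₂ _-_ ΔG₂ ΔG₁) (lemma₂ c ε κ₁ e₁ κ₂ e₂ y P))))
      (Div-*ˡ (Int-* (Int-* Int-c Int-c) Int-1+ε) (Div-+ (Div-+ (Div-*ˡ (Int-ℕ 2) (Div-* Div-ε Div-y))
          (Div-*ʳ (Int-- (Int-* Int-1+ε (Int-- (Int-* (Int-ℕ 2) (Int-ℕ p)) (Int-ℕ 5))) (Int-- (Int-ℕ p) (Int-ℕ 4))) (Div-* Div-y Div-y)))
        (Div-- (Div-*ˡ Int-1+ε (Div-*ˡ Int-κ₂ (Div-≤ (s≤s (s≤s z≤n)) Div-e₂))) (Div-*ˡ Int-κ₁ (Div-≤ (s≤s (s≤s z≤n)) Div-e₁))))))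
      where
      lemma₁ : ∀ a b → (+ 2 / 1) * (a - b) ≡ (+ 2 / 1) * a - (+ 2 / 1) * b
      lemma₁ = solve-∀ ℚring
      lemma₂ : ∀ c ε κ₁ e₁ κ₂ e₂ y p → c * c * ((1ℚ + ε) * (1ℚ + ε)) * (κ₂ * e₂ + ((+ 2 / 1) * y + ((+ 2 / 1) * p - (+ 5 / 1)) * (y * y)))
          - c * c * (1ℚ + ε) * (κ₁ * e₁ + ((+ 2 / 1) * y + (p - (+ 4 / 1)) * (y * y)))
        ≡ c * c * (1ℚ + ε) * ((+ 2 / 1) * (ε * y) + y * y * ((1ℚ + ε) * ((+ 2 / 1) * p - (+ 5 / 1)) - (p - (+ 4 / 1))) + ((1ℚ + ε) * (κ₂ * e₂) - κ₁ * e₁))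
      lemma₂ = solve-∀ ℚring

    -- The linear terms combine to `2 y (1 − 2 (1 + ε) + (1 + ε)²) = 2 y ε²`. The coefficients -3, p
    -- - 4, 2p - 5 of `y²` form an arithmetic progression, so from `y²` only multiples of `y² ε`
    -- remain.
    second-difference : Div 3 (Δ G₀ j + (- (+ 2 / 1) * Δ G₁ j + Δ G₂ j))
    second-difference = Div-unit< 1 2<p (subst (Div 3) (sym (trans (lemma₁ (Δ G₀ j) (Δ G₁ j) (Δ G₂ j))
        (trans (cong₂ _+_ ΔG₀ (cong₂ (λ x x′ → - (+ 2 / 1) * x + x′) ΔG₁ ΔG₂)) (lemma₂ c d ε κ₁ e₁ κ₂ e₂ y P))))
      (Div-+ (Div-+ (Div-*ˡ (Int-* Int-c Int-c) (Div-+ (Div-*ˡ (Int-ℕ 2) (Div-* Div-y (Div-* Div-ε Div-ε)))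
            (Div-*ʳ (Int-+ (Int-- (Int-* (Int-ℕ 2) (Int-ℕ p)) (Int-ℕ 2)) (Int-* (Div⇒Int Div-ε) (Int-- (Int-* (Int-ℕ 2) (Int-ℕ p)) (Int-ℕ 5)))) (Div-* (Div-* Div-y Div-y) Div-ε))))
          (Div-*ʳ (Int-+ (Int-ℕ 4) (Int-* (Int-ℕ 3) (Div⇒Int Div-y))) (Div-*ˡ (Int-* Int-d Int-d) (Div-* Div-y (Div-* Div-y Div-y)))))
        (Div-*ˡ (Int-* (Int-* Int-c Int-c) Int-1+ε) (Div-- (Div-*ˡ Int-1+ε (Div-*ˡ Int-κ₂ Div-e₂)) (Div-*ˡ (Int-ℕ 2) (Div-*ˡ Int-κ₁ Div-e₁))))))
      where
      lemma₁ : ∀ a b c → (+ 2 / 1) * (a + (- (+ 2 / 1) * b + c)) ≡ (+ 2 / 1) * a + (- (+ 2 / 1) * ((+ 2 / 1) * b) + (+ 2 / 1) * c)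
      lemma₁ = solve-∀ ℚring
      lemma₂ : ∀ c d ε κ₁ e₁ κ₂ e₂ y p →
        (c * c * ((+ 2 / 1) * y - (+ 3 / 1) * (y * y)) + d * d * (y * (y * y)) * ((+ 4 / 1) + (+ 3 / 1) * y))
          + (- (+ 2 / 1) * (c * c * (1ℚ + ε) * (κ₁ * e₁ + ((+ 2 / 1) * y + (p - (+ 4 / 1)) * (y * y))))
             + c * c * ((1ℚ + ε) * (1ℚ + ε)) * (κ₂ * e₂ + ((+ 2 / 1) * y + ((+ 2 / 1) * p - (+ 5 / 1)) * (y * y))))
        ≡ c * c * ((+ 2 / 1) * (y * (ε * ε)) + y * y * ε * ((+ 2 / 1) * p - (+ 2 / 1) + ε * ((+ 2 / 1) * p - (+ 5 / 1))))
          + d * d * (y * (y * y)) * ((+ 4 / 1) + (+ 3 / 1) * y)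
          + c * c * (1ℚ + ε) * ((1ℚ + ε) * (κ₂ * e₂) - (+ 2 / 1) * (κ₁ * e₁))
      lemma₂ = solve-∀ ℚring

  -- The Kummer congruence

  η : ℚ
  η = ℕ→ℚ 2 ^ (p ∸ 1) - 1ℚ

  Div-η : Div 1 η
  Div-η = fermat-unit 2 (p∤≤6 1 (ℕP.m≤m+n 2 4))

  2^n₁ : ℕ→ℚ 2 ^ n₁ ≡ (+ 1 / 4) * (1ℚ + η)
  2^n₁ = trans (n₁-power (ℕ→ℚ 2) (+ 1 / 2) refl) (lemma (ℕ→ℚ 2 ^ (p ∸ 1)))
    where
    lemma : ∀ x → (+ 1 / 2) * (+ 1 / 2) * x ≡ (+ 1 / 4) * (1ℚ + (x - 1ℚ))
    lemma = solve-∀ ℚring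

  2^n₂ : ℕ→ℚ 2 ^ n₂ ≡ (+ 1 / 4) * ((1ℚ + η) * (1ℚ + η))
  2^n₂ = trans (n₂-power (ℕ→ℚ 2) (+ 1 / 2) refl) (lemma (ℕ→ℚ 2 ^ (p ∸ 1)))
    where
    lemma : ∀ x → (+ 1 / 2) * (+ 1 / 2) * (x * x) ≡ (+ 1 / 4) * ((1ℚ + (x - 1ℚ)) * (1ℚ + (x - 1ℚ)))
    lemma = solve-∀ ℚring

  Y₀-Δ : Y₀ * (1ℚ - (+ 1 / 4)) ≡ ∑ h (Δ G₀)
  Y₀-Δ = ∑-doubling-scaled G₀ (+ 1 / 4) G₀-double

  Y₁-Δ : Y₁ * (1ℚ - (+ 1 / 4) * (1ℚ + η)) ≡ ∑ h (Δ G₁)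
  Y₁-Δ = trans (cong (λ s → Y₁ * (1ℚ - s)) (sym 2^n₁)) (∑-doubling-scaled G₁ (ℕ→ℚ 2 ^ n₁) (monomial-double κ₁ n₁))

  Y₂-Δ : Y₂ * (1ℚ - (+ 1 / 4) * ((1ℚ + η) * (1ℚ + η))) ≡ ∑ h (Δ G₂)
  Y₂-Δ = trans (cong (λ s → Y₂ * (1ℚ - s)) (sym 2^n₂)) (∑-doubling-scaled G₂ (ℕ→ℚ 2 ^ n₂) (monomial-double κ₂ n₂))

  Y₁≡ : Y₁ ≡ κ₁ * S n₁
  Y₁≡ = ∑-*ˡ (p ∸ 1) κ₁ (λ i → ℕ→ℚ (suc i) ^ n₁)

  Y₂≡ : Y₂ ≡ κ₂ * S n₂
  Y₂≡ = ∑-*ˡ (p ∸ 1) κ₂ (λ i → ℕ→ℚ (suc i) ^ n₂)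

  Div-Y₁ : Div 1 Y₁
  Div-Y₁ = subst (Div 1) (sym Y₁≡) (Div-*ˡ (Int-1/ n₁ p∤n₁) (Div-S (3 ℕ.+ 2 ℕ.* r) (<p (s≤s (ℕP.m≤n+m (5 ℕ.+ 2 ℕ.* r) 1)))))

  Div-Y₂ : Div 1 Y₂
  Div-Y₂ = subst (Div 1) (sym Y₂≡) (Div-*ˡ (Int-1/ n₂ p∤n₂) (Div-S-periodic (3 ℕ.+ 2 ℕ.* r) (<p (s≤s (ℕP.m≤n+m (5 ℕ.+ 2 ℕ.* r) 1)))))

  -- Needed because the scale factors 1/4, `(1 + η)/4`, `(1 + η)²/4` vary as well: removing them
  -- from the second difference leaves `2 η (Y₂ − Y₁) + η² Y₂`, which must vanish modulo p³.
  Y₂-Y₁ : Div 2 (Y₂ - Y₁)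
  Y₂-Y₁ = Div-unit< 2 (ℕP.≤-trans (ℕP.m≤m+n 4 3) 7≤p) (subst (Div 2) (trans (cong (λ x → (+ 4 / 1) * x + (+ 2 / 1) * (η * Y₂) + η * (η * Y₂) - η * Y₁) (cong₂ _-_ (sym Y₂-Δ) (sym Y₁-Δ))) (lemma Y₁ Y₂ η))
    (Div-- (Div-+ (Div-+ (Div-*ˡ (Int-ℕ 4) (Div-∑-diff h {Δ G₂} {Δ G₁} (λ j j<h → Differences.first-difference j j<h))) (Div-*ˡ (Int-ℕ 2) (Div-* Div-η Div-Y₂)))
      (Div-*ˡ (Div⇒Int Div-η) (Div-* Div-η Div-Y₂))) (Div-* Div-η Div-Y₁)))
    where
    lemma : ∀ y₁ y₂ η → (+ 4 / 1) * (y₂ * (1ℚ - (+ 1 / 4) * ((1ℚ + η) * (1ℚ + η))) - y₁ * (1ℚ - (+ 1 / 4) * (1ℚ + η)))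
      + (+ 2 / 1) * (η * y₂) + η * (η * y₂) - η * y₁ ≡ (+ 3 / 1) * (y₂ - y₁)
    lemma = solve-∀ ℚring

  -- A Kummer congruence for the exponents −2, p − 3, 2p − 4.
  Y₀-2Y₁+Y₂ : Div 3 (Y₀ - (+ 2 / 1) * Y₁ + Y₂)
  Y₀-2Y₁+Y₂ = Div-unit< 2 (ℕP.≤-trans (ℕP.m≤m+n 4 3) 7≤p) (subst (Div 3) (trans (cong (λ x → (+ 4 / 1) * x + (+ 2 / 1) * (η * (Y₂ - Y₁)) + η * (η * Y₂)) sums) (lemma Y₀ Y₁ Y₂ η))
    (Div-+ (Div-+ (Div-*ˡ (Int-ℕ 4) (Div-∑ h {λ j → Δ G₀ j + (- (+ 2 / 1) * Δ G₁ j + Δ G₂ j)} (λ j j<h → Differences.second-difference j j<h))) (Div-*ˡ (Int-ℕ 2) (Div-* Div-η Y₂-Y₁))) (Div-* Div-η (Div-* Div-η Div-Y₂))))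
    where
    sums : ∑ h (λ j → Δ G₀ j + (- (+ 2 / 1) * Δ G₁ j + Δ G₂ j))
      ≡ Y₀ * (1ℚ - (+ 1 / 4)) + (- (+ 2 / 1) * (Y₁ * (1ℚ - (+ 1 / 4) * (1ℚ + η))) + Y₂ * (1ℚ - (+ 1 / 4) * ((1ℚ + η) * (1ℚ + η))))
    sums = trans (∑-+ h (Δ G₀) (λ j → - (+ 2 / 1) * Δ G₁ j + Δ G₂ j)) (cong₂ _+_ (sym Y₀-Δ)
      (trans (∑-+ h (λ j → - (+ 2 / 1) * Δ G₁ j) (Δ G₂)) (cong₂ _+_ (trans (∑-*ˡ h (- (+ 2 / 1)) (Δ G₁)) (cong (- (+ 2 / 1) *_) (sym Y₁-Δ))) (sym Y₂-Δ))))
    lemma : ∀ y₀ y₁ y₂ η → (+ 4 / 1) * (y₀ * (1ℚ - (+ 1 / 4)) + (- (+ 2 / 1) * (y₁ * (1ℚ - (+ 1 / 4) * (1ℚ + η))) + y₂ * (1ℚ - (+ 1 / 4) * ((1ℚ + η) * (1ℚ + η)))))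
      + (+ 2 / 1) * (η * (y₂ - y₁)) + η * (η * y₂) ≡ (+ 3 / 1) * (y₀ - (+ 2 / 1) * y₁ + y₂)
    lemma = solve-∀ ℚring

  Y≡P𝓑 : ∀ n κ → 0 < n → κ * ℕ→ℚ n ≡ 1ℚ → κ * (S n - P * B n) ≡ κ * S n - P * 𝓑 n
  Y≡P𝓑 n κ 0<n κn = trans (cong (λ x → κ * (S n - P * x)) (B≡ n 0<n)) (trans (lemma₁ κ (S n) P (ℕ→ℚ n) (𝓑 n)) (trans (cong (λ x → κ * S n - x * (P * 𝓑 n)) κn) (cong (λ x → κ * S n - x) (ℚP.*-identityˡ (P * 𝓑 n)))))
    where
    lemma₁ : ∀ κ s p n b → κ * (s - p * (n * b)) ≡ κ * s - κ * n * (p * b)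
    lemma₁ = solve-∀ ℚring

  Y₁-P𝓑 : Div 3 (Y₁ - P * 𝓑 n₁)
  Y₁-P𝓑 = subst (Div 3) (trans (Y≡P𝓑 n₁ κ₁ (s≤s z≤n) (1/-inverse n₁)) (cong (_- P * 𝓑 n₁) (sym Y₁≡)))
    (Div-*ˡ (Int-1/ n₁ p∤n₁) (S≡PB-mod-p³ (2 ℕ.+ 2 ℕ.* r) (B-odd r) (Int-B< (2 ℕ.+ 2 ℕ.* r) (<p (s≤s (ℕP.m≤n+m (3 ℕ.+ 2 ℕ.* r) 3))))))

  -- The Bernoulli number of index 2p - 6 is integral because S at 2p - 6 is congruent modulo p to S
  -- at p - 5, which is 0.
  Y₂-P𝓑 : Div 3 (Y₂ - P * 𝓑 n₂)
  Y₂-P𝓑 = subst (Div 3) (trans (Y≡P𝓑 n₂ κ₂ (s≤s z≤n) (1/-inverse n₂)) (cong (_- P * 𝓑 n₂) (sym Y₂≡)))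
    (Div-*ˡ (Int-1/ n₂ p∤n₂) (S≡PB-mod-p³ (2 ℕ.+ 2 ℕ.* r ℕ.+ (p ∸ 1)) (B-odd′ (3 ℕ.+ 2 ℕ.* r) (trans (cong (λ n → 3 ℕ.+ 2 ℕ.* r ℕ.+ n) p∸1≡) (lemma r)))
      (Int-B (1 ℕ.+ 2 ℕ.* r ℕ.+ (p ∸ 1)) (Div-S-periodic (1 ℕ.+ 2 ℕ.* r) (<p (s≤s (ℕP.m≤n+m (3 ℕ.+ 2 ℕ.* r) 3)))))))
    where
    lemma : ∀ r → 3 ℕ.+ 2 ℕ.* r ℕ.+ (6 ℕ.+ 2 ℕ.* r) ≡ 3 ℕ.+ 2 ℕ.* (3 ℕ.+ 2 ℕ.* r)
    lemma = ℕR.solve-∀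

  -- The congruence for `A⋆ p 2`

  1+[p∸2] : 1 ℕ.+ (5 ℕ.+ 2 ℕ.* r) ≡ p ∸ 1
  1+[p∸2] = sym p∸1≡

  -- Wolstenholme's theorem. Modulo p² the complementary `A p (p − 2)` is `P * 𝓑 (p − 2)` up to
  -- sign, and the index `p − 2` is odd.
  A⋆₁ : Div 2 (A⋆ p 1)
  A⋆₁ = subst (Div 2) (sym (A⋆≡ 1 (5 ℕ.+ 2 ℕ.* r) 1+[p∸2])) (Div-+ (Div-neg A-odd) (Div-* wilson (Div-A⋆ 1 (5 ℕ.+ 2 ℕ.* r) 1+[p∸2] (Div-≤ (s≤s z≤n) A-odd))))
    where
    lemma₁ : ∀ s p i a → a - s * (p * (0ℚ * i)) ≡ a
    lemma₁ = solve-∀ ℚring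
    lemma₂ : ∀ r → 5 ℕ.+ 2 ℕ.* r ≡ 3 ℕ.+ 2 ℕ.* (1 ℕ.+ r)
    lemma₂ = ℕR.solve-∀
    A-odd : Div 2 (A p (5 ℕ.+ 2 ℕ.* r))
    A-odd = subst (Div 2) (trans (cong (λ x → A p (5 ℕ.+ 2 ℕ.* r) - (- 1ℚ) ^ (4 ℕ.+ 2 ℕ.* r) * (P * (x * (+ 1 / (5 ℕ.+ 2 ℕ.* r))))) (B-odd′ (1 ℕ.+ r) (lemma₂ r)))
        (lemma₁ ((- 1ℚ) ^ (4 ℕ.+ 2 ℕ.* r)) P (+ 1 / (5 ℕ.+ 2 ℕ.* r)) (A p (5 ℕ.+ 2 ℕ.* r))))
      (A-mod-p² (4 ℕ.+ 2 ℕ.* r) (<p ℕP.≤-refl))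

  -- By Newton's identity for the reciprocals, twice this difference is the square of `A⋆ p 1`,
  -- which Wolstenholme's theorem makes divisible by p⁴.
  A⋆₂-Y₀ : Div 3 (A⋆ p 2 - Y₀)
  A⋆₂-Y₀ = Div-unit< 1 2<p (subst (Div 3) (sym combine) (Div-≤ (s≤s (s≤s (s≤s z≤n))) (Div-* A⋆₁ A⋆₁)))
    where
    open ≡-Reasoning
    L⋆ : List ℚ
    L⋆ = map (λ i → + 1 / suc i) (upTo (p ∸ 1))
    psum₁ : psum 1 L⋆ ≡ A⋆ p 1
    psum₁ = trans (lemma (psum 1 L⋆)) (trans (sym (newton L⋆ 0)) (ℚP.*-identityˡ (A⋆ p 1)))
      where
      lemma : ∀ x → x ≡ 1ℚ * x * 1ℚ
      lemma = solve-∀ ℚring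
    H : ℚ
    H = ∑ (p ∸ 1) (λ i → (+ 1 / suc i) ^ 2)
    lemma₁ : ∀ a y → (+ 2 / 1) * (a - y) ≡ (+ 2 / 1) * a - (+ 2 / 1) * y
    lemma₁ = solve-∀ ℚring
    lemma₂ : ∀ e x → 1ℚ * e * e + (- 1ℚ * 1ℚ * x) * 1ℚ - (+ 2 / 1) * ((- (+ 1 / 2)) * x) ≡ e * e
    lemma₂ = solve-∀ ℚring
    combine : (+ 2 / 1) * (A⋆ p 2 - Y₀) ≡ A⋆ p 1 * A⋆ p 1
    combine = begin
      (+ 2 / 1) * (A⋆ p 2 - Y₀)
        ≡⟨ lemma₁ (A⋆ p 2) Y₀ ⟩
      (+ 2 / 1) * A⋆ p 2 - (+ 2 / 1) * Y₀
        ≡⟨ cong₂ (λ x x′ → x - (+ 2 / 1) * x′) (newton L⋆ 1) (∑-*ˡ (p ∸ 1) (- (+ 1 / 2)) (λ i → (+ 1 / suc i) ^ 2)) ⟩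
      1ℚ * psum 1 L⋆ * A⋆ p 1 + (- 1ℚ * 1ℚ * psum 2 L⋆) * 1ℚ - (+ 2 / 1) * ((- (+ 1 / 2)) * H)
        ≡⟨ cong₂ (λ x x′ → 1ℚ * x * A⋆ p 1 + (- 1ℚ * 1ℚ * x′) * 1ℚ - (+ 2 / 1) * ((- (+ 1 / 2)) * H)) psum₁ (psum-upTo 2 (λ i → + 1 / suc i) (p ∸ 1)) ⟩
      1ℚ * A⋆ p 1 * A⋆ p 1 + (- 1ℚ * 1ℚ * H) * 1ℚ - (+ 2 / 1) * ((- (+ 1 / 2)) * H)
        ≡⟨ lemma₂ (A⋆ p 1) H ⟩
      A⋆ p 1 * A⋆ p 1 ∎

  -- Modulo p³, `A⋆ p 2 ≡ Y₀ ≡ 2 Y₁ − Y₂ ≡ P (2 𝓑 n₁ − 𝓑 n₂)`; the factor `z` supplies the fourth p.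
  A⋆₂-mod-p⁴ : A⋆ p 2 ≈ - A p (p ∸ 3) + ℕ→ℚ (p ℕ.^ 2) * w p * (ℕ→ℚ 2 * 𝓑 (p ∸ 3) - 𝓑 (2 ℕ.* p ∸ 4))
  A⋆₂-mod-p⁴ = mod-p⁴ (subst₂ (λ m n → Div 4 (A⋆ p 2 - (- A p m + ℕ→ℚ (p ℕ.^ 2) * w p * (ℕ→ℚ 2 * 𝓑 m - 𝓑 n)))) (sym p∸3≡) (sym 2p∸4≡)
    (subst (λ x → Div 4 (A⋆ p 2 - (- A p n₁ + x * w p * (ℕ→ℚ 2 * 𝓑 n₁ - 𝓑 n₂)))) (sym (ℕ→ℚ-^ p 2))
      (subst (Div 4) (sym (trans (cong (_- (- A p n₁ + P ^ 2 * w p * (ℕ→ℚ 2 * 𝓑 n₁ - 𝓑 n₂))) (A⋆≡ 2 n₁ (sym p∸1≡))) (lemma₁ (A p n₁) P (w p) (A⋆ p 2) (𝓑 n₁) (𝓑 n₂) Y₀ Y₁ Y₂)))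
        (Div-* wilson (Div-- (Div-+ (Div-+ A⋆₂-Y₀ Y₀-2Y₁+Y₂) (Div-*ˡ (Int-ℕ 2) Y₁-P𝓑)) Y₂-P𝓑)))))
    where
    p∸3≡ : p ∸ 3 ≡ n₁
    p∸3≡ = cong (_∸ 3) p≡
    2p∸4≡ : 2 ℕ.* p ∸ 4 ≡ n₂
    2p∸4≡ = trans (cong (_∸ 4) (trans (cong (2 ℕ.*_) p≡) (lemma r))) (cong (n₁ ℕ.+_) (sym p∸1≡))
      where
      lemma : ∀ r → 2 ℕ.* (7 ℕ.+ 2 ℕ.* r) ≡ 4 ℕ.+ (4 ℕ.+ 2 ℕ.* r ℕ.+ (6 ℕ.+ 2 ℕ.* r))
      lemma = ℕR.solve-∀
    lemma₁ : ∀ a p w t b₁ b₂ y₀ y₁ y₂ → (- a + p * w * t) - (- a + p * (p * 1ℚ) * w * ((+ 2 / 1) * b₁ - b₂))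
      ≡ p * w * (((t - y₀) + (y₀ - (+ 2 / 1) * y₁ + y₂)) + (+ 2 / 1) * (y₁ - p * b₁) - (y₂ - p * b₂))
    lemma₁ = solve-∀ ℚring

theorem2 : (p : ℕ) → .{{_ : ℕ.NonZero p}} → Prime p → 7 ≤ p →
    ((n : ℕ) → 4 ≤ 2 ℕ.* n → 2 ℕ.* n ≤ p ∸ 7 →
    A⋆ p (2 ℕ.* n) ≡
    - A p (p ∸ 1 ∸ 2 ℕ.* n)
    + ℕ→ℚ (p ℕ.^ 2) * w p * (1ℚ + ℕ→ℚ p * w p) * 𝓑 (p ∸ 1 ∸ 2 ℕ.* n)
    - ℕ→ℚ (p ℕ.^ 3) * w p * (+ 1 / 2) * 𝓒 (p ∸ 1 ∸ 2 ℕ.* n)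
    [mod p ^ 4 ])
    × (A⋆ p 2 ≡ - A p (p ∸ 3) + ℕ→ℚ (p ℕ.^ 2) * w p * (ℕ→ℚ 2 * 𝓑 (p ∸ 3) - 𝓑 (2 ℕ.* p ∸ 4))
    [mod p ^ 4 ])
    × (11 ≤ p →
    A⋆ p (p ∸ 5) ≡
    (+ 1 / 8) * (ℕ→ℚ (5 ℕ.* p ℕ.^ 3) * (+ 1 / 4) - ℕ→ℚ p * (+ 1 / 15) - ℕ→ℚ (p ℕ.^ 2) * (+ 1 / 36))
    + ℕ→ℚ p * w p * (+ 1 / 120)
    * (ℕ→ℚ (7 ℕ.* p ℕ.^ 2) * (+ 1 / 12) - ℕ→ℚ p * (1ℚ + ℕ→ℚ p * AG p))
    [mod p ^ 4 ])
    × (A⋆ p (p ∸ 3) ≡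
    (+ 1 / 24) * (ℕ→ℚ (p ℕ.* (2 ℕ.* p ∸ 1) ℕ.* (5 ℕ.* p ∸ 2))
    + ℕ→ℚ p * w p * (ℕ→ℚ (2 ℕ.* p) - ℕ→ℚ (11 ℕ.* p ℕ.^ 2) + ℕ→ℚ (2 ℕ.* p ℕ.^ 2) * AG p))
    [mod p ^ 4 ])
    × (A⋆ p (p ∸ 1) ≡
    - 1ℚ + ℕ→ℚ p * w p
    * (ℕ→ℚ 3 * (ℕ→ℚ p * 𝓑 (p ∸ 1) - 1ℚ) - ℕ→ℚ p * 𝓑 (2 ℕ.* (p ∸ 1))
    - (+ 1 / 2) * ℕ→ℚ (p ℕ.^ 2) * (𝓑 (p ∸ 1) * 𝓑 (p ∸ 1)))
    [mod p ^ 4 ])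
theorem2 p pr 7≤p = (λ n 4≤2n 2n≤p∸7 → ≈⇒mod p pr 7≤p (A⋆-even-mod-p⁴ p pr 7≤p n 4≤2n 2n≤p∸7))
  , ≈⇒mod p pr 7≤p (A⋆₂-mod-p⁴ p pr 7≤p)
  , (λ _ → ≈⇒mod p pr 7≤p (A⋆[p∸5]-mod-p⁴ p pr 7≤p))
  , ≈⇒mod p pr 7≤p (A⋆[p∸3]-mod-p⁴ p pr 7≤p)
  , ≈⇒mod p pr 7≤p (A⋆[p∸1]-mod-p⁴ p pr 7≤p)
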